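{- Let $\Phi\in\mathrm{End}(\mathcal{Q})$ and $n\ge0$. Suppose that for every $m\le n$ with $\lambda_m\neq0$ we have $\lambda_m\neq\lambda_\beta$ for all $\beta\in\operatorname{Comp}(m)\setminus\{(m)\}$, and suppose that $\operatorname{rank}(\Phi_n)=\#\{\alpha\in\operatorname{Comp}(n):\lambda_\alpha\neq0\}$. Then $\Phi_n$ is diagonalizable, and so is the operator $W\mapsto (X^\Phi)_n\cdot W$ on $\mathcal{D}_n$.
   Context: Work over $\mathbb{Q}$. Compositions $\alpha=(a_1,\dots,a_k)$ of $n$, $\operatorname{Comp}(n)$, $S_\alpha=\{a_1,\dots,a_1+\dots+a_{k-1}\}$, $\operatorname{co}=$ inverse of $\alpha\mapsto S_\alpha$, order $\alpha\le\beta$ iff $S_\alpha\subseteq S_\beta$. $M_\alpha=\sum_{i_1<\dots<i_k}x_{i_1}^{a_1}\cdots x_{i_k}^{a_k}$, $\mathcal{Q}_n=\operatorname{span}\{M_\alpha:\alpha\in\operatorname{Comp}(n)\}$, $\mathcal{Q}=\bigoplus_n\mathcal{Q}_n$ the graded Hopf algebra of quasisymmetric functions (coproduct $\Delta(M_\alpha)=\sum_{\alpha=\beta\cdot\gamma}M_\beta\otimes M_\gamma$), $F_\alpha=\sum_{\beta\ge\alpha}M_\beta$. $\mathrm{End}(\mathcal{Q})$ = graded Hopf algebra endomorphisms; $\Phi_n=\Phi|_{\mathcal{Q}_n}$. For $\sigma\in\mathfrak{S}_n$, $D(\sigma)=\operatorname{co}(\{i:\sigma_i>\sigma_{i+1}\})$.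 In $\mathbb{Q}[\mathfrak{S}_n]$ let $Y_\alpha=\sum_{D(\sigma)=\alpha}\sigma$, $X_\alpha=\sum_{D(\sigma)\le\alpha}\sigma$; their span $\mathcal{D}_n$ is a subalgebra (descent algebra). Pairing $\mathcal{D}_n\times\mathcal{Q}_n\to\mathbb{Q}$: $\langle X_\alpha,M_\beta\rangle=\delta_{\alpha\beta}$ (equivalently $\langle Y_\alpha,F_\beta\rangle=\delta_{\alpha\beta}$). For $\Phi\in\mathrm{End}(\mathcal{Q})$, $(X^\Phi)_n\in\mathcal{D}_n$ is defined by $\langle (X^\Phi)_n,G\rangle=\langle X_{(n)},\Phi(G)\rangle$ for $G\in\mathcal{Q}_n$ (here $X_{(n)}$ is the identity permutation; equivalently $\langle (X^\Phi)_n,G\rangle=\Phi(G)(1,0,0,\dots)$). Set $\lambda_m=\langle (X^\Phi)_m,M_{(m)}\rangle$ and $\lambda_\alpha=\lambda_{a_1}\cdots\lambda_{a_k}$ for $\alpha=(a_1,\dots,a_k)$. -}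

module Defs where

open import Data.Nat as ℕ using (ℕ; zero; suc; _≡ᵇ_; _<ᵇ_)
open import Data.Bool using (Bool; true; false; if_then_else_; _∧_; _∨_; not)
open import Data.List using (List; []; _∷_; _++_; map; concatMap; foldr; take; drop; length; filter; upTo)
open import Data.List.Membership.Propositional using (_∈_)
import Data.Nat.ListAction
open import Data.Fin using (Fin)
import Data.Fin as Fin
open import Data.Rational using (ℚ; 0ℚ; 1ℚ; _+_; _*_)
open import Data.Rational.Properties using (_≟_)
open import Data.Product using (Σ; _×_)
open import Relation.Nullary using (¬_; does)
open import Relation.Binary.PropositionalEquality using (_≡_; _≢_)

-- Compositions are lists of positive naturals.  comps n enumerates
-- Comp(n) (each exactly once): a composition of n+2 is either 1 ∷ α or
-- α with first part increased, for α a composition of n+1.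

incFirst : List ℕ → List ℕ
incFirst []      = []
incFirst (a ∷ α) = suc a ∷ α

comps : ℕ → List (List ℕ)
comps zero          = [] ∷ []
comps (suc zero)    = (1 ∷ []) ∷ []
comps (suc (suc n)) = concatMap (λ α → (1 ∷ α) ∷ incFirst α ∷ []) (comps (suc n))

single : ℕ → List ℕ
single zero    = []
single (suc n) = suc n ∷ []

eqL : List ℕ → List ℕ → Bool
eqL []       []       = true
eqL (x ∷ xs) (y ∷ ys) = (x ≡ᵇ y) ∧ eqL xs ys
eqL _        _        = false

memB : ℕ → List ℕ → Bool
memB x []       = false
memB x (y ∷ ys) = (x ≡ᵇ y) ∨ memB x ys

subsetB : List ℕ → List ℕ → Bool
subsetB []       ys = true
subsetB (x ∷ xs) ys = memB x ys ∧ subsetB xs ys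

ind : Bool → ℚ
ind b = if b then 1ℚ else 0ℚ

Σ[_]_ : {A : Set} → List A → (A → ℚ) → ℚ
Σ[ xs ] f = foldr (λ x r → f x + r) 0ℚ xs

sumFin : (k : ℕ) → (Fin k → ℚ) → ℚ
sumFin zero    f = 0ℚ
sumFin (suc k) f = f Fin.zero + sumFin k (λ i → f (Fin.suc i))

-- Quasi-shuffles (as a list with multiplicities):
-- M_α M_β = Σ_{γ ∈ qsh α β} M_γ.

qsh : List ℕ → List ℕ → List (List ℕ)
qsh []       b        = b ∷ []
qsh (x ∷ a)  []       = (x ∷ a) ∷ []
qsh (x ∷ a) (y ∷ b)   =
  map (x ∷_) (qsh a (y ∷ b)) ++ map (y ∷_) (qsh (x ∷ a) b) ++ map ((x ℕ.+ y) ∷_) (qsh a b)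

-- A graded linear endomorphism Φ of 𝒬 is given by its matrix in the
-- monomial basis:  Φ(M_β) = Σ_{α ∈ Comp(|β|)} Φ α β · M_α
-- (only entries with α, β compositions of the same n are used).

Mat : Set
Mat = List ℕ → List ℕ → ℚ

record IsHopfEnd (Φ : Mat) : Set where
  field
    -- Φ(1) = 1  (unit; this is also counit preservation, by gradedness)
    unit   : Φ [] [] ≡ 1ℚ
    -- Φ(M_β M_γ) = Φ(M_β) Φ(M_γ), compared coefficientwise at M_α
    mult   : ∀ p q β γ α → β ∈ comps p → γ ∈ comps q → α ∈ comps (p ℕ.+ q) →
             Σ[ qsh β γ ] (λ δ → Φ α δ)
               ≡ Σ[ comps p ] (λ α₁ → Σ[ comps q ] (λ α₂ →
                   (Φ α₁ β * Φ α₂ γ) * Σ[ qsh α₁ α₂ ] (λ ε → ind (eqL ε α))))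
    -- Δ(Φ(M_β)) = (Φ ⊗ Φ)(Δ M_β), compared at M_α₁ ⊗ M_α₂
    comult : ∀ p q α₁ α₂ β → α₁ ∈ comps p → α₂ ∈ comps q → β ∈ comps (p ℕ.+ q) →
             Φ (α₁ ++ α₂) β
               ≡ Σ[ upTo (suc (length β)) ] (λ i →
                   ind (Data.Nat.ListAction.sum (take i β) ≡ᵇ p) * (Φ α₁ (take i β) * Φ α₂ (drop i β)))

-- λ_m = ⟨(X^Φ)_m, M_(m)⟩ = ⟨X_(m), Φ(M_(m))⟩ = coefficient of M_(m) in Φ(M_(m))
lam : Mat → ℕ → ℚ
lam Φ m = Φ (single m) (single m)

lamC : Mat → List ℕ → ℚ
lamC Φ α = foldr (λ a r → lam Φ a * r) 1ℚ α

nonzeroCount : Mat → ℕ → ℕ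
nonzeroCount Φ n = length (filter (λ α → Relation.Nullary.¬? (lamC Φ α ≟ 0ℚ)) (comps n))

-- Finite-dimensional linear algebra over ℚ.  Vectors are functions
-- List ℕ → ℚ, compared pointwise on a finite "support" list L
-- (L = Comp(n) for 𝒬_n in the M-basis, L = 𝔖_n for ℚ[𝔖_n]).

Vect : Set
Vect = List ℕ → ℚ

_≈[_]_ : Vect → List (List ℕ) → Vect → Set
f ≈[ L ] g = ∀ x → x ∈ L → f x ≡ g x

zeroV : Vect
zeroV _ = 0ℚ

lin : List (List ℕ) → (List ℕ → ℚ) → (List ℕ → Vect) → Vect
lin I a b x = Σ[ I ] (λ γ → a γ * b γ x)

IndepFin : List (List ℕ) → (k : ℕ) → (Fin k → Vect) → Set
IndepFin L k v = ∀ (a : Fin k → ℚ) → (λ x → sumFin k (λ i → a i * v i x)) ≈[ L ] zeroV →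
                 ∀ i → a i ≡ 0ℚ

InSpan : List (List ℕ) → (List ℕ → Vect) → List (List ℕ) → Vect → Set
InSpan I gen L v = Σ (List ℕ → ℚ) (λ c → v ≈[ L ] lin I c gen)

HasRank : List (List ℕ) → (List ℕ → Vect) → List (List ℕ) → (Vect → Vect) → ℕ → Set
HasRank I gen L T r =
  Σ (Fin r → (List ℕ → ℚ)) (λ c → IndepFin L r (λ i → T (lin I (c i) gen)))
  × (∀ (c : Fin (suc r) → (List ℕ → ℚ)) → ¬ IndepFin L (suc r) (λ i → T (lin I (c i) gen)))

Diagonalizable : List (List ℕ) → (List ℕ → Vect) → List (List ℕ) → (Vect → Vect) → Set
Diagonalizable I gen L T =
  Σ (List ℕ → Vect) (λ b → Σ (List ℕ → ℚ) (λ μ →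
      (∀ γ → γ ∈ I → InSpan I gen L (b γ))
    × (∀ (a : List ℕ → ℚ) → lin I a b ≈[ L ] zeroV → ∀ γ → γ ∈ I → a γ ≡ 0ℚ)
    × (∀ (c : List ℕ → ℚ) → InSpan I b L (lin I c gen))
    × (∀ γ → γ ∈ I → T (b γ) ≈[ L ] (λ x → μ γ * b γ x))))

unitV : List ℕ → Vect
unitV δ x = ind (eqL x δ)

applyΦ : Mat → ℕ → Vect → Vect
applyΦ Φ n v α = Σ[ comps n ] (λ β → Φ α β * v β)

-- ℚ[𝔖_n]: permutations in one-line notation (lists of 1..n).

insertAll : ℕ → List ℕ → List (List ℕ)
insertAll x []       = (x ∷ []) ∷ []
insertAll x (y ∷ ys) = (x ∷ y ∷ ys) ∷ map (y ∷_) (insertAll x ys)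

perms : ℕ → List (List ℕ)
perms zero    = [] ∷ []
perms (suc n) = concatMap (insertAll (suc n)) (perms n)

-- σ_i (1-based), default 0
at : List ℕ → ℕ → ℕ
at []       _             = 0
at (x ∷ xs) zero          = 0
at (x ∷ xs) (suc zero)    = x
at (x ∷ xs) (suc (suc i)) = at xs (suc i)

compose : List ℕ → List ℕ → List ℕ
compose σ τ = map (at σ) τ

mulS : ℕ → Vect → Vect → Vect
mulS n f g π = Σ[ perms n ] (λ σ → Σ[ perms n ] (λ τ →
                 ind (eqL (compose σ τ) π) * (f σ * g τ)))

desFrom : ℕ → List ℕ → List ℕ
desFrom i []           = []
desFrom i (x ∷ [])     = []
desFrom i (x ∷ y ∷ ys) = (if y <ᵇ x then i ∷ [] else []) ++ desFrom (suc i) (y ∷ ys)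

des : List ℕ → List ℕ
des σ = desFrom 1 σ

partialFrom : ℕ → List ℕ → List ℕ
partialFrom s []           = []
partialFrom s (a ∷ [])     = []
partialFrom s (a ∷ b ∷ bs) = (s ℕ.+ a) ∷ partialFrom (s ℕ.+ a) (b ∷ bs)

setOf : List ℕ → List ℕ
setOf α = partialFrom 0 α

Yel : List ℕ → Vect
Yel α σ = ind (eqL (des σ) (setOf α))

Xel : List ℕ → Vect
Xel α σ = ind (subsetB (des σ) (setOf α))

-- (X^Φ)_n = Σ_α ⟨(X^Φ)_n, M_α⟩ X_α ,  ⟨(X^Φ)_n, M_α⟩ = ⟨X_(n), Φ(M_α)⟩ = Φ (n) α
XPhi : Mat → ℕ → Vect
XPhi Φ n = lin (comps n) (λ α → Φ (single n) α) Xel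

{-# OPTIONS --safe #-}
module Submission where

-- In the monomial basis Φ_n is triangular for refinement with diagonal entries λ_α.  Dually, Φ acts
-- multiplicatively on the generators X_(m); when λ_m ≠ 0 the separation hypothesis makes a triangular
-- system solvable and gives a λ_m-eigenvector X_(m) + …, and products of these are independent left
-- eigenvectors of Φ_n, one for each α with λ_α ≠ 0.  By the rank hypothesis Φ_n vanishes on a complement,
-- so that Φ_n = R Λ L with Λ diagonal and R inverse to L.
--
-- For the descent algebra, (X^Φ)_n · X_β evaluated at π is the sum of (X^Φ)_n over the shuffles of the
-- segments of π cut out by β.  By the product rule for the F_α and multiplicativity of the character
-- ζ(G) = Φ(G)(1,0,0,…) it equals Σ_γ Φ_{βγ} X_γ(π); left multiplication by (X^Φ)_n is therefore the
-- transpose of Φ_n in the basis X, and the rows of L give its eigenvectors.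

open import Defs
open import Data.Nat as ℕ using (ℕ; zero; suc; _≤_; _<_; z≤n; s≤s; _≡ᵇ_; _<ᵇ_; _∸_)
import Data.Nat.Properties as ℕₚ
open import Data.Nat.ListAction using (sum)
open import Data.Bool using (Bool; true; false; if_then_else_; _∧_; not; T)
import Data.Bool.Properties as 𝔹ₚ
open import Data.List using (List; []; _∷_; _++_; map; concatMap; take; drop; length; filter; upTo; applyUpTo; lookup; downFrom)
import Data.List.Properties as Listₚ
open import Data.List.Membership.Propositional using (_∈_; _∉_)
import Data.List.Membership.Propositional.Properties as ∈ₚ
open import Data.List.Relation.Unary.Any using (here; there)
open import Data.List.Relation.Unary.All as All using (All; []; _∷_)
import Data.List.Relation.Unary.All.Properties as Allₚ
open import Data.List.Relation.Unary.AllPairs using ([]; _∷_)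
open import Data.List.Relation.Unary.Unique.Propositional using (Unique)
import Data.List.Relation.Unary.Unique.Propositional.Properties as Uniqueₚ
open import Data.List.Relation.Binary.Permutation.Propositional as Perm using (_↭_; ↭-refl; ↭-sym; ↭-trans; ↭-reflexive; ↭⇒↭ₛ)
import Data.List.Relation.Binary.Permutation.Propositional.Properties as ↭ₚ
import Data.List.Relation.Binary.Permutation.Setoid.Properties as ↭ₛₚ
open import Data.List.Membership.DecPropositional ℕ._≟_ using (_∈?_)
open import Data.Fin as Fin using (Fin)
import Data.Fin.Properties as Finₚ
open import Data.Rational using (ℚ; 0ℚ; 1ℚ; _+_; _*_; _-_; -_)
import Data.Rational.Properties as ℚₚ
open import Data.Rational.Properties using (_≟_)
open import Data.Rational.Solver using (module +-*-Solver)
open import Data.Product using (Σ; ∃; _×_; _,_; proj₁; proj₂)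
open import Data.Sum using (_⊎_; inj₁; inj₂)
open import Data.Empty using (⊥-elim)
open import Data.Unit using (tt)
open import Function using (_∘_; id; case_of_)
open import Relation.Nullary using (¬_; Dec; yes; no; contradiction; does; ¬?)
open import Relation.Binary.PropositionalEquality hiding (J)
open +-*-Solver using (solve; _:+_; _:*_; _:-_; :-_; con; _:=_)
open ≡-Reasoning
open import Relation.Binary.Bundles using (Setoid)
import Relation.Binary.Reasoning.Setoid as SetoidReasoning

-- Φ_n is triangular, but its diagonal entries repeat as soon as two compositions have the same
-- parts in another order, so eigenvectors cannot be found by solving one triangular system per
-- diagonal entry. The separation hypothesis speaks only of one-part compositions; multiplicativity
-- carries the solutions from there to all products. It is available on the dual side, where
-- deconcatenation becomes concatenation, hence the left eigenvectors. Where λ_α = 0 nothing so far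
-- prevents a nonzero nilpotent block. The nonzero diagonal entries already account for the whole
-- rank, so the rank hypothesis leaves no room for it. In the descent algebra, (X^Φ)_n records only
-- the row of Φ at the one-part composition (n). Multiplication by X_β recovers the row at β:
-- compatibility with the coproduct builds that row from one-part rows, and compatibility with the
-- product turns sums over shuffles into products of character values.

private variable
  X Y : Set

-- Finite sums over lists.

-- An opaque copy of Σ[_]_, so that unification can read off the summand.
opaque
  ∑ : List X → (X → ℚ) → ℚ
  ∑ xs f = Σ[ xs ] f

  ∑-def : (xs : List X) (f : X → ℚ) → Σ[ xs ] f ≡ ∑ xs f
  ∑-def xs f = refl

  ∑-[] : (f : X → ℚ) → ∑ [] f ≡ 0ℚ
  ∑-[] f = refl

  ∑-∷ : (x : X) (xs : List X) (f : X → ℚ) → ∑ (x ∷ xs) f ≡ f x + ∑ xs f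
  ∑-∷ x xs f = refl

opaque
  unfolding ∑

  Σ-cong : {f g : X → ℚ} (xs : List X) → (∀ x → x ∈ xs → f x ≡ g x) → ∑ xs f ≡ ∑ xs g
  Σ-cong []       _ = refl
  Σ-cong (x ∷ xs) h = cong₂ _+_ (h x (here refl)) (Σ-cong xs (λ y → h y ∘ there))

  Σ-ext : {f g : X → ℚ} (xs : List X) → (∀ x → f x ≡ g x) → ∑ xs f ≡ ∑ xs g
  Σ-ext xs h = Σ-cong xs (λ x _ → h x)

  Σ-0 : (xs : List X) {f : X → ℚ} → (∀ x → x ∈ xs → f x ≡ 0ℚ) → ∑ xs f ≡ 0ℚ
  Σ-0 []       _ = refl
  Σ-0 (x ∷ xs) h = trans (cong₂ _+_ (h x (here refl)) (Σ-0 xs (λ y → h y ∘ there))) (ℚₚ.+-identityˡ 0ℚ)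

  +-interchange : ∀ a b c d → (a + b) + (c + d) ≡ (a + c) + (b + d)
  +-interchange = solve 4 (λ a b c d → (a :+ b) :+ (c :+ d) := (a :+ c) :+ (b :+ d)) refl

  Σ-+ : (xs : List X) (f g : X → ℚ) → ∑ xs (λ x → f x + g x) ≡ ∑ xs f + ∑ xs g
  Σ-+ []       f g = sym (ℚₚ.+-identityˡ 0ℚ)
  Σ-+ (x ∷ xs) f g = trans (cong (f x + g x +_) (Σ-+ xs f g)) (+-interchange (f x) (g x) _ _)

  Σ-*ˡ : (xs : List X) (c : ℚ) (f : X → ℚ) → ∑ xs (λ x → c * f x) ≡ c * ∑ xs f
  Σ-*ˡ []       c f = sym (ℚₚ.*-zeroʳ c)
  Σ-*ˡ (x ∷ xs) c f = trans (cong (c * f x +_) (Σ-*ˡ xs c f)) (sym (ℚₚ.*-distribˡ-+ c (f x) _))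

  Σ-*ʳ : (xs : List X) (c : ℚ) (f : X → ℚ) → ∑ xs (λ x → f x * c) ≡ ∑ xs f * c
  Σ-*ʳ xs c f = trans (Σ-ext xs (λ x → ℚₚ.*-comm (f x) c)) (trans (Σ-*ˡ xs c f) (ℚₚ.*-comm c _))

  Σ-swap : (xs : List X) (ys : List Y) (f : X → Y → ℚ) →
           ∑ xs (λ x → ∑ ys (f x)) ≡ ∑ ys (λ y → ∑ xs (λ x → f x y))
  Σ-swap []       ys f = sym (Σ-0 ys (λ _ _ → refl))
  Σ-swap (x ∷ xs) ys f = trans (cong (∑ ys (f x) +_) (Σ-swap xs ys f)) (sym (Σ-+ ys (f x) _))

  Σ-++ : (xs ys : List X) (f : X → ℚ) → ∑ (xs ++ ys) f ≡ ∑ xs f + ∑ ys f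
  Σ-++ []       ys f = sym (ℚₚ.+-identityˡ _)
  Σ-++ (x ∷ xs) ys f = trans (cong (f x +_) (Σ-++ xs ys f)) (sym (ℚₚ.+-assoc (f x) _ _))

  Σ-map : (g : X → Y) (xs : List X) (f : Y → ℚ) → ∑ (map g xs) f ≡ ∑ xs (f ∘ g)
  Σ-map g []       f = refl
  Σ-map g (x ∷ xs) f = cong (f (g x) +_) (Σ-map g xs f)

  Σ-concatMap : (g : X → List Y) (xs : List X) (f : Y → ℚ) →
                ∑ (concatMap g xs) f ≡ ∑ xs (λ x → ∑ (g x) f)
  Σ-concatMap g []       f = refl
  Σ-concatMap g (x ∷ xs) f = trans (Σ-++ (g x) _ f) (cong (∑ (g x) f +_) (Σ-concatMap g xs f))

  Σ-upTo-suc : (k : ℕ) (f : ℕ → ℚ) → ∑ (upTo (suc k)) f ≡ f 0 + ∑ (upTo k) (f ∘ suc)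
  Σ-upTo-suc k f = cong (f 0 +_) (trans (cong (λ l → ∑ l f) (sym (Listₚ.map-applyUpTo id suc k))) (Σ-map suc (upTo k) f))

-- Booleans, indicators and the Kronecker matrix.

T⇒≡ : {b : Bool} → T b → b ≡ true
T⇒≡ {true} _ = refl

≡⇒T : {b : Bool} → b ≡ true → T b
≡⇒T refl = tt

≡ᵇ-refl : ∀ n → (n ≡ᵇ n) ≡ true
≡ᵇ-refl n = T⇒≡ (ℕₚ.≡⇒≡ᵇ n n refl)

≡ᵇ⇒≡ : ∀ m n → (m ≡ᵇ n) ≡ true → m ≡ n
≡ᵇ⇒≡ m n e = ℕₚ.≡ᵇ⇒≡ m n (≡⇒T e)

∧-split : ∀ a {b} → a ∧ b ≡ true → a ≡ true × b ≡ true
∧-split true {true} _ = refl , refl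

≢true : {b : Bool} → b ≢ true → b ≡ false
≢true {true}  h = contradiction refl h
≢true {false} h = refl

ind-∧ : ∀ a b → ind (a ∧ b) ≡ ind a * ind b
ind-∧ true  b = sym (ℚₚ.*-identityˡ (ind b))
ind-∧ false b = sym (ℚₚ.*-zeroˡ (ind b))

0* : ∀ {a} b → a ≡ 0ℚ → a * b ≡ 0ℚ
0* b refl = ℚₚ.*-zeroˡ b

*0 : ∀ a {b} → b ≡ 0ℚ → a * b ≡ 0ℚ
*0 a refl = ℚₚ.*-zeroʳ a

ind-false* : ∀ {b} q → b ≡ false → ind b * q ≡ 0ℚ
ind-false* q refl = ℚₚ.*-zeroˡ q

ind-true* : ∀ {b} q → b ≡ true → ind b * q ≡ q
ind-true* q refl = ℚₚ.*-identityˡ q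

ind-cong* : ∀ b {p q} → (b ≡ true → p ≡ q) → ind b * p ≡ ind b * q
ind-cong* true  h = cong (1ℚ *_) (h refl)
ind-cong* false {p} {q} h = trans (ℚₚ.*-zeroˡ p) (sym (ℚₚ.*-zeroˡ q))

eqL-refl : ∀ x → eqL x x ≡ true
eqL-refl []       = refl
eqL-refl (a ∷ x) rewrite ≡ᵇ-refl a = eqL-refl x

eqL⇒≡ : ∀ x y → eqL x y ≡ true → x ≡ y
eqL⇒≡ []      []      _ = refl
eqL⇒≡ (a ∷ x) (b ∷ y) e with ∧-split (a ≡ᵇ b) e
... | p , q = cong₂ _∷_ (≡ᵇ⇒≡ a b p) (eqL⇒≡ x y q)

eqL-≢ : ∀ {x y} → x ≢ y → eqL x y ≡ false
eqL-≢ {x} {y} h = ≢true (h ∘ eqL⇒≡ x y)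

eqL-sym : ∀ x y → eqL x y ≡ eqL y x
eqL-sym []      []      = refl
eqL-sym []      (_ ∷ _) = refl
eqL-sym (_ ∷ _) []      = refl
eqL-sym (a ∷ x) (b ∷ y) = cong₂ _∧_ (≡ᵇ-sym a b) (eqL-sym x y)
  where
  ≡ᵇ-sym : ∀ a b → (a ≡ᵇ b) ≡ (b ≡ᵇ a)
  ≡ᵇ-sym zero    zero    = refl
  ≡ᵇ-sym zero    (suc b) = refl
  ≡ᵇ-sym (suc a) zero    = refl
  ≡ᵇ-sym (suc a) (suc b) = ≡ᵇ-sym a b

_≟L_ : (x y : List ℕ) → x ≡ y ⊎ x ≢ y
x ≟L y with eqL x y in e
... | true  = inj₁ (eqL⇒≡ x y e)
... | false = inj₂ λ { refl → case trans (sym (eqL-refl x)) e of λ () }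

δ : Mat
δ x y = ind (eqL x y)

δ-refl : ∀ x → δ x x ≡ 1ℚ
δ-refl x = cong ind (eqL-refl x)

δ-≢ : ∀ {x y} → x ≢ y → δ x y ≡ 0ℚ
δ-≢ h = cong ind (eqL-≢ h)

δ-sym : ∀ x y → δ x y ≡ δ y x
δ-sym x y = cong ind (eqL-sym x y)

opaque
  unfolding ∑

  Σ-single : {xs : List (List ℕ)} {y : List ℕ} {f : List ℕ → ℚ} → Unique xs → y ∈ xs →
             (∀ x → x ∈ xs → x ≢ y → f x ≡ 0ℚ) → ∑ xs f ≡ f y
  Σ-single {x ∷ xs} {y} {f} (u ∷ us) (here refl) h =
    trans (cong (f x +_) (Σ-0 xs (λ z z∈ → h z (there z∈) (λ e → All.lookup u z∈ (sym e))))) (ℚₚ.+-identityʳ _)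
  Σ-single {x ∷ xs} {y} {f} (u ∷ us) (there y∈) h =
    trans (cong₂ _+_ (h x (here refl) (All.lookup u y∈)) (Σ-single us y∈ (λ z → h z ∘ there))) (ℚₚ.+-identityˡ _)

Σ-δ : {xs : List (List ℕ)} {y : List ℕ} (f : List ℕ → ℚ) → Unique xs → y ∈ xs →
      ∑ xs (λ x → δ x y * f x) ≡ f y
Σ-δ {xs} {y} f u y∈ = trans (Σ-single u y∈ (λ x _ x≢y → 0* (f x) (δ-≢ x≢y)))
                            (trans (cong (_* f y) (δ-refl y)) (ℚₚ.*-identityˡ _))

Σ-δʳ : {xs : List (List ℕ)} {y : List ℕ} (f : List ℕ → ℚ) → Unique xs → y ∈ xs →
       ∑ xs (λ x → f x * δ x y) ≡ f y
Σ-δʳ {xs} f u y∈ = trans (Σ-ext xs (λ x → ℚₚ.*-comm (f x) _)) (Σ-δ f u y∈)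

Σ-δ' : {xs : List (List ℕ)} {y : List ℕ} (f : List ℕ → ℚ) → Unique xs → y ∈ xs →
       ∑ xs (λ x → δ y x * f x) ≡ f y
Σ-δ' {xs} {y} f u y∈ = trans (Σ-ext xs (λ x → cong (_* f x) (δ-sym y x))) (Σ-δ f u y∈)

sumFin-cong : ∀ k {f g : Fin k → ℚ} → (∀ i → f i ≡ g i) → sumFin k f ≡ sumFin k g
sumFin-cong zero    h = refl
sumFin-cong (suc k) h = cong₂ _+_ (h Fin.zero) (sumFin-cong k (h ∘ Fin.suc))

sumFin-0 : ∀ k {f : Fin k → ℚ} → (∀ i → f i ≡ 0ℚ) → sumFin k f ≡ 0ℚ
sumFin-0 zero    h = refl
sumFin-0 (suc k) h = trans (cong₂ _+_ (h Fin.zero) (sumFin-0 k (h ∘ Fin.suc))) (ℚₚ.+-identityˡ 0ℚ)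

sumFin-single : ∀ k (f : Fin k → ℚ) j → (∀ i → i ≢ j → f i ≡ 0ℚ) → sumFin k f ≡ f j
sumFin-single (suc k) f Fin.zero h =
  trans (cong (f Fin.zero +_) (sumFin-0 k (λ i → h (Fin.suc i) λ ()))) (ℚₚ.+-identityʳ _)
sumFin-single (suc k) f (Fin.suc j) h =
  trans (cong₂ _+_ (h Fin.zero λ ()) (sumFin-single k (f ∘ Fin.suc) j (λ i i≢j → h (Fin.suc i) (i≢j ∘ Finₚ.suc-injective))))
        (ℚₚ.+-identityˡ _)

opaque
  unfolding ∑

  Σ-sumFin : (xs : List X) (k : ℕ) (f : X → Fin k → ℚ) →
             ∑ xs (λ x → sumFin k (f x)) ≡ sumFin k (λ i → ∑ xs (λ x → f x i))
  Σ-sumFin xs zero    f = Σ-0 xs (λ _ _ → refl)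
  Σ-sumFin xs (suc k) f = trans (Σ-+ xs (λ x → f x Fin.zero) _) (cong (∑ xs (λ x → f x Fin.zero) +_) (Σ-sumFin xs k (λ x i → f x (Fin.suc i))))

sumFin-*ˡ : ∀ k c (f : Fin k → ℚ) → sumFin k (λ i → c * f i) ≡ c * sumFin k f
sumFin-*ˡ zero    c f = sym (ℚₚ.*-zeroʳ c)
sumFin-*ˡ (suc k) c f = trans (cong (c * f Fin.zero +_) (sumFin-*ˡ k c (f ∘ Fin.suc))) (sym (ℚₚ.*-distribˡ-+ c _ _))

-- Reciprocal with inv 0 = 0.
inv : ℚ → ℚ
inv q with q ≟ 0ℚ
... | yes _  = 0ℚ
... | no q≢0 = (Data.Rational.1/ q) {{Data.Rational.≢-nonZero q≢0}}

*-inv : ∀ q → q ≢ 0ℚ → q * inv q ≡ 1ℚ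
*-inv q q≢0 with q ≟ 0ℚ
... | yes e = contradiction e q≢0
... | no n  = ℚₚ.*-inverseʳ q {{Data.Rational.≢-nonZero n}}

inv-* : ∀ q → q ≢ 0ℚ → inv q * q ≡ 1ℚ
inv-* q h = trans (ℚₚ.*-comm (inv q) q) (*-inv q h)

*-cancel-0 : ∀ a b → b ≢ 0ℚ → a * b ≡ 0ℚ → a ≡ 0ℚ
*-cancel-0 a b b≢0 e = begin
  a               ≡⟨ sym (ℚₚ.*-identityʳ a) ⟩
  a * 1ℚ          ≡⟨ cong (a *_) (sym (*-inv b b≢0)) ⟩
  a * (b * inv b) ≡⟨ sym (ℚₚ.*-assoc a b (inv b)) ⟩
  (a * b) * inv b ≡⟨ 0* (inv b) e ⟩
  0ℚ ∎

-- Matrices over a finite index set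

module Matrices (I : List (List ℕ)) (I! : Unique I) where

  infix 4 _≋_
  infixl 7 _⊗_
  infixl 6 _⊞_ _⊟_

  _≋_ : Mat → Mat → Set
  M ≋ N = ∀ α β → α ∈ I → β ∈ I → M α β ≡ N α β

  ≋-setoid : Setoid _ _
  ≋-setoid = record
    { Carrier = Mat ; _≈_ = _≋_
    ; isEquivalence = record
      { refl  = λ _ _ _ _ → refl
      ; sym   = λ h α β α∈ β∈ → sym (h α β α∈ β∈)
      ; trans = λ h k α β α∈ β∈ → trans (h α β α∈ β∈) (k α β α∈ β∈) } }

  _⊗_ _⊞_ _⊟_ : Mat → Mat → Mat
  (M ⊗ N) α β = ∑ I (λ γ → M α γ * N γ β)
  (M ⊞ N) α β = M α β + N α β
  (M ⊟ N) α β = M α β - N α β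

  scaleˡ scaleʳ : (List ℕ → ℚ) → Mat → Mat
  scaleˡ μ M α β = μ α * M α β
  scaleʳ μ M α β = M α β * μ β

  ⊗-congˡ : ∀ {M M'} N → M ≋ M' → M ⊗ N ≋ M' ⊗ N
  ⊗-congˡ N h α β α∈ β∈ = Σ-cong I (λ γ γ∈ → cong (_* N γ β) (h α γ α∈ γ∈))

  ⊗-congʳ : ∀ M {N N'} → N ≋ N' → M ⊗ N ≋ M ⊗ N'
  ⊗-congʳ M h α β α∈ β∈ = Σ-cong I (λ γ γ∈ → cong (M α γ *_) (h γ β γ∈ β∈))

  ⊗-assoc : ∀ M N P → (M ⊗ N) ⊗ P ≋ M ⊗ (N ⊗ P)
  ⊗-assoc M N P α β _ _ = begin
    ∑ I (λ γ → ∑ I (λ ε → M α ε * N ε γ) * P γ β)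
      ≡⟨ Σ-ext I (λ γ → sym (Σ-*ʳ I (P γ β) _)) ⟩
    ∑ I (λ γ → ∑ I (λ ε → M α ε * N ε γ * P γ β))
      ≡⟨ Σ-swap I I _ ⟩
    ∑ I (λ ε → ∑ I (λ γ → M α ε * N ε γ * P γ β))
      ≡⟨ Σ-ext I (λ ε → trans (Σ-ext I (λ γ → ℚₚ.*-assoc (M α ε) (N ε γ) (P γ β))) (Σ-*ˡ I (M α ε) _)) ⟩
    ∑ I (λ ε → M α ε * ∑ I (λ γ → N ε γ * P γ β)) ∎

  ⊗-identityˡ : ∀ M → δ ⊗ M ≋ M
  ⊗-identityˡ M α β α∈ _ = Σ-δ' (λ γ → M γ β) I! α∈

  ⊗-identityʳ : ∀ M → M ⊗ δ ≋ M
  ⊗-identityʳ M α β _ β∈ = Σ-δʳ (M α) I! β∈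

  ⊗-scaleʳ : ∀ μ M N → M ⊗ scaleʳ μ N ≋ scaleʳ μ (M ⊗ N)
  ⊗-scaleʳ μ M N α β _ _ = trans (Σ-ext I (λ γ → sym (ℚₚ.*-assoc (M α γ) (N γ β) (μ β)))) (Σ-*ʳ I (μ β) _)

  ⊗-scaleˡ : ∀ μ M N → scaleˡ μ M ⊗ N ≋ scaleˡ μ (M ⊗ N)
  ⊗-scaleˡ μ M N α β _ _ = trans (Σ-ext I (λ γ → ℚₚ.*-assoc (μ α) (M α γ) (N γ β))) (Σ-*ˡ I (μ α) _)

  private module ≋R = SetoidReasoning ≋-setoid

  cancel-middle : ∀ M N {P Q} → P ⊗ Q ≋ δ → (M ⊗ P) ⊗ (Q ⊗ N) ≋ M ⊗ N
  cancel-middle M N {P} {Q} PQ = ≋R.begin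
    (M ⊗ P) ⊗ (Q ⊗ N) ≋R.≈⟨ ⊗-assoc M P (Q ⊗ N) ⟩
    M ⊗ (P ⊗ (Q ⊗ N)) ≋R.≈⟨ ⊗-congʳ M (⊗-assoc P Q N) ⟨
    M ⊗ ((P ⊗ Q) ⊗ N) ≋R.≈⟨ ⊗-congʳ M (⊗-congˡ N PQ) ⟩
    M ⊗ (δ ⊗ N)       ≋R.≈⟨ ⊗-congʳ M (⊗-identityˡ N) ⟩
    M ⊗ N             ≋R.∎

  -- `AR` serves 𝒬_n, whose eigenvectors are the columns of `R`; `LA` serves the descent algebra,
  -- where the operator is the transpose of Φ_n.
  record Eigenbases (A : Mat) (μ : List ℕ → ℚ) : Set where
    field
      L R : Mat
      LR  : L ⊗ R ≋ δ
      RL  : R ⊗ L ≋ δ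
      AR  : A ⊗ R ≋ scaleʳ μ R
      LA  : L ⊗ A ≋ scaleˡ μ L

  module _ (A E G : Mat) (μ : List ℕ → ℚ) (EG : E ⊗ G ≋ δ) (GE : G ⊗ E ≋ δ)
           (eigenrow  : ∀ γ → γ ∈ I → μ γ ≢ 0ℚ → ∀ β → β ∈ I → (E ⊗ A) γ β ≡ μ γ * E γ β) where

    conjugate : Mat
    conjugate = (E ⊗ A) ⊗ G

    -- This settles the rows with `μ γ ≢ 0ℚ`, the blocks D and 0. The remaining rows of `E` only
    -- complete a basis and need not be eigenvectors.
    conjugate-eigenrow : ∀ γ ε → γ ∈ I → ε ∈ I → μ γ ≢ 0ℚ → conjugate γ ε ≡ μ γ * δ γ ε
    conjugate-eigenrow γ ε γ∈ ε∈ μγ≢0 = begin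
      ∑ I (λ β → (E ⊗ A) γ β * G β ε)   ≡⟨ Σ-cong I (λ β β∈ → cong (_* G β ε) (eigenrow γ γ∈ μγ≢0 β β∈)) ⟩
      ∑ I (λ β → μ γ * E γ β * G β ε)   ≡⟨ ⊗-scaleˡ μ E G γ ε γ∈ ε∈ ⟩
      μ γ * (E ⊗ G) γ ε                    ≡⟨ cong (μ γ *_) (EG γ ε γ∈ ε∈) ⟩
      μ γ * δ γ ε ∎

    -- In the basis E the matrix A becomes (D 0 ; C Z) with D diagonal and invertible.
    -- Once Z = 0, conjugation by 1 + K, where K = (0 0 ; C D⁻¹ 0), removes C.
    module _ (Z≡0 : ∀ γ ε → γ ∈ I → ε ∈ I → μ γ ≡ 0ℚ → μ ε ≡ 0ℚ → conjugate γ ε ≡ 0ℚ) where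

      private
        isZero : ℚ → ℚ
        isZero q = ind (does (q ≟ 0ℚ))

        *-isZero : ∀ q → q * isZero q ≡ 0ℚ
        *-isZero q with q ≟ 0ℚ
        ... | yes refl = refl
        ... | no _     = ℚₚ.*-zeroʳ q

        inv-isZero : ∀ q → inv q * isZero q ≡ 0ℚ
        inv-isZero q with q ≟ 0ℚ
        ... | yes refl = refl
        ... | no q≢0   = ℚₚ.*-zeroʳ ((Data.Rational.1/ q) {{Data.Rational.≢-nonZero q≢0}})

        B K : Mat
        B = conjugate
        -- `isZero` keeps the rows with `μ γ = 0`, and `inv 0 = 0` discards the columns with
        -- `μ ε = 0`, so the block C D⁻¹ is cut out without a case distinction.
        K γ ε = isZero (μ γ) * (B γ ε * inv (μ ε))

        μK≡0 : ∀ γ ε → μ γ * K γ ε ≡ 0ℚ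
        μK≡0 γ ε = trans (sym (ℚₚ.*-assoc (μ γ) _ _)) (0* _ (*-isZero (μ γ)))

        -- At the middle index one factor vanishes unless `μ γ` is nonzero, the other unless it is
        -- zero. Nilpotency is what makes 1 - K inverse to 1 + K.
        KK : K ⊗ K ≋ (λ _ _ → 0ℚ)
        KK α β _ _ = Σ-0 I (λ γ _ → begin
          isZero (μ α) * (B α γ * inv (μ γ)) * (isZero (μ γ) * (B γ β * inv (μ β)))
            ≡⟨ solve 6 (λ a b c d e f → a :* (b :* c) :* (d :* (e :* f)) := (c :* d) :* (a :* b :* e :* f)) refl
                 (isZero (μ α)) (B α γ) (inv (μ γ)) (isZero (μ γ)) (B γ β) (inv (μ β)) ⟩
          (inv (μ γ) * isZero (μ γ)) * (isZero (μ α) * B α γ * B γ β * inv (μ β))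
            ≡⟨ 0* _ (inv-isZero (μ γ)) ⟩
          0ℚ ∎)

        -- Block by block this reads D = D, 0 = 0, C = (C D⁻¹) D and Z = 0; the assumption on Z is
        -- used where both values of `μ` are zero.
        B≋ : B ≋ scaleʳ μ (δ ⊞ K)
        B≋ γ ε γ∈ ε∈ with μ γ ≟ 0ℚ in eγ
        ... | no μγ≢0 = begin
          B γ ε                              ≡⟨ conjugate-eigenrow γ ε γ∈ ε∈ μγ≢0 ⟩
          μ γ * δ γ ε                        ≡⟨ μδ ⟩
          δ γ ε * μ ε                        ≡⟨ cong (_* μ ε) (sym (trans (cong (δ γ ε +_) (ℚₚ.*-zeroˡ (B γ ε * inv (μ ε)))) (ℚₚ.+-identityʳ (δ γ ε)))) ⟩
          (δ γ ε + 0ℚ * (B γ ε * inv (μ ε))) * μ ε ∎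
          where
          μδ : μ γ * δ γ ε ≡ δ γ ε * μ ε
          μδ with γ ≟L ε
          ... | inj₁ refl = ℚₚ.*-comm (μ γ) _
          ... | inj₂ γ≢ε  = trans (*0 (μ γ) (δ-≢ γ≢ε)) (sym (0* (μ ε) (δ-≢ γ≢ε)))
        ... | yes μγ≡0 with μ ε ≟ 0ℚ
        ...   | yes με≡0 = trans (Z≡0 γ ε γ∈ ε∈ μγ≡0 με≡0) (sym (*0 (δ γ ε + 1ℚ * (B γ ε * 0ℚ)) με≡0))
        ...   | no με≢0  = begin
          B γ ε                                       ≡⟨ sym (ℚₚ.*-identityʳ _) ⟩
          B γ ε * 1ℚ                                  ≡⟨ cong (B γ ε *_) (sym (ℚₚ.*-inverseˡ (μ ε) {{nz}})) ⟩
          B γ ε * (i * μ ε)                     ≡⟨ solve 3 (λ b i m → b :* (i :* m) := (con 0ℚ :+ con 1ℚ :* (b :* i)) :* m) refl (B γ ε) i (μ ε) ⟩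
          (0ℚ + 1ℚ * (B γ ε * i)) * μ ε         ≡⟨ cong (λ d → (d + 1ℚ * (B γ ε * i)) * μ ε) (sym (δ-≢ γ≢ε)) ⟩
          (δ γ ε + 1ℚ * (B γ ε * i)) * μ ε ∎
          where
          nz = Data.Rational.≢-nonZero με≢0
          i  = (Data.Rational.1/ (μ ε)) {{nz}}
          γ≢ε : γ ≢ ε
          γ≢ε refl = με≢0 μγ≡0

        K⁺ K⁻ : Mat
        K⁺ = δ ⊞ K
        K⁻ = δ ⊟ K

        K⁻K⁺ : K⁻ ⊗ K⁺ ≋ δ
        K⁻K⁺ α β α∈ β∈ = begin
          ∑ I (λ γ → (δ α γ - K α γ) * (δ γ β + K γ β))
            ≡⟨ Σ-ext I (λ γ → solve 4 (λ a b c d → (a :- b) :* (c :+ d) := ((a :* c) :+ (a :* d)) :+ (:- con 1ℚ) :* ((b :* c) :+ (b :* d))) refl (δ α γ) (K α γ) (δ γ β) (K γ β)) ⟩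
          ∑ I (λ γ → (δ α γ * δ γ β + δ α γ * K γ β) + (- 1ℚ) * (K α γ * δ γ β + K α γ * K γ β))
            ≡⟨ trans (Σ-+ I _ _) (cong₂ _+_ (Σ-+ I _ _) (trans (Σ-*ˡ I (- 1ℚ) _) (cong ((- 1ℚ) *_) (Σ-+ I _ _)))) ⟩
          ((δ ⊗ δ) α β + (δ ⊗ K) α β) + (- 1ℚ) * ((K ⊗ δ) α β + (K ⊗ K) α β)
            ≡⟨ cong₂ (λ x y → x + (- 1ℚ) * y)
                 (cong₂ _+_ (⊗-identityˡ δ α β α∈ β∈) (⊗-identityˡ K α β α∈ β∈))
                 (cong₂ _+_ (⊗-identityʳ K α β α∈ β∈) (KK α β α∈ β∈)) ⟩
          (δ α β + K α β) + (- 1ℚ) * (K α β + 0ℚ)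
            ≡⟨ solve 2 (λ d k → (d :+ k) :+ (:- con 1ℚ) :* (k :+ con 0ℚ) := d) refl (δ α β) (K α β) ⟩
          δ α β ∎

        K⁺K⁻ : K⁺ ⊗ K⁻ ≋ δ
        K⁺K⁻ α β α∈ β∈ = begin
          ∑ I (λ γ → (δ α γ + K α γ) * (δ γ β - K γ β))
            ≡⟨ Σ-ext I (λ γ → solve 4 (λ a b c d → (a :+ b) :* (c :- d) := ((a :* c) :+ (b :* c)) :+ (:- con 1ℚ) :* ((a :* d) :+ (b :* d))) refl (δ α γ) (K α γ) (δ γ β) (K γ β)) ⟩
          ∑ I (λ γ → (δ α γ * δ γ β + K α γ * δ γ β) + (- 1ℚ) * (δ α γ * K γ β + K α γ * K γ β))
            ≡⟨ trans (Σ-+ I _ _) (cong₂ _+_ (Σ-+ I _ _) (trans (Σ-*ˡ I (- 1ℚ) _) (cong ((- 1ℚ) *_) (Σ-+ I _ _)))) ⟩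
          ((δ ⊗ δ) α β + (K ⊗ δ) α β) + (- 1ℚ) * ((δ ⊗ K) α β + (K ⊗ K) α β)
            ≡⟨ cong₂ (λ x y → x + (- 1ℚ) * y)
                 (cong₂ _+_ (⊗-identityˡ δ α β α∈ β∈) (⊗-identityʳ K α β α∈ β∈))
                 (cong₂ _+_ (⊗-identityˡ K α β α∈ β∈) (KK α β α∈ β∈)) ⟩
          (δ α β + K α β) + (- 1ℚ) * (K α β + 0ℚ)
            ≡⟨ solve 2 (λ d k → (d :+ k) :+ (:- con 1ℚ) :* (k :+ con 0ℚ) := d) refl (δ α β) (K α β) ⟩
          δ α β ∎

        -- With Λ the diagonal matrix of `μ`, the product is K⁺ Λ (1 + K), and Λ K = 0 because the
        -- rows of `K` with nonzero `μ` vanish.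
        BK⁺ : B ⊗ K⁺ ≋ scaleʳ μ K⁺
        BK⁺ α β α∈ β∈ = begin
          (B ⊗ K⁺) α β
            ≡⟨ ⊗-congˡ K⁺ B≋ α β α∈ β∈ ⟩
          ∑ I (λ γ → K⁺ α γ * μ γ * (δ γ β + K γ β))
            ≡⟨ Σ-ext I (λ γ → trans (solve 4 (λ x m d k → x :* m :* (d :+ k) := x :* m :* d :+ x :* (m :* k)) refl (K⁺ α γ) (μ γ) (δ γ β) (K γ β))
                                    (trans (cong (K⁺ α γ * μ γ * δ γ β +_) (*0 (K⁺ α γ) (μK≡0 γ β))) (ℚₚ.+-identityʳ _))) ⟩
          (scaleʳ μ K⁺ ⊗ δ) α β
            ≡⟨ ⊗-identityʳ (scaleʳ μ K⁺) α β α∈ β∈ ⟩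
          K⁺ α β * μ β ∎

        μK⁻ : scaleˡ μ K⁻ ≋ scaleˡ μ δ
        μK⁻ α β _ _ = begin
          μ α * (δ α β - K α β)        ≡⟨ solve 3 (λ m d k → m :* (d :- k) := m :* d :- m :* k) refl (μ α) (δ α β) (K α β) ⟩
          μ α * δ α β - μ α * K α β    ≡⟨ cong (λ q → μ α * δ α β - q) (μK≡0 α β) ⟩
          μ α * δ α β - 0ℚ             ≡⟨ ℚₚ.+-identityʳ _ ⟩
          μ α * δ α β ∎

        -- K⁻ B = K⁻ K⁺ Λ = Λ, and Λ = Λ K⁻ because Λ K = 0.
        K⁻B : K⁻ ⊗ B ≋ scaleˡ μ K⁻
        K⁻B α β α∈ β∈ = begin
          (K⁻ ⊗ B) α β                 ≡⟨ ⊗-congʳ K⁻ B≋ α β α∈ β∈ ⟩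
          (K⁻ ⊗ scaleʳ μ K⁺) α β       ≡⟨ ⊗-scaleʳ μ K⁻ K⁺ α β α∈ β∈ ⟩
          (K⁻ ⊗ K⁺) α β * μ β          ≡⟨ cong (_* μ β) (K⁻K⁺ α β α∈ β∈) ⟩
          δ α β * μ β                  ≡⟨ δμ ⟩
          μ α * δ α β                  ≡⟨ sym (μK⁻ α β α∈ β∈) ⟩
          μ α * K⁻ α β ∎
          where
          δμ : δ α β * μ β ≡ μ α * δ α β
          δμ with α ≟L β
          ... | inj₁ refl = ℚₚ.*-comm _ (μ α)
          ... | inj₂ α≢β  = trans (0* (μ β) (δ-≢ α≢β)) (sym (*0 (μ α) (δ-≢ α≢β)))

      eigenbases : Eigenbases A μ
      eigenbases = record
        { L  = K⁻ ⊗ E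
        ; R  = G ⊗ K⁺
        ; LR = λ α β α∈ β∈ → trans (cancel-middle K⁻ K⁺ EG α β α∈ β∈) (K⁻K⁺ α β α∈ β∈)
        ; RL = λ α β α∈ β∈ → trans (cancel-middle G E K⁺K⁻ α β α∈ β∈) (GE α β α∈ β∈)
        ; AR = ≋R.begin
            A ⊗ (G ⊗ K⁺)               ≋R.≈⟨ ⊗-congˡ (G ⊗ K⁺) (⊗-identityˡ A) ⟨
            (δ ⊗ A) ⊗ (G ⊗ K⁺)         ≋R.≈⟨ ⊗-congˡ (G ⊗ K⁺) (⊗-congˡ A GE) ⟨
            ((G ⊗ E) ⊗ A) ⊗ (G ⊗ K⁺)   ≋R.≈⟨ ⊗-congˡ (G ⊗ K⁺) (⊗-assoc G E A) ⟩
            (G ⊗ (E ⊗ A)) ⊗ (G ⊗ K⁺)   ≋R.≈⟨ ⊗-assoc G (E ⊗ A) (G ⊗ K⁺) ⟩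
            G ⊗ ((E ⊗ A) ⊗ (G ⊗ K⁺))   ≋R.≈⟨ ⊗-congʳ G (⊗-assoc (E ⊗ A) G K⁺) ⟨
            G ⊗ (B ⊗ K⁺)               ≋R.≈⟨ ⊗-congʳ G BK⁺ ⟩
            G ⊗ scaleʳ μ K⁺            ≋R.≈⟨ ⊗-scaleʳ μ G K⁺ ⟩
            scaleʳ μ (G ⊗ K⁺)          ≋R.∎
        ; LA = ≋R.begin
            (K⁻ ⊗ E) ⊗ A               ≋R.≈⟨ ⊗-assoc K⁻ E A ⟩
            K⁻ ⊗ (E ⊗ A)               ≋R.≈⟨ ⊗-congʳ K⁻ (⊗-identityʳ (E ⊗ A)) ⟨
            K⁻ ⊗ ((E ⊗ A) ⊗ δ)         ≋R.≈⟨ ⊗-congʳ K⁻ (⊗-congʳ (E ⊗ A) GE) ⟨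
            K⁻ ⊗ ((E ⊗ A) ⊗ (G ⊗ E))   ≋R.≈⟨ ⊗-congʳ K⁻ (⊗-assoc (E ⊗ A) G E) ⟨
            K⁻ ⊗ (B ⊗ E)               ≋R.≈⟨ ⊗-assoc K⁻ B E ⟨
            (K⁻ ⊗ B) ⊗ E               ≋R.≈⟨ ⊗-congˡ E K⁻B ⟩
            scaleˡ μ K⁻ ⊗ E            ≋R.≈⟨ ⊗-scaleˡ μ K⁻ E ⟩
            scaleˡ μ (K⁻ ⊗ E)          ≋R.∎
        }

lin-∑ : ∀ I a b x → lin I a b x ≡ ∑ I (λ γ → a γ * b γ x)
lin-∑ I a b x = ∑-def I _

-- Triangular systems and unitriangular inverses.

module Triangular (I : List (List ℕ)) (I! : Unique I) (h : List ℕ → ℕ) where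

  open Matrices I I!

  -- Forward substitution in the order given by `h`, with `k` as recursion fuel. The reciprocals `d`
  -- of the pivots are separate from `T`, since the eigenvector equation shifts the diagonal and
  -- leaves the other entries as they are.
  solveWithin : Mat → Vect → Vect → ℕ → Vect
  solveWithin T d y zero    β = 0ℚ
  solveWithin T d y (suc k) β =
    d β * (y β - ∑ I (λ α → ind (h α <ᵇ h β) * (solveWithin T d y k α * T α β)))

  solveWithin-stable : ∀ T d y k k' β → h β < k → h β < k' → solveWithin T d y k β ≡ solveWithin T d y k' β
  solveWithin-stable T d y (suc k) (suc k') β (s≤s p) (s≤s p') =
    cong (λ s → d β * (y β - s)) (Σ-ext I (λ α → ind-cong* (h α <ᵇ h β) (λ e →
      let q = ℕₚ.<ᵇ⇒< (h α) (h β) (≡⇒T e) in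
      cong (_* T α β) (solveWithin-stable T d y k k' α (ℕₚ.<-≤-trans q p) (ℕₚ.<-≤-trans q p')))))

  solveLower : Mat → Vect → Vect → Vect
  solveLower T d y β = solveWithin T d y (suc (h β)) β

  solveLower-eq : ∀ T d y β → solveLower T d y β ≡
    d β * (y β - ∑ I (λ α → ind (h α <ᵇ h β) * (solveLower T d y α * T α β)))
  solveLower-eq T d y β =
    cong (λ s → d β * (y β - s)) (Σ-ext I (λ α → ind-cong* (h α <ᵇ h β) (λ e →
      cong (_* T α β) (solveWithin-stable T d y (h β) (suc (h α)) α (ℕₚ.<ᵇ⇒< (h α) (h β) (≡⇒T e)) ℕₚ.≤-refl))))

  UpperTriangular : Mat → Set
  UpperTriangular T = ∀ α β → α ∈ I → β ∈ I → α ≢ β → ¬ (h α < h β) → T α β ≡ 0ℚ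

  ∑-upperTriangular : ∀ {T} → UpperTriangular T → (x : Vect) → ∀ β → β ∈ I →
    ∑ I (λ α → x α * T α β) ≡ ∑ I (λ α → ind (h α <ᵇ h β) * (x α * T α β)) + x β * T β β
  ∑-upperTriangular {T} upper x β β∈ = begin
    ∑ I (λ α → x α * T α β)
      ≡⟨ Σ-cong I summand ⟩
    ∑ I (λ α → ind (h α <ᵇ h β) * (x α * T α β) + δ α β * (x α * T α β))
      ≡⟨ Σ-+ I _ _ ⟩
    ∑ I (λ α → ind (h α <ᵇ h β) * (x α * T α β)) + ∑ I (λ α → δ α β * (x α * T α β))
      ≡⟨ cong (∑ I (λ α → ind (h α <ᵇ h β) * (x α * T α β)) +_) (Σ-δ (λ α → x α * T α β) I! β∈) ⟩
    ∑ I (λ α → ind (h α <ᵇ h β) * (x α * T α β)) + x β * T β β ∎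
    where
    summand : ∀ α → α ∈ I → x α * T α β ≡ ind (h α <ᵇ h β) * (x α * T α β) + δ α β * (x α * T α β)
    summand α α∈ with α ≟L β
    ... | inj₁ refl = sym (trans (cong₂ _+_
        (ind-false* {h α <ᵇ h α} (x α * T α α) (≢true (λ e → ℕₚ.<-irrefl refl (ℕₚ.<ᵇ⇒< (h α) (h α) (≡⇒T e)))))
        (ind-true* {eqL α α} (x α * T α α) (eqL-refl α))) (ℚₚ.+-identityˡ (x α * T α α)))
    ... | inj₂ α≢β with h α <ᵇ h β in e
    ...   | true  = sym (trans (cong₂ _+_ (ℚₚ.*-identityˡ (x α * T α β)) (0* (x α * T α β) (δ-≢ α≢β))) (ℚₚ.+-identityʳ (x α * T α β)))
    ...   | false = trans Tz (sym (trans (cong₂ _+_ (ℚₚ.*-zeroˡ (x α * T α β)) (0* (x α * T α β) (δ-≢ α≢β))) (ℚₚ.+-identityˡ 0ℚ)))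
      where
      Tz : x α * T α β ≡ 0ℚ
      Tz = *0 (x α) (upper α β α∈ β∈ α≢β (λ lt → case trans (sym e) (T⇒≡ (ℕₚ.<⇒<ᵇ lt)) of λ ()))

  leftInverse : Mat → Mat
  leftInverse E γ = solveLower E (λ _ → 1ℚ) (δ γ)

  leftInverse-⊗ : ∀ E → (∀ α → α ∈ I → E α α ≡ 1ℚ) → UpperTriangular E → leftInverse E ⊗ E ≋ δ
  leftInverse-⊗ E diag upper γ β _ β∈ = begin
    ∑ I (λ α → G α * E α β)  ≡⟨ ∑-upperTriangular upper G β β∈ ⟩
    S + G β * E β β          ≡⟨ cong (λ q → S + G β * q) (diag β β∈) ⟩
    S + G β * 1ℚ             ≡⟨ cong (λ q → S + q * 1ℚ) (solveLower-eq E (λ _ → 1ℚ) (δ γ) β) ⟩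
    S + 1ℚ * (δ γ β - S) * 1ℚ ≡⟨ solve 2 (λ s d → s :+ con 1ℚ :* (d :- s) :* con 1ℚ := d) refl S (δ γ β) ⟩
    δ γ β ∎
    where
    G = leftInverse E γ
    S = ∑ I (λ α → ind (h α <ᵇ h β) * (G α * E α β))

record Invertible (I : List (List ℕ)) (I! : Unique I) (E : Mat) : Set where
  open Matrices I I!
  field
    inverse  : Mat
    inverseʳ : E ⊗ inverse ≋ δ
    inverseˡ : inverse ⊗ E ≋ δ

-- Forward substitution yields only a left inverse. The transpose is triangular for the reversed
-- height `H ∸ h α`, which yields a right inverse, and the two agree. The bound `H` makes truncated
-- subtraction reverse the order strictly.
unitriangular-invertible : ∀ I I! h H → (∀ α → α ∈ I → h α ≤ H) → ∀ E → (∀ α → α ∈ I → E α α ≡ 1ℚ) →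
  Triangular.UpperTriangular I I! h E → Invertible I I! E
unitriangular-invertible I I! h H bounded E diag upper = record
  { inverse = G ; inverseʳ = ≋R.begin
      E ⊗ G            ≋R.≈⟨ ⊗-congʳ E G≋G' ⟩
      E ⊗ G'           ≋R.≈⟨ EG' ⟩
      δ                ≋R.∎
  ; inverseˡ = GE }
  where
  open Matrices I I!
  module ≋R = SetoidReasoning ≋-setoid
  module T  = Triangular I I! h
  module T' = Triangular I I! (λ α → H ∸ h α)
  G = T.leftInverse E
  Eᵗ G' : Mat
  Eᵗ α β = E β α
  G' α β = T'.leftInverse Eᵗ β α
  GE : G ⊗ E ≋ δ
  GE = T.leftInverse-⊗ E diag upper
  EG' : E ⊗ G' ≋ δ
  EG' α β α∈ β∈ = begin
    ∑ I (λ γ → E α γ * G' γ β)  ≡⟨ Σ-ext I (λ γ → ℚₚ.*-comm (E α γ) (G' γ β)) ⟩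
    ∑ I (λ γ → G' γ β * E α γ)  ≡⟨ T'.leftInverse-⊗ Eᵗ diag upper' β α β∈ α∈ ⟩
    δ β α                       ≡⟨ δ-sym β α ⟩
    δ α β ∎
    where
    upper' : T'.UpperTriangular Eᵗ
    upper' α β α∈ β∈ α≢β α≮β = upper β α β∈ α∈ (α≢β ∘ sym) (λ lt → α≮β (ℕₚ.∸-monoʳ-< lt (bounded α α∈)))
  G≋G' : G ≋ G'
  G≋G' = ≋R.begin
    G              ≋R.≈⟨ ⊗-identityʳ G ⟨
    G ⊗ δ          ≋R.≈⟨ ⊗-congʳ G EG' ⟨
    G ⊗ (E ⊗ G')   ≋R.≈⟨ ⊗-assoc G E G' ⟨
    (G ⊗ E) ⊗ G'   ≋R.≈⟨ ⊗-congˡ G' GE ⟩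
    δ ⊗ G'         ≋R.≈⟨ ⊗-identityˡ G' ⟩
    G'             ≋R.∎

-- Rank and diagonalizability in coordinates.

module _ (I : List (List ℕ)) (I! : Unique I) where

  open Matrices I I!

  nonzeros : (List ℕ → ℚ) → List (List ℕ)
  nonzeros μ = filter (λ α → ¬? (μ α ≟ 0ℚ)) I

  apply : Mat → Vect → Vect
  apply A v α = Σ[ I ] (λ β → A α β * v β)

  apply-lin-unitV : ∀ A c α → apply A (lin I c unitV) α ≡ ∑ I (λ β → A α β * c β)
  apply-lin-unitV A c α = trans (∑-def I _) (Σ-cong I (λ β β∈ →
    cong (A α β *_) (trans (lin-∑ I c unitV β) (trans (Σ-ext I (λ γ → cong (c γ *_) (δ-sym β γ))) (Σ-δʳ c I! β∈)))))

  lookup-injective : ∀ {J : List (List ℕ)} → Unique J → ∀ i j → lookup J i ≡ lookup J j → i ≡ j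
  lookup-injective {_ ∷ J} (u ∷ us) Fin.zero    Fin.zero    e = refl
  lookup-injective {_ ∷ J} (u ∷ us) Fin.zero    (Fin.suc j) e = contradiction e (All.lookup u (∈ₚ.∈-lookup j))
  lookup-injective {_ ∷ J} (u ∷ us) (Fin.suc i) Fin.zero    e = contradiction (sym e) (All.lookup u (∈ₚ.∈-lookup i))
  lookup-injective {_ ∷ J} (u ∷ us) (Fin.suc i) (Fin.suc j) e = cong Fin.suc (lookup-injective us i j e)

  -- A nonzero entry of the corner at (γ , ε) would make the images of the ε-th column of G
  -- and of the columns with nonzero μ independent, one vector more than the rank.
  corner≡0 : ∀ A E G μ (EG : E ⊗ G ≋ δ) (GE : G ⊗ E ≋ δ) eigenrow →
    (∀ c → ¬ IndepFin I (suc (length (nonzeros μ))) (λ i → apply A (lin I (c i) unitV))) →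
    ∀ γ ε → γ ∈ I → ε ∈ I → μ γ ≡ 0ℚ → μ ε ≡ 0ℚ → conjugate A E G μ EG GE eigenrow γ ε ≡ 0ℚ
  corner≡0 A E G μ EG GE eigenrow rank γ ε γ∈ ε∈ μγ≡0 με≡0
    with conjugate A E G μ EG GE eigenrow γ ε ≟ 0ℚ
  ... | yes e = e
  ... | no B≢0 = ⊥-elim (rank c indep)
    where
    B = conjugate A E G μ EG GE eigenrow
    J = ε ∷ nonzeros μ
    r = length (nonzeros μ)
    nonzero : ∀ {x} → x ∈ nonzeros μ → μ x ≢ 0ℚ
    nonzero x∈ = proj₂ (∈ₚ.∈-filter⁻ (λ α → ¬? (μ α ≟ 0ℚ)) {xs = I} x∈)
    J! : Unique J
    J! = All.tabulate (λ x∈ → λ { refl → nonzero x∈ με≡0 }) ∷ Uniqueₚ.filter⁺ (λ α → ¬? (μ α ≟ 0ℚ)) I!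
    c : Fin (suc r) → Vect
    c i β = G β (lookup J i)
    J⊆I : ∀ i → lookup J i ∈ I
    J⊆I Fin.zero    = ε∈
    J⊆I (Fin.suc i) = proj₁ (∈ₚ.∈-filter⁻ (λ α → ¬? (μ α ≟ 0ℚ)) {xs = I} (∈ₚ.∈-lookup i))
    indep : IndepFin I (suc r) (λ i → apply A (lin I (c i) unitV))
    indep a Σa≈0 = λ { Fin.zero → a₀≡0 ; (Fin.suc j) → a₊≡0 j }
      where
      v : Fin (suc r) → Vect
      v i = apply A (lin I (c i) unitV)
      -- Pairing the supposed relation with row `φ` of `E` turns it into a relation between entries
      -- of row `φ` of `B`.
      rows : ∀ φ → φ ∈ I → sumFin (suc r) (λ i → a i * B φ (lookup J i)) ≡ 0ℚ
      rows φ φ∈ = begin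
        sumFin (suc r) (λ i → a i * B φ (lookup J i))
          ≡⟨ sumFin-cong (suc r) (λ i → cong (a i *_) (begin
               B φ (lookup J i)                       ≡⟨ ⊗-assoc E A G φ (lookup J i) φ∈ (J⊆I i) ⟩
               ∑ I (λ x → E φ x * (A ⊗ G) x (lookup J i)) ≡⟨ Σ-ext I (λ x → cong (E φ x *_) (sym (apply-lin-unitV A (c i) x))) ⟩
               ∑ I (λ x → E φ x * v i x) ∎)) ⟩
        sumFin (suc r) (λ i → a i * ∑ I (λ x → E φ x * v i x))
          ≡⟨ sumFin-cong (suc r) (λ i → trans (sym (Σ-*ˡ I (a i) _)) (Σ-ext I (λ x →
               solve 3 (λ a e v → a :* (e :* v) := e :* (a :* v)) refl (a i) (E φ x) (v i x)))) ⟩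
        sumFin (suc r) (λ i → ∑ I (λ x → E φ x * (a i * v i x)))
          ≡⟨ sym (Σ-sumFin I (suc r) (λ x i → E φ x * (a i * v i x))) ⟩
        ∑ I (λ x → sumFin (suc r) (λ i → E φ x * (a i * v i x)))
          ≡⟨ Σ-0 I (λ x x∈ → trans (sumFin-*ˡ (suc r) (E φ x) (λ i → a i * v i x)) (*0 (E φ x) (Σa≈0 x x∈))) ⟩
        0ℚ ∎
      -- Row `x` of `B` is `μ x` times a unit vector, so it isolates the coefficient belonging to
      -- `x`.
      a₊≡0 : ∀ j → a (Fin.suc j) ≡ 0ℚ
      a₊≡0 j = *-cancel-0 (a (Fin.suc j)) (μ x) μx≢0 (begin
        a (Fin.suc j) * μ x            ≡⟨ cong (a (Fin.suc j) *_) (sym (trans Brow (trans (cong (μ x *_) (δ-refl x)) (ℚₚ.*-identityʳ _)))) ⟩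
        a (Fin.suc j) * B x x          ≡⟨ sym (sumFin-single (suc r) (λ i → a i * B x (lookup J i)) (Fin.suc j) (λ i i≢j →
          *0 (a i) (trans (conjugate-eigenrow A E G μ EG GE eigenrow x (lookup J i) (J⊆I (Fin.suc j)) (J⊆I i) μx≢0)
            (*0 (μ x) (δ-≢ (λ e → i≢j (lookup-injective J! i (Fin.suc j) (sym e)))))))) ⟩
        sumFin (suc r) (λ i → a i * B x (lookup J i)) ≡⟨ rows x (J⊆I (Fin.suc j)) ⟩
        0ℚ ∎)
        where
        x = lookup J (Fin.suc j)
        μx≢0 : μ x ≢ 0ℚ
        μx≢0 = nonzero (∈ₚ.∈-lookup j)
        Brow : B x x ≡ μ x * δ x x
        Brow = conjugate-eigenrow A E G μ EG GE eigenrow x x (J⊆I (Fin.suc j)) (J⊆I (Fin.suc j)) μx≢0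
      -- With the other coefficients gone, row `γ` leaves the single term `a Fin.zero * B γ ε`,
      -- whose second factor is nonzero by assumption.
      a₀≡0 : a Fin.zero ≡ 0ℚ
      a₀≡0 = *-cancel-0 (a Fin.zero) (B γ ε) B≢0 (trans
        (sym (sumFin-single (suc r) (λ i → a i * B γ (lookup J i)) Fin.zero
          λ { Fin.zero z≢z → contradiction refl z≢z ; (Fin.suc j) _ → 0* (B γ (lookup J (Fin.suc j))) (a₊≡0 j) }))
        (rows γ γ∈))

  lin-lin : ∀ a (P : Mat) (gen : List ℕ → Vect) x →
    lin I a (λ γ → lin I (P γ) gen) x ≡ lin I (λ β → ∑ I (λ γ → a γ * P γ β)) gen x
  lin-lin a P gen x = begin
    lin I a (λ γ → lin I (P γ) gen) x
      ≡⟨ trans (lin-∑ I a (λ γ → lin I (P γ) gen) x) (Σ-ext I (λ γ → cong (a γ *_) (lin-∑ I (P γ) gen x))) ⟩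
    ∑ I (λ γ → a γ * ∑ I (λ β → P γ β * gen β x))
      ≡⟨ Σ-ext I (λ γ → sym (Σ-*ˡ I (a γ) _)) ⟩
    ∑ I (λ γ → ∑ I (λ β → a γ * (P γ β * gen β x)))
      ≡⟨ Σ-swap I I _ ⟩
    ∑ I (λ β → ∑ I (λ γ → a γ * (P γ β * gen β x)))
      ≡⟨ Σ-ext I (λ β → trans (Σ-ext I (λ γ → sym (ℚₚ.*-assoc (a γ) (P γ β) (gen β x)))) (Σ-*ʳ I (gen β x) _)) ⟩
    ∑ I (λ β → ∑ I (λ γ → a γ * P γ β) * gen β x)
      ≡⟨ sym (lin-∑ I (λ β → ∑ I (λ γ → a γ * P γ β)) gen x) ⟩
    lin I (λ β → ∑ I (λ γ → a γ * P γ β)) gen x ∎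

  lin-cong : ∀ {a a'} gen x → (∀ γ → γ ∈ I → a γ ≡ a' γ) → lin I a gen x ≡ lin I a' gen x
  lin-cong {a} {a'} gen x h = trans (lin-∑ I a gen x)
    (trans (Σ-cong I (λ γ γ∈ → cong (_* gen γ x) (h γ γ∈))) (sym (lin-∑ I a' gen x)))

  diagonalizable : ∀ {gen L T P Q} μ → P ⊗ Q ≋ δ → Q ⊗ P ≋ δ →
    (∀ a → lin I a gen ≈[ L ] zeroV → ∀ γ → γ ∈ I → a γ ≡ 0ℚ) →
    (∀ γ → γ ∈ I → T (lin I (P γ) gen) ≈[ L ] (λ x → μ γ * lin I (P γ) gen x)) →
    Diagonalizable I gen L T
  diagonalizable {gen} {L} {T} {P} {Q} μ PQ QP indep eigen =
    b , μ , (λ γ _ → P γ , λ x _ → refl) , indep-b , spans , eigen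
    where
    b : List ℕ → Vect
    b γ = lin I (P γ) gen
    cancel : ∀ {M N} → M ⊗ N ≋ δ → ∀ a γ → γ ∈ I → ∑ I (λ β → ∑ I (λ ε → a ε * M ε β) * N β γ) ≡ a γ
    cancel {M} {N} MN a γ γ∈ = begin
      -- A row vector is read as a matrix with all rows equal, so that the matrix laws apply to it;
      -- the first index is a dummy.
      (((λ _ → a) ⊗ M) ⊗ N) γ γ ≡⟨ ⊗-assoc (λ _ → a) M N γ γ γ∈ γ∈ ⟩
      ((λ _ → a) ⊗ (M ⊗ N)) γ γ ≡⟨ ⊗-congʳ (λ _ → a) MN γ γ γ∈ γ∈ ⟩
      ((λ _ → a) ⊗ δ) γ γ       ≡⟨ ⊗-identityʳ (λ _ → a) γ γ γ∈ γ∈ ⟩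
      a γ ∎
    indep-b : ∀ a → lin I a b ≈[ L ] zeroV → ∀ γ → γ ∈ I → a γ ≡ 0ℚ
    indep-b a ab≈0 γ γ∈ = trans (sym (cancel PQ a γ γ∈)) (Σ-0 I (λ β β∈ →
      0* (Q β γ) (indep (λ β → ∑ I (λ ε → a ε * P ε β)) (λ x x∈ → trans (sym (lin-lin a P gen x)) (ab≈0 x x∈)) β β∈)))
    spans : ∀ c → InSpan I b L (lin I c gen)
    spans c = (λ γ → ∑ I (λ ε → c ε * Q ε γ)) , λ x _ →
      sym (trans (lin-lin (λ γ → ∑ I (λ ε → c ε * Q ε γ)) P gen x) (lin-cong gen x (cancel QP c)))

-- Compositions and multiplicative matrices

Positive : List ℕ → Set
Positive = All (0 <_)

∑-comps : ∀ n (f : List ℕ → ℚ) →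
  ∑ (comps (suc (suc n))) f ≡ ∑ (comps (suc n)) (λ α → f (1 ∷ α) + f (incFirst α))
∑-comps n f = trans (Σ-concatMap (λ α → (1 ∷ α) ∷ incFirst α ∷ []) (comps (suc n)) f) (Σ-ext (comps (suc n)) (λ α →
  trans (∑-∷ (1 ∷ α) (incFirst α ∷ []) f) (cong (f (1 ∷ α) +_)
    (trans (∑-∷ (incFirst α) [] f) (trans (cong (f (incFirst α) +_) (∑-[] f)) (ℚₚ.+-identityʳ (f (incFirst α))))))))

∑-[x] : ∀ {A : Set} (x : A) f → ∑ (x ∷ []) f ≡ f x
∑-[x] x f = trans (∑-∷ x [] f) (trans (cong (f x +_) (∑-[] f)) (ℚₚ.+-identityʳ (f x)))

concatMap-∈ : ∀ {A B : Set} (f : A → List B) xs {z} → z ∈ concatMap f xs → ∃ λ x → x ∈ xs × z ∈ f x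
concatMap-∈ f (x ∷ xs) z∈ with ∈ₚ.∈-++⁻ (f x) z∈
... | inj₁ p = x , here refl , p
... | inj₂ p with concatMap-∈ f xs p
...   | y , y∈ , q = y , there y∈ , q

∈-concatMap : ∀ {A B : Set} (f : A → List B) xs {x z} → x ∈ xs → z ∈ f x → z ∈ concatMap f xs
∈-concatMap f (x ∷ xs) (here refl) p = ∈ₚ.∈-++⁺ˡ p
∈-concatMap f (x ∷ xs) (there q)   p = ∈ₚ.∈-++⁺ʳ (f x) (∈-concatMap f xs q p)

concatMap-unique : ∀ {A B : Set} (f : A → List B) {xs} → Unique xs → (∀ x → x ∈ xs → Unique (f x)) →
  (∀ x y z → x ∈ xs → y ∈ xs → z ∈ f x → z ∈ f y → x ≡ y) → Unique (concatMap f xs)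
concatMap-unique f {[]}     _        _ _ = []
concatMap-unique f {x ∷ xs} (u ∷ us) v d = Uniqueₚ.++⁺ (v x (here refl))
  (concatMap-unique f us (λ y y∈ → v y (there y∈)) (λ y z w y∈ z∈ → d y z w (there y∈) (there z∈)))
  (λ {z} (p , q) → case concatMap-∈ f xs q of λ (y , y∈ , q') →
     All.lookup u y∈ (d x y z (here refl) (there y∈) p q'))

comps-sound : ∀ n α → α ∈ comps n → Positive α × sum α ≡ n
comps-sound zero          _ (here refl) = [] , refl
comps-sound (suc zero)    _ (here refl) = s≤s z≤n ∷ [] , refl
comps-sound (suc (suc n)) α α∈ = step (comps-sound (suc n)) α α∈
  where
  step : (∀ β → β ∈ comps (suc n) → Positive β × sum β ≡ suc n) →
         ∀ α → α ∈ comps (suc (suc n)) → Positive α × sum α ≡ suc (suc n)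
  step ih α α∈ with concatMap-∈ (λ α → (1 ∷ α) ∷ incFirst α ∷ []) (comps (suc n)) α∈
  ... | β , β∈ , z with ih β β∈
  step ih _ _ | β , β∈ , here refl             | p , e     = s≤s z≤n ∷ p , cong suc e
  step ih _ _ | b ∷ β , β∈ , there (here refl) | _ ∷ p , e = s≤s z≤n ∷ p , cong suc e

comps-positive : ∀ n {α} → α ∈ comps n → Positive α
comps-positive n {α} α∈ = proj₁ (comps-sound n α α∈)

comps-sum : ∀ n {α} → α ∈ comps n → sum α ≡ n
comps-sum n {α} α∈ = proj₂ (comps-sound n α α∈)

comps-complete : ∀ n α → Positive α → sum α ≡ n → α ∈ comps n
comps-complete zero    []                  _       _ = here refl
comps-complete zero    (suc a ∷ α)         _       ()
comps-complete zero    (zero ∷ α)          (() ∷ _) _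
comps-complete (suc n) (zero ∷ α)          (() ∷ _) _
comps-complete (suc zero) (suc zero ∷ [])  _       _ = here refl
comps-complete (suc zero) (suc zero ∷ suc b ∷ α) _ ()
comps-complete (suc zero) (suc zero ∷ zero ∷ α) (_ ∷ () ∷ _) _
comps-complete (suc zero) (suc (suc a) ∷ α) _ ()
comps-complete (suc (suc n)) (suc zero ∷ α) (_ ∷ p) e =
  ∈-concatMap (λ α → (1 ∷ α) ∷ incFirst α ∷ []) (comps (suc n)) (comps-complete (suc n) α p (ℕₚ.suc-injective e)) (here refl)
comps-complete (suc (suc n)) (suc (suc a) ∷ α) (_ ∷ p) e =
  ∈-concatMap (λ α → (1 ∷ α) ∷ incFirst α ∷ []) (comps (suc n)) (comps-complete (suc n) (suc a ∷ α) (s≤s z≤n ∷ p) (ℕₚ.suc-injective e)) (there (here refl))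

comps-head : ∀ n {α} → α ∈ comps (suc n) → ∃ λ a → ∃ λ β → α ≡ suc a ∷ β
comps-head n {α} α∈ with comps-sound (suc n) α α∈
comps-head n {suc a ∷ β} α∈ | _ , e = a , β , refl
comps-head n {zero ∷ β}  α∈ | () ∷ _ , e

comps-unique : ∀ n → Unique (comps n)
comps-unique zero          = [] ∷ []
comps-unique (suc zero)    = [] ∷ []
comps-unique (suc (suc n)) = concatMap-unique _ (comps-unique (suc n))
  (λ α α∈ → ((λ e → 1∷≢incFirst α∈ e) ∷ []) ∷ [] ∷ []) distinct
  where
  1∷≢incFirst : ∀ {α β} → β ∈ comps (suc n) → 1 ∷ α ≢ incFirst β
  1∷≢incFirst β∈ e with comps-head n β∈
  1∷≢incFirst β∈ () | b , β , refl
  distinct : ∀ α β γ → α ∈ comps (suc n) → β ∈ comps (suc n) → γ ∈ (1 ∷ α) ∷ incFirst α ∷ [] → γ ∈ (1 ∷ β) ∷ incFirst β ∷ [] → α ≡ β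
  distinct α β γ α∈ β∈ (here refl)         (here refl)         = refl
  distinct α β γ α∈ β∈ (here refl)         (there (here e))    = contradiction e (1∷≢incFirst β∈)
  distinct α β γ α∈ β∈ (there (here refl)) (here e)            = contradiction (sym e) (1∷≢incFirst α∈)
  distinct α β γ α∈ β∈ (there (here refl)) (there (here e)) with comps-head n α∈ | comps-head n β∈
  distinct _ _ _ _ _ _ (there (here refl)) | a , α , refl | b , β , refl = refl

sum-++ : ∀ x y → sum (x ++ y) ≡ sum x ℕ.+ sum y
sum-++ []      y = refl
sum-++ (a ∷ x) y = trans (cong (a ℕ.+_) (sum-++ x y)) (sym (ℕₚ.+-assoc a (sum x) (sum y)))

comps-++⁻ : ∀ p q x y → x ++ y ∈ comps (p ℕ.+ q) → sum x ≡ p → x ∈ comps p × y ∈ comps q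
comps-++⁻ p q x y xy∈ refl =
  comps-complete p x (Allₚ.++⁻ˡ x (comps-positive (sum x ℕ.+ q) xy∈)) refl ,
  comps-complete q y (Allₚ.++⁻ʳ x (comps-positive (sum x ℕ.+ q) xy∈))
    (ℕₚ.+-cancelˡ-≡ (sum x) (sum y) q (trans (sym (sum-++ x y)) (comps-sum (sum x ℕ.+ q) xy∈)))

single-∈ : ∀ n → single n ∈ comps n
single-∈ zero    = here refl
single-∈ (suc n) = comps-complete (suc n) (suc n ∷ []) (s≤s z≤n ∷ []) (ℕₚ.+-identityʳ (suc n))

length≤sum : ∀ {α} → Positive α → length α ≤ sum α
length≤sum []      = z≤n
length≤sum (p ∷ ps) = ℕₚ.+-mono-≤ p (length≤sum ps)

-- Cutting compositions in two.

-- The sum of F x y over the factorisations β = x ++ y whose first factor has a sum satisfying q.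
cutSum : (ℕ → Bool) → List ℕ → (List ℕ → List ℕ → ℚ) → ℚ
cutSum q []      F = ind (q 0) * F [] []
cutSum q (b ∷ β) F = ind (q 0) * F [] (b ∷ β) + cutSum (λ s → q (b ℕ.+ s)) β (λ x → F (b ∷ x))

-- Links the indexed form of the coproduct to recursion on the list. A predicate in place of a
-- target sum lets the recursion absorb a part `b` by shifting the argument, with no subtraction.
cutSum-upTo : ∀ q β F →
  ∑ (upTo (suc (length β))) (λ i → ind (q (sum (take i β))) * F (take i β) (drop i β)) ≡ cutSum q β F
cutSum-upTo q []      F = ∑-[x] 0 _
cutSum-upTo q (b ∷ β) F = trans (Σ-upTo-suc (suc (length β)) _)
  (cong (ind (q 0) * F [] (b ∷ β) +_) (cutSum-upTo (λ s → q (b ℕ.+ s)) β (λ x → F (b ∷ x))))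

cutSum-cong : ∀ q β {F G} → (∀ x y → x ++ y ≡ β → q (sum x) ≡ true → F x y ≡ G x y) → cutSum q β F ≡ cutSum q β G
cutSum-cong q []      h = ind-cong* (q 0) (h [] [] refl)
cutSum-cong q (b ∷ β) h = cong₂ _+_ (ind-cong* (q 0) (h [] (b ∷ β) refl))
  (cutSum-cong (λ s → q (b ℕ.+ s)) β (λ x y e → h (b ∷ x) y (cong (b ∷_) e)))

cutSum-0 : ∀ q β {F} → (∀ x y → x ++ y ≡ β → q (sum x) ≡ true → F x y ≡ 0ℚ) → cutSum q β F ≡ 0ℚ
cutSum-0 q []      h = trans (ind-cong* (q 0) (h [] [] refl)) (ℚₚ.*-zeroʳ (ind (q 0)))
cutSum-0 q (b ∷ β) h = trans (cong₂ _+_ (trans (ind-cong* (q 0) (h [] (b ∷ β) refl)) (ℚₚ.*-zeroʳ (ind (q 0))))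
  (cutSum-0 (λ s → q (b ℕ.+ s)) β (λ x y e → h (b ∷ x) y (cong (b ∷_) e)))) (ℚₚ.+-identityˡ 0ℚ)

cutSum-[] : ∀ q β {F} → q 0 ≡ true → (∀ a x y → a ∷ x ++ y ≡ β → q (sum (a ∷ x)) ≡ true → F (a ∷ x) y ≡ 0ℚ) → cutSum q β F ≡ F [] β
cutSum-[] q []      {F} q0 h = ind-true* (F [] []) q0
cutSum-[] q (b ∷ β) {F} q0 h = trans (cong₂ _+_ (ind-true* (F [] (b ∷ β)) q0)
  (cutSum-0 (λ s → q (b ℕ.+ s)) β (λ x y e → h b x y (cong (b ∷_) e)))) (ℚₚ.+-identityʳ (F [] (b ∷ β)))

cutSum-*ˡ : ∀ q β c F → cutSum q β (λ x y → c * F x y) ≡ c * cutSum q β F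
cutSum-*ˡ q []      c F = solve 3 (λ i c f → i :* (c :* f) := c :* (i :* f)) refl (ind (q 0)) c (F [] [])
cutSum-*ˡ q (b ∷ β) c F = trans (cong (ind (q 0) * (c * F [] (b ∷ β)) +_) (cutSum-*ˡ (λ s → q (b ℕ.+ s)) β c (λ x → F (b ∷ x))))
  (solve 4 (λ i c f r → i :* (c :* f) :+ c :* r := c :* (i :* f :+ r)) refl (ind (q 0)) c (F [] (b ∷ β)) _)

cutSum-*ʳ : ∀ q β c F → cutSum q β (λ x y → F x y * c) ≡ cutSum q β F * c
cutSum-*ʳ q β c F = trans (cutSum-cong q β (λ x y _ _ → ℚₚ.*-comm (F x y) c))
  (trans (cutSum-*ˡ q β c F) (ℚₚ.*-comm c (cutSum q β F)))

cutSum-∑ : ∀ {A : Set} (xs : List A) q β (F : A → List ℕ → List ℕ → ℚ) →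
  ∑ xs (λ a → cutSum q β (F a)) ≡ cutSum q β (λ x y → ∑ xs (λ a → F a x y))
cutSum-∑ xs q []      F = Σ-*ˡ xs (ind (q 0)) (λ a → F a [] [])
cutSum-∑ xs q (b ∷ β) F = trans (Σ-+ xs _ _) (cong₂ _+_ (Σ-*ˡ xs (ind (q 0)) (λ a → F a [] (b ∷ β)))
  (cutSum-∑ xs (λ s → q (b ℕ.+ s)) β (λ a x → F a (b ∷ x))))

-- A zero part would create further cuts of sum 0, hence the positivity.
cutSum-at-0 : ∀ β F → Positive β → cutSum (_≡ᵇ 0) β F ≡ F [] β
cutSum-at-0 β F p = cutSum-[] (_≡ᵇ 0) β refl (λ { (suc a) x y e () ; zero x y refl _ → case p of λ { (() ∷ _) } })

0*+ : ∀ a b → 0ℚ * a + b ≡ b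
0*+ a b = trans (cong (_+ b) (ℚₚ.*-zeroˡ a)) (ℚₚ.+-identityˡ b)

-- Concatenation is a bijection from pairs of compositions of `p` and `q` onto the compositions of
-- `p + q` that can be cut at `p`. The induction on `p` follows the two moves of `comps`; for
-- `p = 1` and `q > 0`, raising the first part destroys the cut, so only the move `1 ∷ α`
-- contributes.
∑-cutSum : ∀ p q F → ∑ (comps (p ℕ.+ q)) (λ α → cutSum (_≡ᵇ p) α F) ≡ ∑ (comps p) (λ x → ∑ (comps q) (F x))
∑-cutSum zero q F = trans (Σ-cong (comps q) (λ α α∈ → cutSum-at-0 α F (comps-positive q α∈))) (sym (∑-[x] [] _))
∑-cutSum (suc zero) zero F = trans (∑-[x] (1 ∷ []) _) (trans (0*+ (F [] (1 ∷ [])) _)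
  (trans (ℚₚ.*-identityˡ (F (1 ∷ []) [])) (sym (trans (∑-[x] (1 ∷ []) _) (∑-[x] [] _)))))
∑-cutSum (suc zero) (suc q) F = begin
  ∑ (comps (suc (suc q))) (λ α → cutSum (_≡ᵇ 1) α F)
    ≡⟨ ∑-comps q _ ⟩
  ∑ (comps (suc q)) (λ α → cutSum (_≡ᵇ 1) (1 ∷ α) F + cutSum (_≡ᵇ 1) (incFirst α) F)
    ≡⟨ Σ-cong (comps (suc q)) summand ⟩
  ∑ (comps (suc q)) (F (1 ∷ []))
    ≡⟨ sym (∑-[x] (1 ∷ []) _) ⟩
  ∑ (comps 1) (λ x → ∑ (comps (suc q)) (F x)) ∎
  where
  summand : ∀ α → α ∈ comps (suc q) → cutSum (_≡ᵇ 1) (1 ∷ α) F + cutSum (_≡ᵇ 1) (incFirst α) F ≡ F (1 ∷ []) α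
  summand α α∈ with comps-head q α∈
  ... | a , β , refl = trans (cong₂ _+_
    (trans (0*+ (F [] (1 ∷ α)) _) (cutSum-at-0 α (λ x → F (1 ∷ x)) (comps-positive (suc q) α∈)))
    (trans (0*+ (F [] (suc (suc a) ∷ β)) _) (cutSum-0 (λ s → (suc (suc a) ℕ.+ s) ≡ᵇ 1) β {λ x → F (suc (suc a) ∷ x)} (λ _ _ _ ()))))
    (ℚₚ.+-identityʳ (F (1 ∷ []) α))
∑-cutSum (suc (suc p)) q F = begin
  ∑ (comps (suc (suc (p ℕ.+ q)))) (λ α → cutSum (_≡ᵇ suc (suc p)) α F)
    ≡⟨ ∑-comps (p ℕ.+ q) _ ⟩
  ∑ (comps (suc (p ℕ.+ q))) (λ α → cutSum (_≡ᵇ suc (suc p)) (1 ∷ α) F + cutSum (_≡ᵇ suc (suc p)) (incFirst α) F)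
    ≡⟨ Σ-cong (comps (suc (p ℕ.+ q))) summand ⟩
  ∑ (comps (suc (p ℕ.+ q))) (λ α → cutSum (_≡ᵇ suc p) α (λ x → F (1 ∷ x)) + cutSum (_≡ᵇ suc p) α (λ x → F (incFirst x)))
    ≡⟨ trans (Σ-+ (comps (suc (p ℕ.+ q))) _ _) (cong₂ _+_ (∑-cutSum (suc p) q (λ x → F (1 ∷ x))) (∑-cutSum (suc p) q (λ x → F (incFirst x)))) ⟩
  ∑ (comps (suc p)) (λ x → ∑ (comps q) (F (1 ∷ x))) + ∑ (comps (suc p)) (λ x → ∑ (comps q) (F (incFirst x)))
    ≡⟨ sym (Σ-+ (comps (suc p)) _ _) ⟩
  ∑ (comps (suc p)) (λ x → ∑ (comps q) (F (1 ∷ x)) + ∑ (comps q) (F (incFirst x)))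
    ≡⟨ sym (∑-comps p _) ⟩
  ∑ (comps (suc (suc p))) (λ x → ∑ (comps q) (F x)) ∎
  where
  summand : ∀ α → α ∈ comps (suc (p ℕ.+ q)) →
    cutSum (_≡ᵇ suc (suc p)) (1 ∷ α) F + cutSum (_≡ᵇ suc (suc p)) (incFirst α) F ≡
    cutSum (_≡ᵇ suc p) α (λ x → F (1 ∷ x)) + cutSum (_≡ᵇ suc p) α (λ x → F (incFirst x))
  summand α α∈ with comps-head (p ℕ.+ q) α∈
  ... | a , β , refl = cong₂ _+_ (0*+ (F [] (1 ∷ α)) _)
    (trans (0*+ (F [] (suc (suc a) ∷ β)) _) (sym (0*+ (F [] (suc a ∷ β)) _)))

-- The matrix of an endomorphism of the free algebra on generators indexed by ℕ,
-- f a being the image of the a-th generator.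
mulExt : (ℕ → Vect) → Mat
mulExt f []      β = δ β []
mulExt f (a ∷ α) β = cutSum (_≡ᵇ a) β (λ x y → f a x * mulExt f α y)

-- A positive part of `α` can only match a nonempty factor of `β`, so `β` has at least as many parts
-- as `α`, and with equality every factor is the part itself. Length thus stands in for the
-- refinement order in the triangularity arguments.
mulExt-upper : ∀ f α β → Positive α → β ≢ α → length β ≤ length α → mulExt f α β ≡ 0ℚ
mulExt-upper f []          []      _        β≢α _ = contradiction refl β≢α
mulExt-upper f (suc a ∷ α) []      _        _   _ = ℚₚ.*-zeroˡ (f (suc a) [] * mulExt f α [])
mulExt-upper f (zero ∷ α)  []      (() ∷ _)
mulExt-upper f (suc a ∷ α) (b ∷ β) (_ ∷ ps) β≢α (s≤s len) =
  trans (0*+ (f (suc a) [] * mulExt f α (b ∷ β)) _) (cutSum-0 (λ s → b ℕ.+ s ≡ᵇ suc a) β term)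
  where
  term : ∀ x y → x ++ y ≡ β → (b ℕ.+ sum x ≡ᵇ suc a) ≡ true → f (suc a) (b ∷ x) * mulExt f α y ≡ 0ℚ
  term []      y refl e = *0 (f (suc a) (b ∷ [])) (mulExt-upper f α y ps
    (λ { refl → β≢α (cong (_∷ α) (trans (sym (ℕₚ.+-identityʳ b)) (≡ᵇ⇒≡ (b ℕ.+ 0) (suc a) e))) }) len)
  term (c ∷ x) y refl e = *0 (f (suc a) (b ∷ c ∷ x)) (mulExt-upper f α y ps
    (λ { refl → ℕₚ.<-irrefl refl (ℕₚ.≤-trans (s≤s (subst (length y ≤_) (sym (Listₚ.length-++ x)) (ℕₚ.m≤n+m _ _))) len) })
    (ℕₚ.≤-trans (ℕₚ.≤-trans (subst (length y ≤_) (sym (Listₚ.length-++ x)) (ℕₚ.m≤n+m _ _)) (ℕₚ.n≤1+n _)) len))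

-- Taking more than the first part leaves a remainder too short for `α`, and `mulExt-upper` kills
-- that term.
mulExt-diag : ∀ f a α → Positive (a ∷ α) → mulExt f (a ∷ α) (a ∷ α) ≡ f a (a ∷ []) * mulExt f α α
mulExt-diag f (suc a) α (_ ∷ ps) = trans (0*+ (f (suc a) [] * mulExt f α (suc a ∷ α)) _)
  (cutSum-[] (λ s → suc a ℕ.+ s ≡ᵇ suc a) α (trans (cong (_≡ᵇ a) (ℕₚ.+-identityʳ a)) (≡ᵇ-refl a)) term)
  where
  term : ∀ c x y → c ∷ x ++ y ≡ α → (a ℕ.+ sum (c ∷ x) ≡ᵇ a) ≡ true → f (suc a) (suc a ∷ c ∷ x) * mulExt f α y ≡ 0ℚ
  term c x y refl _ = *0 (f (suc a) (suc a ∷ c ∷ x)) (mulExt-upper f (c ∷ x ++ y) y ps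
    (λ e → ℕₚ.<-irrefl (cong length e) (s≤s (subst (length y ≤_) (sym (Listₚ.length-++ x)) (ℕₚ.m≤n+m _ _))))
    (ℕₚ.≤-trans (subst (length y ≤_) (sym (Listₚ.length-++ x)) (ℕₚ.m≤n+m _ _)) (ℕₚ.n≤1+n _)))

-- Hopf endomorphisms in the monomial basis.

module HopfEnd (Φ : Mat) (hopf : IsHopfEnd Φ) where

  open IsHopfEnd hopf

  comult-cutSum : ∀ p q α₁ α₂ β → α₁ ∈ comps p → α₂ ∈ comps q → β ∈ comps (p ℕ.+ q) →
    Φ (α₁ ++ α₂) β ≡ cutSum (_≡ᵇ p) β (λ x y → Φ α₁ x * Φ α₂ y)
  comult-cutSum p q α₁ α₂ β α₁∈ α₂∈ β∈ =
    trans (comult p q α₁ α₂ β α₁∈ α₂∈ β∈) (trans (∑-def (upTo (suc (length β))) _) (cutSum-upTo (_≡ᵇ p) β (λ x y → Φ α₁ x * Φ α₂ y)))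

  comult-∷ : ∀ a q α β → 0 < a → α ∈ comps q → β ∈ comps (a ℕ.+ q) →
    Φ (a ∷ α) β ≡ cutSum (_≡ᵇ a) β (λ x y → Φ (a ∷ []) x * Φ α y)
  comult-∷ (suc a) q α β _ α∈ β∈ = comult-cutSum (suc a) q (suc a ∷ []) α β (single-∈ (suc a)) α∈ β∈

  -- The coproduct is deconcatenation, so on the dual side, where the rows of `Φ` live, `comult`
  -- says that concatenating indices multiplies rows. Hence the rows at one-part compositions
  -- determine all others.
  Φ-mulExt : ∀ n α β → α ∈ comps n → β ∈ comps n → Φ α β ≡ mulExt (λ a → Φ (a ∷ [])) α β
  Φ-mulExt n α β α∈ β∈ with comps-sound n α α∈
  Φ-mulExt _ [] β α∈ (here refl) | _ , refl = unit
  Φ-mulExt _ (a ∷ α) β α∈ β∈ | p ∷ ps , refl =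
    trans (comult-∷ a (sum α) α β p (comps-complete (sum α) α ps refl) β∈)
      (cutSum-cong (_≡ᵇ a) β (λ { x y refl e → cong (Φ (a ∷ []) x *_)
        (Φ-mulExt (sum α) α y (comps-complete (sum α) α ps refl) (proj₂ (comps-++⁻ a (sum α) x y β∈ (≡ᵇ⇒≡ (sum x) a e)))) }))

  Φ-upper : ∀ n → Triangular.UpperTriangular (comps n) (comps-unique n) length Φ
  Φ-upper n α β α∈ β∈ α≢β ¬lt = trans (Φ-mulExt n α β α∈ β∈)
    (mulExt-upper (λ a → Φ (a ∷ [])) α β (comps-positive n α∈) (α≢β ∘ sym) (ℕₚ.≮⇒≥ ¬lt))

  Φ-diag : ∀ n α → α ∈ comps n → Φ α α ≡ lamC Φ α
  Φ-diag n α α∈ = trans (Φ-mulExt n α α α∈ α∈) (go α (comps-positive n α∈))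
    where
    go : ∀ α → Positive α → mulExt (λ a → Φ (a ∷ [])) α α ≡ lamC Φ α
    go []          _ = refl
    go (suc a ∷ α) (p ∷ ps) = trans (mulExt-diag (λ a → Φ (a ∷ [])) (suc a) α (p ∷ ps)) (cong (lam Φ (suc a) *_) (go α ps))

  -- Bilinear extension of `comult`: the dual of Φ respects products of arbitrary row vectors. This
  -- generality is needed because eigenvectors are not basis vectors.
  ∑-comps-mul : ∀ p q (u v : Vect) β → β ∈ comps (p ℕ.+ q) →
    ∑ (comps (p ℕ.+ q)) (λ α → cutSum (_≡ᵇ p) α (λ x y → u x * v y) * Φ α β) ≡
    cutSum (_≡ᵇ p) β (λ x y → ∑ (comps p) (λ α → u α * Φ α x) * ∑ (comps q) (λ α → v α * Φ α y))
  ∑-comps-mul p q u v β β∈ = begin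
    ∑ (comps (p ℕ.+ q)) (λ α → cutSum (_≡ᵇ p) α (λ x y → u x * v y) * Φ α β)
      ≡⟨ Σ-ext (comps (p ℕ.+ q)) (λ α → trans (sym (cutSum-*ʳ (_≡ᵇ p) α (Φ α β) (λ x y → u x * v y)))
           (cutSum-cong (_≡ᵇ p) α (λ { x y refl _ → refl }))) ⟩
    ∑ (comps (p ℕ.+ q)) (λ α → cutSum (_≡ᵇ p) α (λ x y → u x * v y * Φ (x ++ y) β))
      ≡⟨ ∑-cutSum p q (λ x y → u x * v y * Φ (x ++ y) β) ⟩
    ∑ (comps p) (λ α₁ → ∑ (comps q) (λ α₂ → u α₁ * v α₂ * Φ (α₁ ++ α₂) β))
      ≡⟨ Σ-cong (comps p) (λ α₁ α₁∈ → Σ-cong (comps q) (λ α₂ α₂∈ →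
           trans (cong (u α₁ * v α₂ *_) (comult-cutSum p q α₁ α₂ β α₁∈ α₂∈ β∈))
             (trans (sym (cutSum-*ˡ (_≡ᵇ p) β (u α₁ * v α₂) (λ x y → Φ α₁ x * Φ α₂ y)))
               (cutSum-cong (_≡ᵇ p) β (λ x y _ _ →
                 solve 4 (λ a b c d → a :* b :* (c :* d) := a :* c :* (b :* d)) refl (u α₁) (v α₂) (Φ α₁ x) (Φ α₂ y)))))) ⟩
    ∑ (comps p) (λ α₁ → ∑ (comps q) (λ α₂ → cutSum (_≡ᵇ p) β (λ x y → u α₁ * Φ α₁ x * (v α₂ * Φ α₂ y))))
      ≡⟨ trans (Σ-ext (comps p) (λ α₁ → cutSum-∑ (comps q) (_≡ᵇ p) β (λ α₂ x y → u α₁ * Φ α₁ x * (v α₂ * Φ α₂ y)))) (cutSum-∑ (comps p) (_≡ᵇ p) β (λ α₁ x y → ∑ (comps q) (λ α₂ → u α₁ * Φ α₁ x * (v α₂ * Φ α₂ y)))) ⟩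
    cutSum (_≡ᵇ p) β (λ x y → ∑ (comps p) (λ α₁ → ∑ (comps q) (λ α₂ → u α₁ * Φ α₁ x * (v α₂ * Φ α₂ y))))
      ≡⟨ cutSum-cong (_≡ᵇ p) β (λ x y _ _ → trans (Σ-ext (comps p) (λ α₁ → Σ-*ˡ (comps q) (u α₁ * Φ α₁ x) _))
           (Σ-*ʳ (comps p) (∑ (comps q) (λ α → v α * Φ α y)) _)) ⟩
    cutSum (_≡ᵇ p) β (λ x y → ∑ (comps p) (λ α → u α * Φ α x) * ∑ (comps q) (λ α → v α * Φ α y)) ∎

  -- Left eigenvectors of Φ and their products.

  EigenGenerator : (ℕ → Vect) → ℕ → Set
  EigenGenerator e c = ∀ β → β ∈ comps c → ∑ (comps c) (λ α → e c α * Φ α β) ≡ lam Φ c * e c β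

  -- Eigenvalues multiply because the dual of Φ is an algebra endomorphism; `∑-comps-mul` splits off
  -- the first factor.
  mulExt-eigen : ∀ e γ → All (EigenGenerator e) γ → Positive γ → ∀ β → β ∈ comps (sum γ) →
    ∑ (comps (sum γ)) (λ α → mulExt e γ α * Φ α β) ≡ lamC Φ γ * mulExt e γ β
  mulExt-eigen e []      _        _ _ (here refl) = trans (∑-[x] [] _) (cong (1ℚ *_) unit)
  mulExt-eigen e (c ∷ γ) (h ∷ hs) (p ∷ ps) β β∈ = begin
    ∑ (comps (c ℕ.+ sum γ)) (λ α → cutSum (_≡ᵇ c) α (λ x y → e c x * mulExt e γ y) * Φ α β)
      ≡⟨ ∑-comps-mul c (sum γ) (e c) (mulExt e γ) β β∈ ⟩
    cutSum (_≡ᵇ c) β (λ x y → ∑ (comps c) (λ α → e c α * Φ α x) * ∑ (comps (sum γ)) (λ α → mulExt e γ α * Φ α y))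
      ≡⟨ cutSum-cong (_≡ᵇ c) β (λ { x y refl q → let (x∈ , y∈) = comps-++⁻ c (sum γ) x y β∈ (≡ᵇ⇒≡ (sum x) c q) in
           trans (cong₂ _*_ (h x x∈) (mulExt-eigen e γ hs ps y y∈))
             (solve 4 (λ a b c d → a :* b :* (c :* d) := a :* c :* (b :* d)) refl (lam Φ c) (e c x) (lamC Φ γ) (mulExt e γ y)) }) ⟩
    cutSum (_≡ᵇ c) β (λ x y → lam Φ c * lamC Φ γ * (e c x * mulExt e γ y))
      ≡⟨ cutSum-*ˡ (_≡ᵇ c) β (lam Φ c * lamC Φ γ) (λ x y → e c x * mulExt e γ y) ⟩
    lamC Φ (c ∷ γ) * mulExt e (c ∷ γ) β ∎

  -- Forward substitution for e Φ = λ_m e. At (m) the pivot λ_m - λ_m vanishes and the coefficient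
  -- is free; taking 1 both for `d` and for the right side normalises it to 1. Elsewhere the pivot
  -- is λ_β - λ_m.
  generator : ℕ → Vect
  generator m = Triangular.solveLower (comps m) (comps-unique m) length Φ
    (λ β → if eqL β (m ∷ []) then 1ℚ else inv (lamC Φ β - lam Φ m)) (λ β → δ β (m ∷ []))

  private
    lower : ∀ m → List ℕ → ℚ
    lower m β = ∑ (comps m) (λ α → ind (length α <ᵇ length β) * (generator m α * Φ α β))

    generator-eq : ∀ m β → generator m β ≡
      (if eqL β (m ∷ []) then 1ℚ else inv (lamC Φ β - lam Φ m)) * (δ β (m ∷ []) - lower m β)
    generator-eq m β = Triangular.solveLower-eq (comps m) (comps-unique m) length Φ
      (λ β → if eqL β (m ∷ []) then 1ℚ else inv (lamC Φ β - lam Φ m)) (λ β → δ β (m ∷ [])) β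

    -- For positive m the composition (m) is the shortest one of m, so no term lies below it.
    lower-single : ∀ m → 0 < m → lower m (m ∷ []) ≡ 0ℚ
    lower-single (suc m) _ = Σ-0 (comps (suc m)) term
      where
      term : ∀ α → α ∈ comps (suc m) → ind (length α <ᵇ 1) * (generator (suc m) α * Φ α (suc m ∷ [])) ≡ 0ℚ
      term α α∈ with comps-head m α∈
      ... | _ , β , refl = ℚₚ.*-zeroˡ (generator (suc m) α * Φ α (suc m ∷ []))

  generator-single : ∀ m → 0 < m → generator m (m ∷ []) ≡ 1ℚ
  generator-single m 0<m = begin
    generator m (m ∷ [])
      ≡⟨ generator-eq m (m ∷ []) ⟩
    (if eqL (m ∷ []) (m ∷ []) then 1ℚ else inv (lamC Φ (m ∷ []) - lam Φ m)) * (δ (m ∷ []) (m ∷ []) - lower m (m ∷ []))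
      ≡⟨ cong₂ (λ b s → (if b then 1ℚ else inv (lamC Φ (m ∷ []) - lam Φ m)) * (ind b - s)) (eqL-refl (m ∷ [])) (lower-single m 0<m) ⟩
    1ℚ ∎

  generator-eigen : ∀ m → 0 < m → (∀ β → β ∈ comps m → β ≢ m ∷ [] → lam Φ m ≢ lamC Φ β) → EigenGenerator generator m
  generator-eigen m 0<m distinct β β∈ = trans
    (trans (Triangular.∑-upperTriangular (comps m) (comps-unique m) length (Φ-upper m) (generator m) β β∈)
      (cong (λ q → lower m β + generator m β * q) (Φ-diag m β β∈)))
    solved
    where
    solved : lower m β + generator m β * lamC Φ β ≡ lam Φ m * generator m β
    solved with β ≟L (m ∷ [])
    -- At (m) the pivot is zero, and the equation holds because nothing precedes (m) and the
    -- diagonal entry is λ_m itself.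
    ... | inj₁ refl = trans (cong (_+ generator m (m ∷ []) * (lam Φ m * 1ℚ)) (lower-single m 0<m))
      (solve 2 (λ g l → con 0ℚ :+ g :* (l :* con 1ℚ) := l :* g) refl (generator m (m ∷ [])) (lam Φ m))
    -- Away from (m) the right side `δ` is 0, and separation makes the pivot `D` invertible.
    ... | inj₂ β≢m  = begin
      lower m β + g * lamC Φ β                    ≡⟨ solve 4 (λ s g b m → s :+ g :* b := m :* g :+ (g :* (b :- m) :+ s)) refl (lower m β) g (lamC Φ β) (lam Φ m) ⟩
      lam Φ m * g + (g * D + lower m β)           ≡⟨ cong (λ q → lam Φ m * g + (q * D + lower m β)) g-eq ⟩
      lam Φ m * g + (inv D * (0ℚ - lower m β) * D + lower m β) ≡⟨ cong (lam Φ m * g +_) (begin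
          inv D * (0ℚ - lower m β) * D + lower m β ≡⟨ solve 3 (λ i s d → i :* (con 0ℚ :- s) :* d :+ s := s :- i :* d :* s) refl (inv D) (lower m β) D ⟩
          lower m β - inv D * D * lower m β        ≡⟨ cong (λ q → lower m β - q * lower m β) (inv-* D D≢0) ⟩
          lower m β - 1ℚ * lower m β               ≡⟨ solve 1 (λ s → s :- con 1ℚ :* s := con 0ℚ) refl (lower m β) ⟩
          0ℚ ∎) ⟩
      lam Φ m * g + 0ℚ                            ≡⟨ ℚₚ.+-identityʳ _ ⟩
      lam Φ m * g ∎
      where
      g = generator m β
      D = lamC Φ β - lam Φ m
      D≢0 : D ≢ 0ℚ
      D≢0 e = distinct β β∈ β≢m (sym (begin
        lamC Φ β                       ≡⟨ solve 2 (λ b m → b := (b :- m) :+ m) refl (lamC Φ β) (lam Φ m) ⟩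
        D + lam Φ m                    ≡⟨ cong (_+ lam Φ m) e ⟩
        0ℚ + lam Φ m                   ≡⟨ ℚₚ.+-identityˡ _ ⟩
        lam Φ m ∎))
      g-eq : g ≡ inv D * (0ℚ - lower m β)
      g-eq = trans (generator-eq m β) (cong (λ b → (if b then 1ℚ else inv D) * (ind b - lower m β)) (eqL-≢ β≢m))

  mulExt-generator-diag : ∀ γ → Positive γ → mulExt generator γ γ ≡ 1ℚ
  mulExt-generator-diag []      _        = refl
  mulExt-generator-diag (c ∷ γ) (p ∷ ps) = trans (mulExt-diag generator c γ (p ∷ ps))
    (cong₂ _*_ (generator-single c p) (mulExt-generator-diag γ ps))

-- Eigenbases of Φ_n.

module Spectrum (Φ : Mat) (hopf : IsHopfEnd Φ) (n : ℕ)
  (separated : ∀ m → 1 ≤ m → m ≤ n → lam Φ m ≢ 0ℚ →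
    ∀ β → β ∈ comps m → β ≢ m ∷ [] → lam Φ m ≢ lamC Φ β)
  (rank : HasRank (comps n) unitV (comps n) (applyΦ Φ n) (nonzeroCount Φ n)) where

  open HopfEnd Φ hopf
  open Matrices (comps n) (comps-unique n)

  private
    -- If λ_γ = 0, some part c has λ_c = 0, and separation provides no eigenvector for it. A unit
    -- vector then fills the row and keeps the matrix unitriangular.
    eigenrows : Mat
    eigenrows γ with lamC Φ γ ≟ 0ℚ
    ... | yes _ = δ γ
    ... | no _  = mulExt generator γ

    eigenrows-diag : ∀ γ → γ ∈ comps n → eigenrows γ γ ≡ 1ℚ
    eigenrows-diag γ γ∈ with lamC Φ γ ≟ 0ℚ
    ... | yes _ = δ-refl γ
    ... | no _  = mulExt-generator-diag γ (comps-positive n γ∈)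

    eigenrows-upper : Triangular.UpperTriangular (comps n) (comps-unique n) length eigenrows
    eigenrows-upper γ β γ∈ β∈ γ≢β ¬lt with lamC Φ γ ≟ 0ℚ
    ... | yes _ = δ-≢ γ≢β
    ... | no _  = mulExt-upper generator γ β (comps-positive n γ∈) (γ≢β ∘ sym) (ℕₚ.≮⇒≥ ¬lt)

    -- A nonzero product has nonzero factors, and every part of `γ` is at most `n`, so the
    -- separation hypothesis covers each part.
    parts-eigen : ∀ γ → Positive γ → sum γ ≤ n → lamC Φ γ ≢ 0ℚ → All (EigenGenerator generator) γ
    parts-eigen []      _        _  _ = []
    parts-eigen (c ∷ γ) (p ∷ ps) le h =
      generator-eigen c p (separated c p (ℕₚ.≤-trans (ℕₚ.m≤m+n c (sum γ)) le) (λ e → h (0* (lamC Φ γ) e)))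
      ∷ parts-eigen γ ps (ℕₚ.≤-trans (ℕₚ.m≤n+m (sum γ) c) le) (λ e → h (*0 (lam Φ c) e))

    eigenrows-eigen : ∀ γ → γ ∈ comps n → lamC Φ γ ≢ 0ℚ → ∀ β → β ∈ comps n →
      (eigenrows ⊗ Φ) γ β ≡ lamC Φ γ * eigenrows γ β
    eigenrows-eigen γ γ∈ λ≢0 β β∈ with lamC Φ γ ≟ 0ℚ
    ... | yes λ≡0 = contradiction λ≡0 λ≢0
    ... | no _ with comps-sound n γ γ∈
    ...   | ps , refl = mulExt-eigen generator γ (parts-eigen γ ps ℕₚ.≤-refl λ≢0) ps β β∈

    invertible : Invertible (comps n) (comps-unique n) eigenrows
    invertible = unitriangular-invertible (comps n) (comps-unique n) length n
      (λ α α∈ → subst (length α ≤_) (comps-sum n α∈) (length≤sum (comps-positive n α∈)))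
      eigenrows eigenrows-diag eigenrows-upper

    open Invertible invertible

  Φ-eigenbases : Eigenbases Φ (lamC Φ)
  Φ-eigenbases = eigenbases Φ eigenrows inverse (lamC Φ) inverseʳ inverseˡ eigenrows-eigen
    -- The rank hypothesis enters as the bound that no family with more than `nonzeroCount Φ n`
    -- members has independent images.
    (corner≡0 (comps n) (comps-unique n) Φ eigenrows inverse (lamC Φ) inverseʳ inverseˡ eigenrows-eigen (proj₂ rank))

  open Eigenbases Φ-eigenbases

  Φ-diagonalizable : Diagonalizable (comps n) unitV (comps n) (applyΦ Φ n)
  -- The eigenvectors are the columns of `R`, while `diagonalizable` takes coordinates as rows;
  -- hence the transposes.
  Φ-diagonalizable = diagonalizable (comps n) (comps-unique n) {T = applyΦ Φ n} {P = λ γ β → R β γ} {Q = λ γ β → L β γ} (lamC Φ)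
    (λ α β α∈ β∈ → trans (Σ-ext (comps n) (λ γ → ℚₚ.*-comm (R γ α) (L β γ))) (trans (LR β α β∈ α∈) (δ-sym β α)))
    (λ α β α∈ β∈ → trans (Σ-ext (comps n) (λ γ → ℚₚ.*-comm (L γ α) (R β γ))) (trans (RL β α β∈ α∈) (δ-sym β α)))
    (λ a a≈0 γ γ∈ → trans (sym (lin-unitV a γ γ∈)) (a≈0 γ γ∈))
    (λ γ γ∈ x x∈ → begin
      applyΦ Φ n (lin (comps n) (λ β → R β γ) unitV) x
        ≡⟨ apply-lin-unitV (comps n) (comps-unique n) Φ (λ β → R β γ) x ⟩
      (Φ ⊗ R) x γ
        ≡⟨ AR x γ x∈ γ∈ ⟩
      R x γ * lamC Φ γ
        ≡⟨ trans (ℚₚ.*-comm (R x γ) (lamC Φ γ)) (cong (lamC Φ γ *_) (sym (lin-unitV (λ β → R β γ) x x∈))) ⟩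
      lamC Φ γ * lin (comps n) (λ β → R β γ) unitV x ∎)
    where
    lin-unitV : ∀ a x → x ∈ comps n → lin (comps n) a unitV x ≡ a x
    lin-unitV a x x∈ = trans (lin-∑ (comps n) a unitV x)
      (trans (Σ-ext (comps n) (λ γ → cong (a γ *_) (δ-sym x γ))) (Σ-δʳ a (comps-unique n) x∈))

-- Shuffles and quasi-shuffles

-- Stated as the negated descent test, so that it reduces together with the test in `desFrom`.
_≤?ᵇ_ : ℕ → ℕ → Bool
x ≤?ᵇ y = not (y <ᵇ x)

≤?ᵇ-true : ∀ {x y} → x ≤ y → (x ≤?ᵇ y) ≡ true
≤?ᵇ-true {x} {y} le with y <ᵇ x in e
... | false = refl
... | true  = contradiction (ℕₚ.<ᵇ⇒< y x (≡⇒T e)) (ℕₚ.≤⇒≯ le)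

≤?ᵇ-false : ∀ {x y} → y < x → (x ≤?ᵇ y) ≡ false
≤?ᵇ-false lt = cong not (T⇒≡ (ℕₚ.<⇒<ᵇ lt))

≤?ᵇ⇒≤ : ∀ {x y} → (x ≤?ᵇ y) ≡ true → x ≤ y
≤?ᵇ⇒≤ {x} {y} e = ℕₚ.≮⇒≥ (λ lt → case trans (sym e) (≤?ᵇ-false lt) of λ ())

∑-if : ∀ {A : Set} b (xs : List A) f → ∑ (if b then xs else []) f ≡ ind b * ∑ xs f
∑-if true  xs f = sym (ℚₚ.*-identityˡ (∑ xs f))
∑-if false xs f = trans (∑-[] f) (sym (ℚₚ.*-zeroˡ (∑ xs f)))

-- runs x u lists the ways to split off from u a prefix (recorded by its length) which, placed
-- after the letter x, is weakly increasing; cuts w lists the α with D(w) ≤ α.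
runs : ℕ → List ℕ → List (ℕ × List ℕ)
runs x []      = (0 , []) ∷ []
runs x (a ∷ u) = (0 , a ∷ u) ∷ (if x ≤?ᵇ a then map (λ (i , v) → suc i , v) (runs a u) else [])

cuts : List ℕ → List (List ℕ)
cuts []          = [] ∷ []
cuts (x ∷ [])    = (1 ∷ []) ∷ []
cuts (x ∷ y ∷ w) = map (1 ∷_) (cuts (y ∷ w)) ++ (if x ≤?ᵇ y then map incFirst (cuts (y ∷ w)) else [])

∑runs : ℕ → List ℕ → (ℕ → List ℕ → ℚ) → ℚ
∑runs x u G = ∑ (runs x u) (λ (i , v) → G i v)

∑runs-[] : ∀ x G → ∑runs x [] G ≡ G 0 []
∑runs-[] x G = ∑-[x] (0 , []) _

∑runs-∷ : ∀ x a u G → ∑runs x (a ∷ u) G ≡ G 0 (a ∷ u) + ind (x ≤?ᵇ a) * ∑runs a u (λ i → G (suc i))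
∑runs-∷ x a u G = trans (∑-∷ (0 , a ∷ u) _ _) (cong (G 0 (a ∷ u) +_)
  (trans (∑-if (x ≤?ᵇ a) _ _) (cong (ind (x ≤?ᵇ a) *_) (Σ-map _ (runs a u) _))))

-- The letter 0 lies weakly below every letter, so a run placed after it is unconstrained at its
-- first letter; this models the beginning of a word.
∑runs-0∷ : ∀ a u G → ∑runs 0 (a ∷ u) G ≡ G 0 (a ∷ u) + ∑runs a u (λ i → G (suc i))
∑runs-0∷ a u G = trans (∑runs-∷ 0 a u G) (cong (G 0 (a ∷ u) +_) (ℚₚ.*-identityˡ (∑runs a u (λ i → G (suc i)))))

runs-suffix : ∀ x u i v → (i , v) ∈ runs x u → ∃ λ p → u ≡ p ++ v
runs-suffix x []      i v (here refl) = [] , refl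
runs-suffix x (a ∷ u) i v (here refl) = [] , refl
runs-suffix x (a ∷ u) i v (there m) with x ≤?ᵇ a
... | true with ∈ₚ.∈-map⁻ (λ (i , v) → suc i , v) m
...   | (j , v') , m' , refl with runs-suffix a u j v' m'
...     | p , refl = a ∷ p , refl

-- The first part of a composition α with D(w) ≤ α covers a weakly increasing prefix. Nothing is
-- required at the cut behind it, so the remaining parts form an arbitrary member of `cuts` of the
-- suffix.
∑-cuts : ∀ x w ζ → ∑ (cuts (x ∷ w)) ζ ≡ ∑runs x w (λ i v → ∑ (cuts v) (λ β → ζ (suc i ∷ β)))
∑-cuts x []      ζ = trans (∑-[x] (1 ∷ []) ζ) (sym (trans (∑runs-[] x (λ i v → ∑ (cuts v) (λ β → ζ (suc i ∷ β)))) (∑-[x] [] _)))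
∑-cuts x (y ∷ w) ζ = begin
  ∑ (map (1 ∷_) (cuts (y ∷ w)) ++ (if x ≤?ᵇ y then map incFirst (cuts (y ∷ w)) else [])) ζ
    ≡⟨ trans (Σ-++ (map (1 ∷_) (cuts (y ∷ w))) _ ζ) (cong₂ _+_ (Σ-map (1 ∷_) (cuts (y ∷ w)) ζ)
         (trans (∑-if (x ≤?ᵇ y) _ ζ) (cong (ind (x ≤?ᵇ y) *_) (Σ-map incFirst (cuts (y ∷ w)) ζ)))) ⟩
  ∑ (cuts (y ∷ w)) (λ β → ζ (1 ∷ β)) + ind (x ≤?ᵇ y) * ∑ (cuts (y ∷ w)) (λ β → ζ (incFirst β))
    ≡⟨ cong (λ s → ∑ (cuts (y ∷ w)) (λ β → ζ (1 ∷ β)) + ind (x ≤?ᵇ y) * s) (∑-cuts y w (ζ ∘ incFirst)) ⟩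
  ∑ (cuts (y ∷ w)) (λ β → ζ (1 ∷ β)) + ind (x ≤?ᵇ y) * ∑runs y w (λ i v → ∑ (cuts v) (λ β → ζ (suc (suc i) ∷ β)))
    ≡⟨ sym (∑runs-∷ x y w (λ i v → ∑ (cuts v) (λ β → ζ (suc i ∷ β)))) ⟩
  ∑runs x (y ∷ w) (λ i v → ∑ (cuts v) (λ β → ζ (suc i ∷ β))) ∎

shuffle : List ℕ → List ℕ → List (List ℕ)
shuffle []      v       = v ∷ []
shuffle (a ∷ u) []      = (a ∷ u) ∷ []
shuffle (a ∷ u) (b ∷ v) = map (a ∷_) (shuffle u (b ∷ v)) ++ map (b ∷_) (shuffle (a ∷ u) v)

shuffle-[]ʳ : ∀ u → shuffle u [] ≡ u ∷ []
shuffle-[]ʳ []      = refl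
shuffle-[]ʳ (_ ∷ _) = refl

∑-shuffle : ∀ a u b v f → ∑ (shuffle (a ∷ u) (b ∷ v)) f ≡
  ∑ (shuffle u (b ∷ v)) (λ w → f (a ∷ w)) + ∑ (shuffle (a ∷ u) v) (λ w → f (b ∷ w))
∑-shuffle a u b v f = trans (Σ-++ (map (a ∷_) (shuffle u (b ∷ v))) _ f)
  (cong₂ _+_ (Σ-map (a ∷_) (shuffle u (b ∷ v)) f) (Σ-map (b ∷_) (shuffle (a ∷ u) v) f))

Apart : List ℕ → List ℕ → Set
Apart u v = ∀ {a} → a ∈ u → a ∉ v

-- Two disjoint weakly increasing words have exactly one weakly increasing shuffle.
∑-shuffle-runs : ∀ x u v → Apart u v → ∀ G →
  ∑ (shuffle u v) (λ w → ∑runs x w G) ≡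
  ∑runs x u (λ i u' → ∑runs x v (λ j v' → ∑ (shuffle u' v') (G (i ℕ.+ j))))
∑-shuffle-runs x [] v _ G = begin
  ∑ (v ∷ []) (λ w → ∑runs x w G)                          ≡⟨ ∑-[x] v _ ⟩
  ∑runs x v G                                             ≡⟨ Σ-ext (runs x v) (λ (j , v') → sym (∑-[x] v' (G j))) ⟩
  ∑runs x v (λ j v' → ∑ (shuffle [] v') (G j))            ≡⟨ sym (∑runs-[] x (λ i u' → ∑runs x v (λ j v' → ∑ (shuffle u' v') (G (i ℕ.+ j))))) ⟩
  ∑runs x [] (λ i u' → ∑runs x v (λ j v' → ∑ (shuffle u' v') (G (i ℕ.+ j)))) ∎
∑-shuffle-runs x (a ∷ u) [] _ G = begin
  ∑ ((a ∷ u) ∷ []) (λ w → ∑runs x w G)                    ≡⟨ ∑-[x] (a ∷ u) _ ⟩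
  ∑runs x (a ∷ u) G                                       ≡⟨ Σ-ext (runs x (a ∷ u)) (λ (i , u') → sym (trans (∑runs-[] x (λ j v' → ∑ (shuffle u' v') (G (i ℕ.+ j))))
                                                               (trans (cong₂ (λ s k → ∑ s (G k)) (shuffle-[]ʳ u') (ℕₚ.+-identityʳ i)) (∑-[x] u' (G i))))) ⟩
  ∑runs x (a ∷ u) (λ i u' → ∑runs x [] (λ j v' → ∑ (shuffle u' v') (G (i ℕ.+ j)))) ∎
∑-shuffle-runs x (a ∷ u) (b ∷ v) apart G = begin
  ∑ (shuffle (a ∷ u) (b ∷ v)) (λ w → ∑runs x w G)
    ≡⟨ ∑-shuffle a u b v _ ⟩
  ∑ (shuffle u (b ∷ v)) (λ w → ∑runs x (a ∷ w) G) + ∑ (shuffle (a ∷ u) v) (λ w → ∑runs x (b ∷ w) G)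
    ≡⟨ cong₂ _+_ (peel a (shuffle u (b ∷ v))) (peel b (shuffle (a ∷ u) v)) ⟩
  (U + xa * ∑ (shuffle u (b ∷ v)) (λ w → ∑runs a w G⁺)) + (V + xb * ∑ (shuffle (a ∷ u) v) (λ w → ∑runs b w G⁺))
    ≡⟨ cong₂ (λ s t → (U + xa * s) + (V + xb * t))
         (∑-shuffle-runs a u (b ∷ v) (λ p → apart (there p)) G⁺)
         (∑-shuffle-runs b (a ∷ u) v (λ p q → apart p (there q)) G⁺) ⟩
  (U + xa * ∑runs a u (λ i u' → ∑runs a (b ∷ v) (W i u'))) + (V + xb * ∑runs b (a ∷ u) (λ i u' → ∑runs b v (W i u')))
    ≡⟨ compare (ℕₚ.<-cmp a b) ⟩
  ((U + V) + xb * ∑runs b v (λ j v' → ∑ (shuffle (a ∷ u) v') (G (suc j)))) + xa * ∑runs a u (λ i u' → ∑runs x (b ∷ v) (W i u'))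
    ≡⟨ cong (_+ xa * ∑runs a u (λ i u' → ∑runs x (b ∷ v) (W i u'))) (begin
         (U + V) + xb * ∑runs b v (λ j v' → ∑ (shuffle (a ∷ u) v') (G (suc j)))
           ≡⟨ cong (_+ xb * ∑runs b v (λ j v' → ∑ (shuffle (a ∷ u) v') (G (suc j)))) (sym (∑-shuffle a u b v (G 0))) ⟩
         ∑ (shuffle (a ∷ u) (b ∷ v)) (G 0) + xb * ∑runs b v (λ j v' → ∑ (shuffle (a ∷ u) v') (G (suc j)))
           ≡⟨ sym (∑runs-∷ x b v (λ j v' → ∑ (shuffle (a ∷ u) v') (G j))) ⟩
         ∑runs x (b ∷ v) (λ j v' → ∑ (shuffle (a ∷ u) v') (G j)) ∎) ⟩
  ∑runs x (b ∷ v) (λ j v' → ∑ (shuffle (a ∷ u) v') (G j)) + xa * ∑runs a u (λ i u' → ∑runs x (b ∷ v) (W i u'))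
    ≡⟨ sym (∑runs-∷ x a u (λ i u' → ∑runs x (b ∷ v) (λ j v' → ∑ (shuffle u' v') (G (i ℕ.+ j))))) ⟩
  ∑runs x (a ∷ u) (λ i u' → ∑runs x (b ∷ v) (λ j v' → ∑ (shuffle u' v') (G (i ℕ.+ j)))) ∎
  where
  G⁺ : ℕ → List ℕ → ℚ
  G⁺ i = G (suc i)
  W : ℕ → List ℕ → ℕ → List ℕ → ℚ
  W i u' j v' = ∑ (shuffle u' v') (G (suc (i ℕ.+ j)))
  xa = ind (x ≤?ᵇ a)
  xb = ind (x ≤?ᵇ b)
  U = ∑ (shuffle u (b ∷ v)) (λ w → G 0 (a ∷ w))
  V = ∑ (shuffle (a ∷ u) v) (λ w → G 0 (b ∷ w))
  peel : ∀ c ws → ∑ ws (λ w → ∑runs x (c ∷ w) G) ≡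
    ∑ ws (λ w → G 0 (c ∷ w)) + ind (x ≤?ᵇ c) * ∑ ws (λ w → ∑runs c w G⁺)
  peel c ws = trans (Σ-ext ws (λ w → ∑runs-∷ x c w G)) (trans (Σ-+ ws _ _)
    (cong (∑ ws (λ w → G 0 (c ∷ w)) +_) (Σ-*ˡ ws (ind (x ≤?ᵇ c)) _)))
  V⁺ = ∑runs b v (λ j v' → ∑ (shuffle (a ∷ u) v') (G (suc j)))
  open import Relation.Binary.Definitions using (Tri; tri<; tri≈; tri>)
  -- A run can take in both first letters only with the smaller one first, so the order of `a` and
  -- `b` decides which of the two expansions continues past the other letter. Equality is excluded
  -- by disjointness.
  compare : Tri (a < b) (a ≡ b) (b < a) →
    (U + xa * ∑runs a u (λ i u' → ∑runs a (b ∷ v) (W i u'))) + (V + xb * ∑runs b (a ∷ u) (λ i u' → ∑runs b v (W i u')))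
    ≡ ((U + V) + xb * V⁺) + xa * ∑runs a u (λ i u' → ∑runs x (b ∷ v) (W i u'))
  compare (tri≈ _ refl _) = contradiction (here refl) (apart (here refl))
  compare (tri< a<b _ _) = begin
    (U + xa * ∑runs a u (λ i u' → ∑runs a (b ∷ v) (W i u'))) + (V + xb * ∑runs b (a ∷ u) (λ i u' → ∑runs b v (W i u')))
      ≡⟨ cong₂ (λ s t → (U + s) + (V + xb * t)) first second ⟩
    (U + xa * ∑runs a u (λ i u' → ∑runs x (b ∷ v) (W i u'))) + (V + xb * V⁺)
      ≡⟨ solve 4 (λ u v s t → (u :+ s) :+ (v :+ t) := ((u :+ v) :+ t) :+ s) refl U V (xa * ∑runs a u (λ i u' → ∑runs x (b ∷ v) (W i u'))) (xb * V⁺) ⟩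
    ((U + V) + xb * V⁺) + xa * ∑runs a u (λ i u' → ∑runs x (b ∷ v) (W i u')) ∎
    where
    -- If x ≤ a < b, the letter `b` may follow `x` as well as `a`, so the two thresholds can be
    -- exchanged.
    first : xa * ∑runs a u (λ i u' → ∑runs a (b ∷ v) (W i u')) ≡ xa * ∑runs a u (λ i u' → ∑runs x (b ∷ v) (W i u'))
    first = ind-cong* (x ≤?ᵇ a) (λ e → Σ-ext (runs a u) (λ (i , u') →
      trans (∑runs-∷ a b v (W i u')) (trans
        (cong (λ t → W i u' 0 (b ∷ v) + ind t * ∑runs b v (λ j → W i u' (suc j)))
          (trans (≤?ᵇ-true (ℕₚ.<⇒≤ a<b)) (sym (≤?ᵇ-true (ℕₚ.≤-trans (≤?ᵇ⇒≤ {x} {a} e) (ℕₚ.<⇒≤ a<b))))))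
        (sym (∑runs-∷ x b v (W i u'))))))
    second : ∑runs b (a ∷ u) (λ i u' → ∑runs b v (W i u')) ≡ V⁺
    second = trans (∑runs-∷ b a u (λ i u' → ∑runs b v (W i u')))
      (trans (cong (V⁺ +_) (ind-false* (∑runs a u (λ i u' → ∑runs b v (W (suc i) u'))) (≤?ᵇ-false a<b))) (ℚₚ.+-identityʳ V⁺))
  compare (tri> _ _ b<a) = begin
    (U + xa * ∑runs a u (λ i u' → ∑runs a (b ∷ v) (W i u'))) + (V + xb * ∑runs b (a ∷ u) (λ i u' → ∑runs b v (W i u')))
      ≡⟨ cong₂ (λ s t → (U + xa * s) + (V + xb * t)) first second ⟩
    (U + xa * P) + (V + xb * (V⁺ + Q))
      ≡⟨ solve 7 (λ u v y t p q z → (u :+ z :* p) :+ (v :+ y :* (t :+ q)) := ((u :+ v) :+ y :* t) :+ (z :* p :+ y :* q)) refl U V xb V⁺ P Q xa ⟩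
    ((U + V) + xb * V⁺) + (xa * P + xb * Q)
      ≡⟨ cong (((U + V) + xb * V⁺) +_) third ⟩
    ((U + V) + xb * V⁺) + xa * ∑runs a u (λ i u' → ∑runs x (b ∷ v) (W i u')) ∎
    where
    P = ∑runs a u (λ i u' → W i u' 0 (b ∷ v))
    Q = ∑runs a u (λ i u' → ∑runs b v (λ j → W i u' (suc j)))
    first : ∑runs a u (λ i u' → ∑runs a (b ∷ v) (W i u')) ≡ P
    first = Σ-ext (runs a u) (λ (i , u') → trans (∑runs-∷ a b v (W i u'))
      (trans (cong (W i u' 0 (b ∷ v) +_) (ind-false* (∑runs b v (λ j → W i u' (suc j))) (≤?ᵇ-false b<a))) (ℚₚ.+-identityʳ (W i u' 0 (b ∷ v)))))
    second : ∑runs b (a ∷ u) (λ i u' → ∑runs b v (W i u')) ≡ V⁺ + Q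
    second = trans (∑runs-∷ b a u (λ i u' → ∑runs b v (W i u'))) (cong (V⁺ +_)
      (trans (ind-true* (∑runs a u (λ i u' → ∑runs b v (W (suc i) u'))) (≤?ᵇ-true (ℕₚ.<⇒≤ b<a)))
        (Σ-ext (runs a u) (λ (i , u') → Σ-ext (runs b v) (λ (j , v') → cong (λ k → ∑ (shuffle u' v') (G (suc k))) (sym (ℕₚ.+-suc i j)))))))
    expand : ∑runs a u (λ i u' → ∑runs x (b ∷ v) (W i u')) ≡ P + xb * Q
    expand = trans (Σ-ext (runs a u) (λ (i , u') → ∑runs-∷ x b v (W i u')))
      (trans (Σ-+ (runs a u) _ _) (cong (P +_) (Σ-*ˡ (runs a u) xb _)))
    third : xa * P + xb * Q ≡ xa * ∑runs a u (λ i u' → ∑runs x (b ∷ v) (W i u'))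
    third = trans (trans (cong (xa * P +_) xab) (sym (ℚₚ.*-distribˡ-+ xa P (xb * Q)))) (cong (xa *_) (sym expand))
      where
      -- x ≤ b < a forces x ≤ a, so the factor `xa` can be inserted.
      xab : xb * Q ≡ xa * (xb * Q)
      xab with x ≤?ᵇ b in e
      ... | false = solve 2 (λ a q → con 0ℚ :* q := a :* (con 0ℚ :* q)) refl xa Q
      ... | true  = sym (ind-true* (1ℚ * Q) (≤?ᵇ-true (ℕₚ.≤-trans (≤?ᵇ⇒≤ {x} {b} e) (ℕₚ.<⇒≤ b<a))))

∑-qsh : ∀ x a y b ζ → ∑ (qsh (x ∷ a) (y ∷ b)) ζ ≡
  ∑ (qsh a (y ∷ b)) (λ δ → ζ (x ∷ δ)) + (∑ (qsh (x ∷ a) b) (λ δ → ζ (y ∷ δ)) + ∑ (qsh a b) (λ δ → ζ (x ℕ.+ y ∷ δ)))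
∑-qsh x a y b ζ = trans (Σ-++ (map (x ∷_) (qsh a (y ∷ b))) _ ζ) (cong₂ _+_ (Σ-map (x ∷_) (qsh a (y ∷ b)) ζ)
  (trans (Σ-++ (map (y ∷_) (qsh (x ∷ a) b)) _ ζ) (cong₂ _+_ (Σ-map (y ∷_) (qsh (x ∷ a) b) ζ) (Σ-map (x ℕ.+ y ∷_) (qsh a b) ζ))))

qsh-[]ʳ : ∀ β → qsh β [] ≡ β ∷ []
qsh-[]ʳ []      = refl
qsh-[]ʳ (_ ∷ _) = refl

-- The product rule F_{D(u)} F_{D(v)} = Σ F_{D(w)} over the shuffles w of u and v, written with
-- an arbitrary linear form ζ on 𝒬 and proved by splitting off the first parts of both sides.
∑-shuffle-cuts : ∀ k u v → length u ℕ.+ length v ≤ k → Apart u v → ∀ ζ →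
  ∑ (shuffle u v) (λ w → ∑ (cuts w) ζ) ≡ ∑ (cuts u) (λ β → ∑ (cuts v) (λ γ → ∑ (qsh β γ) ζ))
∑-shuffle-cuts k [] v _ _ ζ = trans (∑-[x] v _) (sym (trans (∑-[x] [] _) (Σ-ext (cuts v) (λ γ → ∑-[x] γ ζ))))
∑-shuffle-cuts k (a ∷ u) [] _ _ ζ = trans (∑-[x] (a ∷ u) _) (sym (Σ-ext (cuts (a ∷ u)) (λ β →
  trans (∑-[x] [] _) (trans (cong (λ l → ∑ l ζ) (qsh-[]ʳ β)) (∑-[x] β ζ)))))
∑-shuffle-cuts (suc k) (a ∷ u) (b ∷ v) (s≤s len) apart ζ = begin
  ∑ (shuffle (a ∷ u) (b ∷ v)) (λ w → ∑ (cuts w) ζ)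
    ≡⟨ trans (∑-shuffle a u b v _) (trans (cong₂ _+_ (Σ-ext (shuffle u (b ∷ v)) (λ w → H-cuts a w)) (Σ-ext (shuffle (a ∷ u) v) (λ w → H-cuts b w)))
         (sym (∑-shuffle a u b v _))) ⟩
  ∑ (shuffle (a ∷ u) (b ∷ v)) (λ w → ∑runs 0 w H)
    ≡⟨ ∑-shuffle-runs 0 (a ∷ u) (b ∷ v) apart H ⟩
  ∑runs 0 (a ∷ u) (λ i u' → ∑runs 0 (b ∷ v) (λ j v' → ∑ (shuffle u' v') (H (i ℕ.+ j))))
    ≡⟨ ∑runs-0∷ a u _ ⟩
  ∑runs 0 (b ∷ v) (λ j v' → ∑ (shuffle (a ∷ u) v') (H j)) + ∑runs a u (λ i u' → ∑runs 0 (b ∷ v) (λ j v' → ∑ (shuffle u' v') (H (suc i ℕ.+ j))))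
    ≡⟨ cong₂ _+_ (trans (∑runs-0∷ b v _) (cong (_+ ∑runs b v (λ j v' → ∑ (shuffle (a ∷ u) v') (H (suc j)))) (Σ-0 (shuffle (a ∷ u) (b ∷ v)) (λ _ _ → refl))))
         (trans (Σ-ext (runs a u) (λ (i , u') → trans (∑runs-0∷ b v (λ j v' → ∑ (shuffle u' v') (H (suc i ℕ.+ j))))
             (cong (λ m → ∑ (shuffle u' (b ∷ v)) (H (suc m)) + ∑runs b v (λ j v' → ∑ (shuffle u' v') (H (suc i ℕ.+ suc j)))) (ℕₚ.+-identityʳ i))))
           (Σ-+ (runs a u) _ _)) ⟩
  (0ℚ + ∑runs b v (λ j v' → ∑ (shuffle (a ∷ u) v') (H (suc j))))
    + (∑runs a u (λ i u' → ∑ (shuffle u' (b ∷ v)) (H (suc i))) + ∑runs a u (λ i u' → ∑runs b v (λ j v' → ∑ (shuffle u' v') (H (suc i ℕ.+ suc j)))))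
    ≡⟨ cong₂ _+_ (trans (ℚₚ.+-identityˡ _) ih-v) (cong₂ _+_ ih-u ih-uv) ⟩
  T₂ + (T₁ + T₃)
    ≡⟨ solve 3 (λ s t r → s :+ (t :+ r) := t :+ (s :+ r)) refl T₂ T₁ T₃ ⟩
  T₁ + (T₂ + T₃)
    ≡⟨ sym expand ⟩
  ∑ (cuts (a ∷ u)) (λ β → ∑ (cuts (b ∷ v)) (λ γ → ∑ (qsh β γ) ζ)) ∎
  where
  -- A composition of a nonempty word has a positive first part. Weight 0 for the empty run allows
  -- it into the sum, as `∑-shuffle-runs` requires.
  H : ℕ → List ℕ → ℚ
  H zero    w = 0ℚ
  H (suc i) w = ∑ (cuts w) (λ β → ζ (suc i ∷ β))
  H-cuts : ∀ c w → ∑ (cuts (c ∷ w)) ζ ≡ ∑runs 0 (c ∷ w) H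
  H-cuts c w = trans (∑-cuts c w ζ) (sym (trans (∑runs-0∷ c w H) (ℚₚ.+-identityˡ _)))
  suffix-length : ∀ {x u i u'} → (i , u') ∈ runs x u → length u' ≤ length u
  suffix-length {x} {u} {i} {u'} m with runs-suffix x u i u' m
  ... | p , refl = subst (length u' ≤_) (sym (Listₚ.length-++ p)) (ℕₚ.m≤n+m (length u') (length p))
  suffix-⊆ : ∀ {x u i u' c} → (i , u') ∈ runs x u → c ∈ u' → c ∈ u
  suffix-⊆ {x} {u} {i} {u'} m c∈ with runs-suffix x u i u' m
  ... | p , refl = ∈ₚ.∈-++⁺ʳ p c∈
  -- The three ways in which a quasi-shuffle starts: with the first part of the left factor, with
  -- that of the right factor, or with their sum. They match runs that take letters from the first
  -- word only, from the second only, or from both.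
  T₁ T₂ T₃ : ℚ
  T₁ = ∑runs a u (λ i u' → ∑ (cuts u') (λ β → ∑runs b v (λ j v' → ∑ (cuts v') (λ γ → ∑ (qsh β (suc j ∷ γ)) (λ δ → ζ (suc i ∷ δ))))))
  T₂ = ∑runs a u (λ i u' → ∑ (cuts u') (λ β → ∑runs b v (λ j v' → ∑ (cuts v') (λ γ → ∑ (qsh (suc i ∷ β) γ) (λ δ → ζ (suc j ∷ δ))))))
  T₃ = ∑runs a u (λ i u' → ∑ (cuts u') (λ β → ∑runs b v (λ j v' → ∑ (cuts v') (λ γ → ∑ (qsh β γ) (λ δ → ζ (suc i ℕ.+ suc j ∷ δ))))))
  expand : ∑ (cuts (a ∷ u)) (λ β → ∑ (cuts (b ∷ v)) (λ γ → ∑ (qsh β γ) ζ)) ≡ T₁ + (T₂ + T₃)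
  expand = begin
    ∑ (cuts (a ∷ u)) (λ β → ∑ (cuts (b ∷ v)) (λ γ → ∑ (qsh β γ) ζ))
      ≡⟨ ∑-cuts a u _ ⟩
    ∑runs a u (λ i u' → ∑ (cuts u') (λ β → ∑ (cuts (b ∷ v)) (λ γ → ∑ (qsh (suc i ∷ β) γ) ζ)))
      ≡⟨ Σ-ext (runs a u) (λ (i , u') → Σ-ext (cuts u') (λ β → trans (∑-cuts b v _)
           (trans (Σ-ext (runs b v) (λ (j , v') → trans (Σ-ext (cuts v') (λ γ → ∑-qsh (suc i) β (suc j) γ ζ)) (split3 (cuts v') _ _ _))) (split3 (runs b v) _ _ _)))) ⟩
    _ ≡⟨ trans (Σ-ext (runs a u) (λ (i , u') → split3 (cuts u') _ _ _)) (split3 (runs a u) _ _ _) ⟩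
    T₁ + (T₂ + T₃) ∎
    where
    split3 : ∀ {A : Set} (xs : List A) f g h → ∑ xs (λ x → f x + (g x + h x)) ≡ ∑ xs f + (∑ xs g + ∑ xs h)
    split3 xs f g h = trans (Σ-+ xs f _) (cong (∑ xs f +_) (Σ-+ xs g h))
  -- Induction is applied to the form that prepends `suc i` before evaluating `ζ`, hence the
  -- generality in `ζ`. Runs may have any length, hence the bound `k` on the total length.
  ih-u : ∑runs a u (λ i u' → ∑ (shuffle u' (b ∷ v)) (H (suc i))) ≡ T₁
  ih-u = Σ-cong (runs a u) (λ (i , u') m → trans
    (∑-shuffle-cuts k u' (b ∷ v) (ℕₚ.≤-trans (ℕₚ.+-monoˡ-≤ (suc (length v)) (suffix-length m)) len)
      (λ p q → apart (there (suffix-⊆ m p)) q) (λ δ → ζ (suc i ∷ δ)))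
    (Σ-ext (cuts u') (λ β → ∑-cuts b v _)))
  ih-v : ∑runs b v (λ j v' → ∑ (shuffle (a ∷ u) v') (H (suc j))) ≡ T₂
  ih-v = begin
    ∑runs b v (λ j v' → ∑ (shuffle (a ∷ u) v') (H (suc j)))
      ≡⟨ Σ-cong (runs b v) (λ (j , v') m → ∑-shuffle-cuts k (a ∷ u) v'
           (ℕₚ.≤-trans (ℕₚ.≤-reflexive (sym (ℕₚ.+-suc (length u) (length v')))) (ℕₚ.≤-trans (ℕₚ.+-monoʳ-≤ (length u) (s≤s (suffix-length m))) len))
           (λ p q → apart p (there (suffix-⊆ m q))) (λ δ → ζ (suc j ∷ δ))) ⟩
    ∑runs b v (λ j v' → ∑ (cuts (a ∷ u)) (λ β → ∑ (cuts v') (λ γ → ∑ (qsh β γ) (λ δ → ζ (suc j ∷ δ)))))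
      ≡⟨ Σ-swap (runs b v) (cuts (a ∷ u)) _ ⟩
    ∑ (cuts (a ∷ u)) (λ β → ∑runs b v (λ j v' → ∑ (cuts v') (λ γ → ∑ (qsh β γ) (λ δ → ζ (suc j ∷ δ)))))
      ≡⟨ ∑-cuts a u _ ⟩
    T₂ ∎
  ih-uv : ∑runs a u (λ i u' → ∑runs b v (λ j v' → ∑ (shuffle u' v') (H (suc i ℕ.+ suc j)))) ≡ T₃
  ih-uv = Σ-cong (runs a u) (λ (i , u') m → trans
    (Σ-cong (runs b v) (λ (j , v') m' → ∑-shuffle-cuts k u' v'
      (ℕₚ.≤-trans (ℕₚ.+-mono-≤ (suffix-length m) (ℕₚ.≤-trans (suffix-length m') (ℕₚ.n≤1+n (length v)))) len)
      (λ p q → apart (there (suffix-⊆ m p)) (there (suffix-⊆ m' q))) (λ δ → ζ (suc i ℕ.+ suc j ∷ δ))))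
    (Σ-swap (runs b v) (cuts u') _))

-- The relation D(w) ≤ α tested along the word.

fits : List ℕ → List ℕ → Bool
fits []                w           = true
fits (zero ∷ α)        w           = false
fits (suc a ∷ α)       []          = false
fits (suc zero ∷ α)    (x ∷ w)     = fits α w
fits (suc (suc a) ∷ α) (x ∷ [])    = false
fits (suc (suc a) ∷ α) (x ∷ y ∷ w) = (x ≤?ᵇ y) ∧ fits (suc a ∷ α) (y ∷ w)

≡ᵇ-≢ : ∀ {m n} → m ≢ n → (m ≡ᵇ n) ≡ false
≡ᵇ-≢ {m} {n} h = ≢true (h ∘ ≡ᵇ⇒≡ m n)

partialFrom-> : ∀ s α → Positive α → All (s <_) (partialFrom s α)
partialFrom-> s []          _        = []
partialFrom-> s (a ∷ [])    _        = []
partialFrom-> s (a ∷ b ∷ α) (p ∷ ps) =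
  ℕₚ.m<m+n s p ∷ All.map (ℕₚ.≤-<-trans (ℕₚ.m≤m+n s a)) (partialFrom-> (s ℕ.+ a) (b ∷ α) ps)

desFrom-≥ : ∀ s w → All (s ≤_) (desFrom s w)
desFrom-≥ s []          = []
desFrom-≥ s (x ∷ [])    = []
desFrom-≥ s (x ∷ y ∷ w) = Allₚ.++⁺ (first (y <ᵇ x)) (All.map (ℕₚ.≤-trans (ℕₚ.n≤1+n s)) (desFrom-≥ (suc s) (y ∷ w)))
  where
  first : ∀ b → All (s ≤_) (if b then s ∷ [] else [])
  first true  = ℕₚ.≤-refl ∷ []
  first false = []

memB-> : ∀ s ys → All (s <_) ys → memB s ys ≡ false
memB-> s []       _        = refl
memB-> s (y ∷ ys) (p ∷ ps) rewrite ≡ᵇ-≢ (ℕₚ.<⇒≢ p) = memB-> s ys ps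

subsetB-∷ : ∀ k xs ys → All (k <_) xs → subsetB xs (k ∷ ys) ≡ subsetB xs ys
subsetB-∷ k []       ys _        = refl
subsetB-∷ k (x ∷ xs) ys (p ∷ ps) rewrite ≡ᵇ-≢ (ℕₚ.>⇒≢ p) = cong (memB x ys ∧_) (subsetB-∷ k xs ys ps)

partialFrom-suc : ∀ s a α → partialFrom s (suc a ∷ α) ≡ partialFrom (suc s) (a ∷ α)
partialFrom-suc s a []      = refl
partialFrom-suc s a (b ∷ α) rewrite ℕₚ.+-suc s a = refl

-- Inclusion of sets of positions becomes a test on consecutive letters, suited to induction along
-- the word. Position `suc s` is a partial sum exactly when the current block ends there with
-- letters still to follow; then a descent is allowed, while inside a block it refutes the
-- inclusion. `s` counts the letters already read.
subsetB-fits : ∀ s α w → Positive α → sum α ≡ length w → subsetB (desFrom (suc s) w) (partialFrom s α) ≡ fits α w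
subsetB-fits s []                    []          _ _ = refl
subsetB-fits s (zero ∷ α)            w           (() ∷ _) _
subsetB-fits s (suc a ∷ α)           []          _ ()
subsetB-fits s (suc zero ∷ [])       (x ∷ [])    _ _ = refl
subsetB-fits s (suc zero ∷ suc b ∷ α) (x ∷ [])   _ ()
subsetB-fits s (suc zero ∷ zero ∷ α) (x ∷ [])    (_ ∷ () ∷ _) _
subsetB-fits s (suc zero ∷ [])       (x ∷ y ∷ w) _ ()
subsetB-fits s (suc zero ∷ b ∷ α)    (x ∷ y ∷ w) (_ ∷ ps) e = begin
  subsetB ((if y <ᵇ x then suc s ∷ [] else []) ++ D) (s ℕ.+ 1 ∷ partialFrom (s ℕ.+ 1) (b ∷ α))
    ≡⟨ cong (λ k → subsetB ((if y <ᵇ x then suc s ∷ [] else []) ++ D) (k ∷ partialFrom k (b ∷ α))) (ℕₚ.+-comm s 1) ⟩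
  subsetB ((if y <ᵇ x then suc s ∷ [] else []) ++ D) (suc s ∷ P) ≡⟨ drop-allowed (y <ᵇ x) ⟩
  subsetB D (suc s ∷ P)                                          ≡⟨ subsetB-∷ (suc s) D P (desFrom-≥ (suc (suc s)) (y ∷ w)) ⟩
  subsetB D P                                                    ≡⟨ subsetB-fits (suc s) (b ∷ α) (y ∷ w) ps (ℕₚ.suc-injective e) ⟩
  fits (b ∷ α) (y ∷ w) ∎
  where
  D = desFrom (suc (suc s)) (y ∷ w)
  P = partialFrom (suc s) (b ∷ α)
  drop-allowed : ∀ b → subsetB ((if b then suc s ∷ [] else []) ++ D) (suc s ∷ P) ≡ subsetB D (suc s ∷ P)
  drop-allowed false = refl
  drop-allowed true rewrite ≡ᵇ-refl s = refl
subsetB-fits s (suc (suc a) ∷ α)     (x ∷ [])    _ ()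
subsetB-fits s (suc (suc a) ∷ α)     (x ∷ y ∷ w) (_ ∷ ps) e = begin
  subsetB ((if y <ᵇ x then suc s ∷ [] else []) ++ D) (partialFrom s (suc (suc a) ∷ α))
    ≡⟨ cong (subsetB ((if y <ᵇ x then suc s ∷ [] else []) ++ D)) (partialFrom-suc s (suc a) α) ⟩
  subsetB ((if y <ᵇ x then suc s ∷ [] else []) ++ D) P
    ≡⟨ forbidden (y <ᵇ x) ⟩
  (x ≤?ᵇ y) ∧ subsetB D P
    ≡⟨ cong ((x ≤?ᵇ y) ∧_) (subsetB-fits (suc s) (suc a ∷ α) (y ∷ w) (s≤s z≤n ∷ ps) (ℕₚ.suc-injective e)) ⟩
  (x ≤?ᵇ y) ∧ fits (suc a ∷ α) (y ∷ w) ∎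
  where
  D = desFrom (suc (suc s)) (y ∷ w)
  P = partialFrom (suc s) (suc a ∷ α)
  forbidden : ∀ b → subsetB ((if b then suc s ∷ [] else []) ++ D) P ≡ not b ∧ subsetB D P
  forbidden false = refl
  forbidden true  = cong (_∧ subsetB D P) (memB-> (suc s) P (partialFrom-> (suc s) (suc a ∷ α) (s≤s z≤n ∷ ps)))

Xel-fits : ∀ {n α} σ → α ∈ comps n → length σ ≡ n → Xel α σ ≡ ind (fits α σ)
Xel-fits {n} {α} σ α∈ len = cong ind (subsetB-fits 0 α σ (comps-positive n α∈) (trans (comps-sum n α∈) (sym len)))

-- The last letter of `w₁` and the first of `w₂` are never compared, since a block ends between
-- them.
fits-++ : ∀ γ₁ γ₂ w₁ w₂ → Positive γ₁ → sum γ₁ ≡ length w₁ → fits (γ₁ ++ γ₂) (w₁ ++ w₂) ≡ fits γ₁ w₁ ∧ fits γ₂ w₂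
fits-++ []                 γ₂ []          w₂ _        _ = refl
fits-++ (suc zero ∷ γ₁)    γ₂ (x ∷ w)     w₂ (_ ∷ ps) e = fits-++ γ₁ γ₂ w w₂ ps (ℕₚ.suc-injective e)
fits-++ (suc (suc a) ∷ γ₁) γ₂ (x ∷ [])    w₂ _        ()
fits-++ (suc (suc a) ∷ γ₁) γ₂ (x ∷ y ∷ w) w₂ (_ ∷ ps) e = trans
  (cong ((x ≤?ᵇ y) ∧_) (fits-++ (suc a ∷ γ₁) γ₂ (y ∷ w) w₂ (s≤s z≤n ∷ ps) (ℕₚ.suc-injective e)))
  (sym (𝔹ₚ.∧-assoc (x ≤?ᵇ y) (fits (suc a ∷ γ₁) (y ∷ w)) (fits γ₂ w₂)))

∈-if : ∀ {A : Set} b {xs : List A} {z} → z ∈ (if b then xs else []) → z ∈ xs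
∈-if true z∈ = z∈

cuts-⊆-comps : ∀ w α → α ∈ cuts w → α ∈ comps (length w)
cuts-⊆-comps []          _ (here refl) = here refl
cuts-⊆-comps (x ∷ [])    _ (here refl) = here refl
cuts-⊆-comps (x ∷ y ∷ w) = step (cuts-⊆-comps (y ∷ w))
  where
  step : (∀ α → α ∈ cuts (y ∷ w) → α ∈ comps (suc (length w))) →
         ∀ α → α ∈ cuts (x ∷ y ∷ w) → α ∈ comps (suc (suc (length w)))
  step ih α α∈ with ∈ₚ.∈-++⁻ (map (1 ∷_) (cuts (y ∷ w))) α∈
  ... | inj₁ p with ∈ₚ.∈-map⁻ (1 ∷_) p
  ...   | β , β∈ , refl = ∈-concatMap (λ α → (1 ∷ α) ∷ incFirst α ∷ []) (comps (suc (length w))) (ih β β∈) (here refl)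
  step ih α α∈ | inj₂ p with ∈ₚ.∈-map⁻ incFirst (∈-if (x ≤?ᵇ y) p)
  ... | β , β∈ , refl = ∈-concatMap (λ α → (1 ∷ α) ∷ incFirst α ∷ []) (comps (suc (length w))) (ih β β∈) (there (here refl))

-- `cuts` and `comps` grow by the same two moves, and only raising the first part carries a
-- condition, that the new letter not exceed the next one.
∑-cuts-fits : ∀ w ζ → ∑ (cuts w) ζ ≡ ∑ (comps (length w)) (λ α → ζ α * ind (fits α w))
∑-cuts-fits []          ζ = trans (∑-[x] [] ζ) (sym (trans (∑-[x] [] _) (ℚₚ.*-identityʳ (ζ []))))
∑-cuts-fits (x ∷ [])    ζ = trans (∑-[x] (1 ∷ []) ζ) (sym (trans (∑-[x] (1 ∷ []) _) (ℚₚ.*-identityʳ (ζ (1 ∷ [])))))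
∑-cuts-fits (x ∷ y ∷ w) ζ = begin
  ∑ (map (1 ∷_) (cuts (y ∷ w)) ++ (if x ≤?ᵇ y then map incFirst (cuts (y ∷ w)) else [])) ζ
    ≡⟨ trans (Σ-++ (map (1 ∷_) (cuts (y ∷ w))) _ ζ) (cong₂ _+_ (Σ-map (1 ∷_) (cuts (y ∷ w)) ζ)
         (trans (∑-if (x ≤?ᵇ y) _ ζ) (cong (ind (x ≤?ᵇ y) *_) (Σ-map incFirst (cuts (y ∷ w)) ζ)))) ⟩
  ∑ (cuts (y ∷ w)) (λ β → ζ (1 ∷ β)) + ind (x ≤?ᵇ y) * ∑ (cuts (y ∷ w)) (λ β → ζ (incFirst β))
    ≡⟨ cong₂ (λ s t → s + ind (x ≤?ᵇ y) * t) (∑-cuts-fits (y ∷ w) _) (∑-cuts-fits (y ∷ w) _) ⟩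
  ∑ C (λ β → ζ (1 ∷ β) * ind (fits β (y ∷ w))) + ind (x ≤?ᵇ y) * ∑ C (λ β → ζ (incFirst β) * ind (fits β (y ∷ w)))
    ≡⟨ cong (∑ C (λ β → ζ (1 ∷ β) * ind (fits β (y ∷ w))) +_) (trans (sym (Σ-*ˡ C (ind (x ≤?ᵇ y)) _)) (Σ-cong C incTerm)) ⟩
  ∑ C (λ β → ζ (1 ∷ β) * ind (fits β (y ∷ w))) + ∑ C (λ β → ζ (incFirst β) * ind (fits (incFirst β) (x ∷ y ∷ w)))
    ≡⟨ sym (trans (∑-comps (length w) _) (Σ-+ C _ _)) ⟩
  ∑ (comps (suc (suc (length w)))) (λ α → ζ α * ind (fits α (x ∷ y ∷ w))) ∎
  where
  C = comps (suc (length w))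
  incTerm : ∀ β → β ∈ C → ind (x ≤?ᵇ y) * (ζ (incFirst β) * ind (fits β (y ∷ w))) ≡ ζ (incFirst β) * ind (fits (incFirst β) (x ∷ y ∷ w))
  incTerm β β∈ with comps-head (length w) β∈
  ... | b , β' , refl = trans
    (solve 3 (λ i z f → i :* (z :* f) := z :* (i :* f)) refl (ind (x ≤?ᵇ y)) (ζ (suc (suc b) ∷ β')) (ind (fits (suc b ∷ β') (y ∷ w))))
    (cong (ζ (suc (suc b) ∷ β') *_) (sym (ind-∧ (x ≤?ᵇ y) (fits (suc b ∷ β') (y ∷ w)))))

-- Quasi-shuffles and one-part compositions.

qsh-sum : ∀ β γ ε → ε ∈ qsh β γ → sum ε ≡ sum β ℕ.+ sum γ
qsh-sum []      γ       _ (here refl) = refl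
qsh-sum (x ∷ a) []      _ (here refl) = sym (ℕₚ.+-identityʳ _)
qsh-sum (x ∷ a) (y ∷ b) ε ε∈ with ∈ₚ.∈-++⁻ (map (x ∷_) (qsh a (y ∷ b))) ε∈
... | inj₁ p with ∈ₚ.∈-map⁻ (x ∷_) p
...   | ε' , m , refl = trans (cong (x ℕ.+_) (qsh-sum a (y ∷ b) ε' m)) (sym (ℕₚ.+-assoc x (sum a) _))
qsh-sum (x ∷ a) (y ∷ b) ε ε∈ | inj₂ p with ∈ₚ.∈-++⁻ (map (y ∷_) (qsh (x ∷ a) b)) p
... | inj₁ q with ∈ₚ.∈-map⁻ (y ∷_) q
...   | ε' , m , refl = trans (cong (y ℕ.+_) (qsh-sum (x ∷ a) b ε' m)) (exchange y (x ℕ.+ sum a) (sum b))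
  where
  exchange : ∀ y s t → y ℕ.+ (s ℕ.+ t) ≡ s ℕ.+ (y ℕ.+ t)
  exchange y s t = trans (sym (ℕₚ.+-assoc y s t)) (trans (cong (ℕ._+ t) (ℕₚ.+-comm y s)) (ℕₚ.+-assoc s y t))
qsh-sum (x ∷ a) (y ∷ b) ε ε∈ | inj₂ p | inj₂ q with ∈ₚ.∈-map⁻ (x ℕ.+ y ∷_) q
... | ε' , m , refl = trans (cong (x ℕ.+ y ℕ.+_) (qsh-sum a b ε' m)) (ℕ-interchange x y (sum a) (sum b))
  where
  ℕ-interchange : ∀ x y s t → x ℕ.+ y ℕ.+ (s ℕ.+ t) ≡ x ℕ.+ s ℕ.+ (y ℕ.+ t)
  ℕ-interchange x y s t = trans (ℕₚ.+-assoc x y (s ℕ.+ t)) (trans (cong (x ℕ.+_) (trans (sym (ℕₚ.+-assoc y s t))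
    (trans (cong (ℕ._+ t) (ℕₚ.+-comm y s)) (ℕₚ.+-assoc s y t)))) (sym (ℕₚ.+-assoc x s (y ℕ.+ t))))

qsh-∷-nonempty : ∀ {x a y b} → [] ∉ qsh (x ∷ a) (y ∷ b)
qsh-∷-nonempty {x} {a} {y} {b} m with ∈ₚ.∈-++⁻ (map (x ∷_) (qsh a (y ∷ b))) m
... | inj₁ p = case ∈ₚ.∈-map⁻ (x ∷_) p of λ { (_ , _ , ()) }
... | inj₂ p with ∈ₚ.∈-++⁻ (map (y ∷_) (qsh (x ∷ a) b)) p
...   | inj₁ q = case ∈ₚ.∈-map⁻ (y ∷_) q of λ { (_ , _ , ()) }
...   | inj₂ q = case ∈ₚ.∈-map⁻ (x ℕ.+ y ∷_) q of λ { (_ , _ , ()) }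

qsh-nonemptyʳ : ∀ a {y b} → [] ∉ qsh a (y ∷ b)
qsh-nonemptyʳ []      (here ())
qsh-nonemptyʳ (x ∷ a) {y} {b} = qsh-∷-nonempty {x} {a} {y} {b}

qsh-nonemptyˡ : ∀ b {x a} → [] ∉ qsh (x ∷ a) b
qsh-nonemptyˡ []      (here ())
qsh-nonemptyˡ (y ∷ b) {x} {a} = qsh-∷-nonempty {x} {a} {y} {b}

δ-single-long : ∀ x ε n → ε ≢ [] → δ (x ∷ ε) (single n) ≡ 0ℚ
δ-single-long x ε zero    _ = refl
δ-single-long x ε (suc n) h = δ-≢ {x ∷ ε} {suc n ∷ []} (λ { refl → h refl })

-- Taking the coefficient of M_(n) is evaluation at (1,0,0,...), which is multiplicative. For
-- nonempty factors only the merged branch can leave a single part, and it does so exactly when both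
-- factors have one part.
qsh-single : ∀ α₁ α₂ p q → sum α₁ ≡ p → sum α₂ ≡ q → Positive α₁ → Positive α₂ →
  ∑ (qsh α₁ α₂) (λ ε → δ ε (single (p ℕ.+ q))) ≡ δ α₁ (single p) * δ α₂ (single q)
qsh-single []      α₂ _ q refl _ _ _ = trans (∑-[x] α₂ _) (sym (ℚₚ.*-identityˡ (δ α₂ (single q))))
qsh-single (x ∷ a) [] p _ e refl _ _ = trans (∑-[x] (x ∷ a) _) (trans (cong (λ k → δ (x ∷ a) (single k)) (ℕₚ.+-identityʳ p)) (sym (ℚₚ.*-identityʳ (δ (x ∷ a) (single p)))))
qsh-single (x ∷ a) (y ∷ b) p q e₁ e₂ P₁ P₂ = begin
  ∑ (qsh (x ∷ a) (y ∷ b)) (λ ε → δ ε (single (p ℕ.+ q)))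
    ≡⟨ ∑-qsh x a y b _ ⟩
  ∑ (qsh a (y ∷ b)) (λ ε → δ (x ∷ ε) (single (p ℕ.+ q))) + (∑ (qsh (x ∷ a) b) (λ ε → δ (y ∷ ε) (single (p ℕ.+ q))) + ∑ (qsh a b) (λ ε → δ (x ℕ.+ y ∷ ε) (single (p ℕ.+ q))))
    ≡⟨ cong₂ _+_ (Σ-0 (qsh a (y ∷ b)) (λ ε m → δ-single-long x ε (p ℕ.+ q) (λ { refl → qsh-nonemptyʳ a m })))
         (cong₂ _+_ (Σ-0 (qsh (x ∷ a) b) (λ ε m → δ-single-long y ε (p ℕ.+ q) (λ { refl → qsh-nonemptyˡ b m }))) (merged a b e₁ e₂ P₁ P₂)) ⟩
  0ℚ + (0ℚ + δ (x ∷ a) (single p) * δ (y ∷ b) (single q))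
    ≡⟨ trans (ℚₚ.+-identityˡ _) (ℚₚ.+-identityˡ _) ⟩
  δ (x ∷ a) (single p) * δ (y ∷ b) (single q) ∎
  where
  merged : ∀ a b → sum (x ∷ a) ≡ p → sum (y ∷ b) ≡ q → Positive (x ∷ a) → Positive (y ∷ b) →
    ∑ (qsh a b) (λ ε → δ (x ℕ.+ y ∷ ε) (single (p ℕ.+ q))) ≡ δ (x ∷ a) (single p) * δ (y ∷ b) (single q)
  merged [] [] refl refl (s≤s {n = x'} _ ∷ _) (s≤s {n = y'} _ ∷ _)
    rewrite ℕₚ.+-identityʳ x' | ℕₚ.+-identityʳ y' | ≡ᵇ-refl x' | ≡ᵇ-refl y' = trans (∑-[x] [] _) (δ-refl (suc (x' ℕ.+ suc y') ∷ []))
  merged (a' ∷ a) b _ _ _ _ = trans (Σ-0 (qsh (a' ∷ a) b) (λ ε m → δ-single-long (x ℕ.+ y) ε (p ℕ.+ q) (λ { refl → qsh-nonemptyˡ b m })))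
    (sym (0* (δ (y ∷ b) (single q)) (δ-single-long x (a' ∷ a) p (λ ()))))
  merged [] (b' ∷ b) _ _ _ _ = trans (Σ-0 (qsh [] (b' ∷ b)) (λ ε m → δ-single-long (x ℕ.+ y) ε (p ℕ.+ q) (λ { refl → qsh-nonemptyʳ [] m })))
    (sym (*0 (δ (x ∷ []) (single p)) (δ-single-long y (b' ∷ b) q (λ ()))))

-- Shuffling the segments of a word.

multiShuffle : List ℕ → List ℕ → List (List ℕ)
multiShuffle []      π = [] ∷ []
multiShuffle (b ∷ β) π = concatMap (shuffle (take b π)) (multiShuffle β (drop b π))

shuffle-letters : ∀ u v {w c} → w ∈ shuffle u v → c ∈ w → c ∈ u ⊎ c ∈ v
shuffle-letters []      v       (here refl) c∈ = inj₂ c∈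
shuffle-letters (a ∷ u) []      (here refl) c∈ = inj₁ c∈
shuffle-letters (a ∷ u) (b ∷ v) w∈ c∈ with ∈ₚ.∈-++⁻ (map (a ∷_) (shuffle u (b ∷ v))) w∈
... | inj₁ p with ∈ₚ.∈-map⁻ (a ∷_) p
shuffle-letters (a ∷ u) (b ∷ v) w∈ (here refl) | inj₁ p | w' , m , refl = inj₁ (here refl)
shuffle-letters (a ∷ u) (b ∷ v) w∈ (there c∈)  | inj₁ p | w' , m , refl with shuffle-letters u (b ∷ v) m c∈
... | inj₁ q = inj₁ (there q)
... | inj₂ q = inj₂ q
shuffle-letters (a ∷ u) (b ∷ v) w∈ c∈ | inj₂ p with ∈ₚ.∈-map⁻ (b ∷_) p
shuffle-letters (a ∷ u) (b ∷ v) w∈ (here refl) | inj₂ p | w' , m , refl = inj₂ (here refl)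
shuffle-letters (a ∷ u) (b ∷ v) w∈ (there c∈)  | inj₂ p | w' , m , refl with shuffle-letters (a ∷ u) v m c∈
... | inj₁ q = inj₁ q
... | inj₂ q = inj₂ (there q)

multiShuffle-letters : ∀ β π {w c} → w ∈ multiShuffle β π → c ∈ w → c ∈ π
multiShuffle-letters []      π (here refl) ()
multiShuffle-letters (b ∷ β) π w∈ c∈ with concatMap-∈ (shuffle (take b π)) (multiShuffle β (drop b π)) w∈
... | w' , w'∈ , m with shuffle-letters (take b π) w' m c∈
...   | inj₁ q = subst (_ ∈_) (Listₚ.take++drop≡id b π) (∈ₚ.∈-++⁺ˡ q)
...   | inj₂ q = subst (_ ∈_) (Listₚ.take++drop≡id b π) (∈ₚ.∈-++⁺ʳ (take b π) (multiShuffle-letters β (drop b π) w'∈ q))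

take-drop-apart : ∀ b π → Unique π → Apart (take b π) (drop b π)
take-drop-apart (suc b) (x ∷ π) (u ∷ us) (here refl) q = All.lookup u (subst (x ∈_) (Listₚ.take++drop≡id b π) (∈ₚ.∈-++⁺ʳ (take b π) q)) refl
take-drop-apart (suc b) (x ∷ π) (u ∷ us) (there p)   q = take-drop-apart b π us p q

length-take-≤ : ∀ b (π : List ℕ) s → b ℕ.+ s ≡ length π → length (take b π) ≡ b × length (drop b π) ≡ s
length-take-≤ b π s e =
  trans (Listₚ.length-take b π) (ℕₚ.m≤n⇒m⊓n≡m (subst (b ≤_) e (ℕₚ.m≤m+n b s))) ,
  trans (Listₚ.length-drop b π) (trans (cong (_∸ b) (sym e)) (ℕₚ.m+n∸m≡n b s))

-- The character of Φ on shuffles.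

module Character (Φ : Mat) (hopf : IsHopfEnd Φ) where

  open IsHopfEnd hopf
  open HopfEnd Φ hopf

  -- ζ G = Φ(G)(1,0,0,…)
  ζ : List ℕ → ℚ
  ζ α = Φ (single (sum α)) α

  -- `ζ` is Φ followed by evaluation at (1,0,0,...), a composite of algebra maps; `qsh-single` is
  -- the multiplicativity of the second.
  ζ-mult : ∀ p q β γ → β ∈ comps p → γ ∈ comps q → ∑ (qsh β γ) ζ ≡ ζ β * ζ γ
  ζ-mult p q β γ β∈ γ∈ = begin
    ∑ (qsh β γ) ζ
      ≡⟨ Σ-cong (qsh β γ) (λ ε ε∈ → cong (λ k → Φ (single k) ε) (trans (qsh-sum β γ ε ε∈) (cong₂ ℕ._+_ (comps-sum p β∈) (comps-sum q γ∈)))) ⟩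
    ∑ (qsh β γ) (λ ε → Φ (single (p ℕ.+ q)) ε)
      ≡⟨ sym (∑-def (qsh β γ) _) ⟩
    Σ[ qsh β γ ] (λ ε → Φ (single (p ℕ.+ q)) ε)
      ≡⟨ mult p q β γ (single (p ℕ.+ q)) β∈ γ∈ (single-∈ (p ℕ.+ q)) ⟩
    Σ[ comps p ] (λ α₁ → Σ[ comps q ] (λ α₂ → (Φ α₁ β * Φ α₂ γ) * Σ[ qsh α₁ α₂ ] (λ ε → δ ε (single (p ℕ.+ q)))))
      ≡⟨ trans (∑-def (comps p) _) (Σ-cong (comps p) (λ α₁ α₁∈ → trans (∑-def (comps q) _) (Σ-cong (comps q) (λ α₂ α₂∈ → trans
           (cong ((Φ α₁ β * Φ α₂ γ) *_) (trans (∑-def (qsh α₁ α₂) _)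
             (qsh-single α₁ α₂ p q (comps-sum p α₁∈) (comps-sum q α₂∈) (comps-positive p α₁∈) (comps-positive q α₂∈))))
           (solve 4 (λ a b c d → (a :* b) :* (c :* d) := (a :* c) :* (b :* d)) refl (Φ α₁ β) (Φ α₂ γ) (δ α₁ (single p)) (δ α₂ (single q))))))) ⟩
    ∑ (comps p) (λ α₁ → ∑ (comps q) (λ α₂ → (Φ α₁ β * δ α₁ (single p)) * (Φ α₂ γ * δ α₂ (single q))))
      ≡⟨ trans (Σ-ext (comps p) (λ α₁ → Σ-*ˡ (comps q) (Φ α₁ β * δ α₁ (single p)) _)) (Σ-*ʳ (comps p) _ _) ⟩
    ∑ (comps p) (λ α₁ → Φ α₁ β * δ α₁ (single p)) * ∑ (comps q) (λ α₂ → Φ α₂ γ * δ α₂ (single q))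
      ≡⟨ cong₂ _*_ (Σ-δʳ (λ α → Φ α β) (comps-unique p) (single-∈ p)) (Σ-δʳ (λ α → Φ α γ) (comps-unique q) (single-∈ q)) ⟩
    Φ (single p) β * Φ (single q) γ
      ≡⟨ cong₂ (λ i j → Φ (single i) β * Φ (single j) γ) (sym (comps-sum p β∈)) (sym (comps-sum q γ∈)) ⟩
    ζ β * ζ γ ∎

  -- `∑ (cuts w) ζ` is the value of `ζ` at F_{D(w)}, so this is the product rule pushed through the
  -- character.
  ζ-shuffle : ∀ u v → Apart u v → ∑ (shuffle u v) (λ w → ∑ (cuts w) ζ) ≡ ∑ (cuts u) ζ * ∑ (cuts v) ζ
  ζ-shuffle u v apart = begin
    ∑ (shuffle u v) (λ w → ∑ (cuts w) ζ)
      ≡⟨ ∑-shuffle-cuts (length u ℕ.+ length v) u v ℕₚ.≤-refl apart ζ ⟩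
    ∑ (cuts u) (λ β → ∑ (cuts v) (λ γ → ∑ (qsh β γ) ζ))
      ≡⟨ Σ-cong (cuts u) (λ β β∈ → trans (Σ-cong (cuts v) (λ γ γ∈ →
           ζ-mult (length u) (length v) β γ (cuts-⊆-comps u β β∈) (cuts-⊆-comps v γ γ∈))) (Σ-*ˡ (cuts v) (ζ β) ζ)) ⟩
    ∑ (cuts u) (λ β → ζ β * ∑ (cuts v) ζ)
      ≡⟨ Σ-*ʳ (cuts u) (∑ (cuts v) ζ) ζ ⟩
    ∑ (cuts u) ζ * ∑ (cuts v) ζ ∎

  -- Segment by segment: the first one contributes the row of `Φ` at (b), the others the row at `β`
  -- by induction. `comult` assembles both into the row at `b ∷ β`, and `fits` factors along the
  -- same cut.
  ∑-multiShuffle : ∀ β π → Positive β → sum β ≡ length π → Unique π →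
    ∑ (multiShuffle β π) (λ w → ∑ (cuts w) ζ) ≡ ∑ (comps (sum β)) (λ γ → Φ β γ * ind (fits γ π))
  ∑-multiShuffle []      []      _        _ _  = trans (∑-[x] [] _) (trans (∑-[x] [] ζ)
    (sym (trans (∑-[x] [] _) (ℚₚ.*-identityʳ (Φ [] [])))))
  ∑-multiShuffle (b ∷ β) π       (p ∷ ps) e π! = begin
    ∑ (multiShuffle (b ∷ β) π) (λ w → ∑ (cuts w) ζ)
      ≡⟨ Σ-concatMap (shuffle π₁) (multiShuffle β π₂) _ ⟩
    ∑ (multiShuffle β π₂) (λ w' → ∑ (shuffle π₁ w') (λ w → ∑ (cuts w) ζ))
      ≡⟨ Σ-cong (multiShuffle β π₂) (λ w' w'∈ → ζ-shuffle π₁ w' (λ c∈ c∈' → take-drop-apart b π π! c∈ (multiShuffle-letters β π₂ w'∈ c∈'))) ⟩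
    ∑ (multiShuffle β π₂) (λ w' → ∑ (cuts π₁) ζ * ∑ (cuts w') ζ)
      ≡⟨ Σ-*ˡ (multiShuffle β π₂) (∑ (cuts π₁) ζ) _ ⟩
    ∑ (cuts π₁) ζ * ∑ (multiShuffle β π₂) (λ w' → ∑ (cuts w') ζ)
      ≡⟨ cong₂ _*_ block (∑-multiShuffle β π₂ ps (sym len₂) π₂!) ⟩
    ∑ (comps b) (λ x → Φ (b ∷ []) x * ind (fits x π₁)) * ∑ (comps (sum β)) (λ y → Φ β y * ind (fits y π₂))
      ≡⟨ sym (trans (Σ-ext (comps b) (λ x → Σ-*ˡ (comps (sum β)) (Φ (b ∷ []) x * ind (fits x π₁)) _)) (Σ-*ʳ (comps b) _ _)) ⟩
    ∑ (comps b) (λ x → ∑ (comps (sum β)) (λ y → Φ (b ∷ []) x * ind (fits x π₁) * (Φ β y * ind (fits y π₂))))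
      ≡⟨ sym (∑-cutSum b (sum β) _) ⟩
    ∑ (comps (b ℕ.+ sum β)) (λ γ → cutSum (_≡ᵇ b) γ (λ x y → Φ (b ∷ []) x * ind (fits x π₁) * (Φ β y * ind (fits y π₂))))
      ≡⟨ Σ-cong (comps (b ℕ.+ sum β)) (λ γ γ∈ → sym (term γ γ∈)) ⟩
    ∑ (comps (b ℕ.+ sum β)) (λ γ → Φ (b ∷ β) γ * ind (fits γ π)) ∎
    where
    π₁ = take b π
    π₂ = drop b π
    len₁ = proj₁ (length-take-≤ b π (sum β) e)
    len₂ = proj₂ (length-take-≤ b π (sum β) e)
    π₂! = Uniqueₚ.drop⁺ b π!
    block : ∑ (cuts π₁) ζ ≡ ∑ (comps b) (λ x → Φ (b ∷ []) x * ind (fits x π₁))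
    block = trans (∑-cuts-fits π₁ ζ) (trans (cong (λ k → ∑ (comps k) (λ x → ζ x * ind (fits x π₁))) len₁)
      (Σ-cong (comps b) (λ x x∈ → cong (_* ind (fits x π₁)) (cong (λ l → Φ l x) (trans (cong single (comps-sum b x∈)) (single-pos p))))))
      where
      single-pos : ∀ {b} → 0 < b → single b ≡ b ∷ []
      single-pos {suc b} _ = refl
    term : ∀ γ → γ ∈ comps (b ℕ.+ sum β) → Φ (b ∷ β) γ * ind (fits γ π) ≡
      cutSum (_≡ᵇ b) γ (λ x y → Φ (b ∷ []) x * ind (fits x π₁) * (Φ β y * ind (fits y π₂)))
    term γ γ∈ = trans (cong (_* ind (fits γ π)) (comult-∷ b (sum β) β γ p (comps-complete (sum β) β ps refl) γ∈))
      (trans (sym (cutSum-*ʳ (_≡ᵇ b) γ (ind (fits γ π)) _)) (cutSum-cong (_≡ᵇ b) γ split))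
      where
      split : ∀ x y → x ++ y ≡ γ → (sum x ≡ᵇ b) ≡ true →
        Φ (b ∷ []) x * Φ β y * ind (fits γ π) ≡ Φ (b ∷ []) x * ind (fits x π₁) * (Φ β y * ind (fits y π₂))
      split x y refl s = trans (cong (λ t → Φ (b ∷ []) x * Φ β y * t)
          (trans (cong ind (trans (cong (fits (x ++ y)) (sym (Listₚ.take++drop≡id b π)))
            (fits-++ x y π₁ π₂ (Allₚ.++⁻ˡ x (comps-positive (b ℕ.+ sum β) γ∈)) (trans (≡ᵇ⇒≡ (sum x) b s) (sym len₁)))))
            (ind-∧ (fits x π₁) (fits y π₂))))
        (solve 4 (λ a c i j → a :* c :* (i :* j) := a :* i :* (c :* j)) refl (Φ (b ∷ []) x) (Φ β y) (ind (fits x π₁)) (ind (fits y π₂)))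

-- Permutations and the product of the descent algebra

Unique-↭ : ∀ {xs ys : List ℕ} → xs ↭ ys → Unique xs → Unique ys
Unique-↭ p = ↭ₛₚ.Unique-resp-↭ (setoid ℕ) (↭⇒↭ₛ p)

remove : List ℕ → List ℕ → List ℕ
remove u = filter (λ x → ¬? (x ∈? u))

remove-∈ : ∀ u {x w} → x ∈ u → remove u (x ∷ w) ≡ remove u w
remove-∈ u x∈ = Listₚ.filter-reject (λ x → ¬? (x ∈? u)) (λ x∉ → x∉ x∈)

remove-∉ : ∀ u {x w} → x ∉ u → remove u (x ∷ w) ≡ x ∷ remove u w
remove-∉ u x∉ = Listₚ.filter-accept (λ x → ¬? (x ∈? u)) x∉

remove-disjoint : ∀ u w → (∀ {x} → x ∈ w → x ∉ u) → remove u w ≡ w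
remove-disjoint u w h = Listₚ.filter-all (λ x → ¬? (x ∈? u)) (All.tabulate h)

-- Decreasing order, so that the recursion matches that of `perms`, which inserts the largest letter
-- last.
letters : ℕ → List ℕ
letters n = map suc (downFrom n)

letters-≤ : ∀ n {x} → x ∈ letters n → 0 < x × x ≤ n
letters-≤ (suc n) (here refl) = s≤s z≤n , ℕₚ.≤-refl
letters-≤ (suc n) (there p)   = proj₁ (letters-≤ n p) , ℕₚ.m≤n⇒m≤1+n (proj₂ (letters-≤ n p))

letters-∌ : ∀ n → suc n ∉ letters n
letters-∌ n p = ℕₚ.1+n≰n (proj₂ (letters-≤ n p))

letters-unique : ∀ n → Unique (letters n)
letters-unique zero    = []
letters-unique (suc n) = All.tabulate (λ p e → letters-∌ n (subst (_∈ letters n) (sym e) p)) ∷ letters-unique n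

length-letters : ∀ n → length (letters n) ≡ n
length-letters n = trans (Listₚ.length-map suc (downFrom n)) (Listₚ.length-downFrom n)

applyUpTo-suc-↭ : ∀ n → applyUpTo suc n ↭ letters n
applyUpTo-suc-↭ zero    = ↭-refl
applyUpTo-suc-↭ (suc n) = ↭-trans (↭-reflexive (sym (Listₚ.applyUpTo-∷ʳ suc n)))
  (↭-trans (↭-sym (↭ₚ.∷↭∷ʳ (suc n) (applyUpTo suc n))) (Perm.prep (suc n) (applyUpTo-suc-↭ n)))

insertAll-↭ : ∀ x w {σ} → σ ∈ insertAll x w → σ ↭ x ∷ w
insertAll-↭ x []      (here refl) = ↭-refl
insertAll-↭ x (y ∷ w) (here refl) = ↭-refl
insertAll-↭ x (y ∷ w) (there p) with ∈ₚ.∈-map⁻ (y ∷_) p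
... | σ , m , refl = Perm.trans (Perm.prep y (insertAll-↭ x w m)) (Perm.swap y x ↭-refl)

insertAll-∈ : ∀ x u v → u ++ x ∷ v ∈ insertAll x (u ++ v)
insertAll-∈ x []      []      = here refl
insertAll-∈ x []      (_ ∷ _) = here refl
insertAll-∈ x (y ∷ u) v       = there (∈ₚ.∈-map⁺ (y ∷_) (insertAll-∈ x u v))

insertAll-unique : ∀ x w → x ∉ w → Unique (insertAll x w)
insertAll-unique x []      _  = [] ∷ []
insertAll-unique x (y ∷ w) x∉ =
  All.tabulate (λ m e → case ∈ₚ.∈-map⁻ (y ∷_) m of λ { (_ , _ , refl) → x∉ (here (Listₚ.∷-injectiveˡ e)) })
  ∷ Uniqueₚ.map⁺ Listₚ.∷-injectiveʳ (insertAll-unique x w (x∉ ∘ there))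

insertAll-remove : ∀ x w {σ} → x ∉ w → σ ∈ insertAll x w → remove (x ∷ []) σ ≡ w
insertAll-remove x []      _  (here refl) = remove-∈ (x ∷ []) (here refl)
insertAll-remove x (y ∷ w) x∉ (here refl) = trans (remove-∈ (x ∷ []) (here refl))
  (remove-disjoint (x ∷ []) (y ∷ w) (λ { z∈ (here refl) → x∉ z∈ }))
insertAll-remove x (y ∷ w) x∉ (there p) with ∈ₚ.∈-map⁻ (y ∷_) p
... | σ , m , refl = trans (remove-∉ (x ∷ []) (λ { (here refl) → x∉ (here refl) }))
  (cong (y ∷_) (insertAll-remove x w (x∉ ∘ there) m))

perms-sound : ∀ n {σ} → σ ∈ perms n → σ ↭ letters n
perms-sound zero    (here refl) = ↭-refl
perms-sound (suc n) σ∈ with concatMap-∈ (insertAll (suc n)) (perms n) σ∈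
... | w , w∈ , m = ↭-trans (insertAll-↭ (suc n) w m) (Perm.prep (suc n) (perms-sound n w∈))

perms-complete : ∀ n {σ} → σ ↭ letters n → σ ∈ perms n
perms-complete zero    p = here (↭ₚ.↭-empty-inv p)
perms-complete (suc n) p with ∈ₚ.∈-∃++ (↭ₚ.∈-resp-↭ (↭-sym p) (here refl))
... | u , v , refl = ∈-concatMap (insertAll (suc n)) (perms n)
  (perms-complete n (↭ₚ.drop-∷ (↭-trans (↭-sym (↭ₚ.shift (suc n) u v)) p))) (insertAll-∈ (suc n) u v)

perms-∌ : ∀ n {w} → w ∈ perms n → suc n ∉ w
perms-∌ n w∈ p = letters-∌ n (↭ₚ.∈-resp-↭ (perms-sound n w∈) p)

perms-unique : ∀ n → Unique (perms n)
perms-unique zero    = [] ∷ []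
perms-unique (suc n) = concatMap-unique (insertAll (suc n)) (perms-unique n)
  (λ w w∈ → insertAll-unique (suc n) w (perms-∌ n w∈))
  (λ w w' σ w∈ w'∈ m m' → trans (sym (insertAll-remove (suc n) w (perms-∌ n w∈) m)) (insertAll-remove (suc n) w' (perms-∌ n w'∈) m'))

perms-letters-unique : ∀ n {σ} → σ ∈ perms n → Unique σ
perms-letters-unique n σ∈ = Unique-↭ (↭-sym (perms-sound n σ∈)) (letters-unique n)

perms-length : ∀ n {σ} → σ ∈ perms n → length σ ≡ n
perms-length n σ∈ = trans (↭ₚ.↭-length (perms-sound n σ∈)) (length-letters n)

-- Positions count from 1, in agreement with `at`; on the letters of a permutation `σ` this is σ⁻¹.
pos : List ℕ → ℕ → ℕ
pos []      x = 0
pos (y ∷ σ) x = if x ≡ᵇ y then 1 else suc (pos σ x)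

pos-here : ∀ x σ → pos (x ∷ σ) x ≡ 1
pos-here x σ rewrite ≡ᵇ-refl x = refl

pos-there : ∀ {x y} σ → x ≢ y → pos (y ∷ σ) x ≡ suc (pos σ x)
pos-there σ h rewrite ≡ᵇ-≢ h = refl

pos-suc : ∀ {x σ} → x ∈ σ → ∃ λ i → pos σ x ≡ suc i
pos-suc {x} {y ∷ σ} _ with x ≡ᵇ y
... | true  = 0 , refl
... | false = pos σ x , refl

at-pos : ∀ {x σ} → x ∈ σ → at σ (pos σ x) ≡ x
at-pos {x} {y ∷ σ} x∈ with x ℕ.≟ y
... | yes refl = cong (at (x ∷ σ)) (pos-here x σ)
at-pos {x} {y ∷ σ} (here e)   | no x≢y = contradiction e x≢y
at-pos {x} {y ∷ σ} (there x∈) | no x≢y with pos-suc x∈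
... | i , e = begin
  at (y ∷ σ) (pos (y ∷ σ) x)  ≡⟨ cong (at (y ∷ σ)) (trans (pos-there σ x≢y) (cong suc e)) ⟩
  at σ (suc i)                ≡⟨ cong (at σ) (sym e) ⟩
  at σ (pos σ x)              ≡⟨ at-pos x∈ ⟩
  x ∎

at-∈ : ∀ σ i → i < length σ → at σ (suc i) ∈ σ
at-∈ (x ∷ σ) zero    _       = here refl
at-∈ (x ∷ σ) (suc i) (s≤s p) = there (at-∈ σ i p)

pos-at : ∀ {σ} → Unique σ → ∀ i → i < length σ → pos σ (at σ (suc i)) ≡ suc i
pos-at {x ∷ σ} _        zero    _       = pos-here x σ
pos-at {x ∷ σ} (u ∷ us) (suc i) (s≤s p) =
  trans (pos-there σ (λ e → All.lookup u (at-∈ σ i p) (sym e))) (cong suc (pos-at us i p))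

map-cong-∈ : ∀ {f g : ℕ → ℕ} xs → (∀ x → x ∈ xs → f x ≡ g x) → map f xs ≡ map g xs
map-cong-∈ xs h = Listₚ.map-cong-local (All.tabulate (h _))

-- σ⁻¹σ is the identity word. As any permutation `π` rearranges `σ`, this makes `map (pos σ) π` a
-- permutation as well.
map-pos-self : ∀ {σ} → Unique σ → map (pos σ) σ ≡ applyUpTo suc (length σ)
map-pos-self {[]}    _        = refl
map-pos-self {x ∷ σ} (u ∷ us) = cong₂ _∷_ (pos-here x σ) (begin
  map (pos (x ∷ σ)) σ            ≡⟨ map-cong-∈ σ (λ y y∈ → pos-there σ (λ e → All.lookup u y∈ (sym e))) ⟩
  map (suc ∘ pos σ) σ            ≡⟨ Listₚ.map-∘ σ ⟩
  map suc (map (pos σ) σ)        ≡⟨ cong (map suc) (map-pos-self us) ⟩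
  map suc (applyUpTo suc (length σ)) ≡⟨ Listₚ.map-applyUpTo suc suc (length σ) ⟩
  applyUpTo (suc ∘ suc) (length σ) ∎)

-- For σ and π fixed, σ ∘ τ = π has the unique solution τ = σ⁻¹ ∘ π.
mulS-eval : ∀ n f g π → π ∈ perms n → mulS n f g π ≡ ∑ (perms n) (λ σ → f σ * g (map (pos σ) π))
mulS-eval n f g π π∈ = trans (∑-def (perms n) _) (Σ-cong (perms n) (λ σ σ∈ →
  trans (∑-def (perms n) _) (trans (Σ-single (perms-unique n) (quotient-∈ σ σ∈) (λ τ τ∈ τ≢ →
      ind-false* (f σ * g τ) (≢true (λ e → τ≢ (quotient-unique σ τ σ∈ τ∈ (eqL⇒≡ (compose σ τ) π e))))))
    (ind-true* (f σ * g (map (pos σ) π)) (trans (cong (λ ρ → eqL ρ π) (compose-quotient σ σ∈)) (eqL-refl π))))))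
  where
  π↭σ : ∀ {σ} → σ ∈ perms n → π ↭ σ
  π↭σ σ∈ = ↭-trans (perms-sound n π∈) (↭-sym (perms-sound n σ∈))
  quotient-∈ : ∀ σ → σ ∈ perms n → map (pos σ) π ∈ perms n
  quotient-∈ σ σ∈ = perms-complete n (↭-trans (↭ₚ.map⁺ (pos σ) (π↭σ σ∈))
    (↭-trans (↭-reflexive (trans (map-pos-self (perms-letters-unique n σ∈)) (cong (applyUpTo suc) (perms-length n σ∈)))) (applyUpTo-suc-↭ n)))
  compose-quotient : ∀ σ → σ ∈ perms n → compose σ (map (pos σ) π) ≡ π
  compose-quotient σ σ∈ = trans (sym (Listₚ.map-∘ π)) (trans (map-cong-∈ π (λ x x∈ → at-pos (↭ₚ.∈-resp-↭ (π↭σ σ∈) x∈))) (Listₚ.map-id π))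
  quotient-unique : ∀ σ τ → σ ∈ perms n → τ ∈ perms n → compose σ τ ≡ π → τ ≡ map (pos σ) π
  quotient-unique σ τ σ∈ τ∈ refl = sym (trans (sym (Listₚ.map-∘ τ)) (trans (map-cong-∈ τ inverse) (Listₚ.map-id τ)))
    where
    inverse : ∀ i → i ∈ τ → pos σ (at σ i) ≡ i
    inverse i i∈ with letters-≤ n (↭ₚ.∈-resp-↭ (perms-sound n τ∈) i∈)
    inverse (suc i) i∈ | _ , le = pos-at (perms-letters-unique n σ∈) i (subst (i <_) (sym (perms-length n σ∈)) le)

-- Shuffles described by positions of letters.

inc : (ℕ → ℕ) → List ℕ → Bool
inc p []          = true
inc p (x ∷ [])    = true
inc p (x ∷ y ∷ u) = (p x ≤?ᵇ p y) ∧ inc p (y ∷ u)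

fits-inc : ∀ p x u → fits (length (x ∷ u) ∷ []) (map p (x ∷ u)) ≡ inc p (x ∷ u)
fits-inc p x []      = refl
fits-inc p x (y ∷ u) = cong ((p x ≤?ᵇ p y) ∧_) (fits-inc p y u)

fits-cong : ∀ (p q : ℕ → ℕ) α π → (∀ x y → x ∈ π → y ∈ π → (p x ≤?ᵇ p y) ≡ (q x ≤?ᵇ q y)) → fits α (map p π) ≡ fits α (map q π)
fits-cong p q []                π           h = refl
fits-cong p q (zero ∷ α)        π           h = refl
fits-cong p q (suc a ∷ α)       []          h = refl
fits-cong p q (suc zero ∷ α)    (x ∷ π)     h = fits-cong p q α π (λ y z y∈ z∈ → h y z (there y∈) (there z∈))
fits-cong p q (suc (suc a) ∷ α) (x ∷ [])    h = refl
fits-cong p q (suc (suc a) ∷ α) (x ∷ y ∷ π) h = cong₂ _∧_ (h x y (here refl) (there (here refl)))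
  (fits-cong p q (suc a ∷ α) (y ∷ π) (λ z w z∈ w∈ → h z w (there z∈) (there w∈)))

inc-cong : ∀ p q u → (∀ x y → x ∈ u → y ∈ u → (p x ≤?ᵇ p y) ≡ (q x ≤?ᵇ q y)) → inc p u ≡ inc q u
inc-cong p q []          h = refl
inc-cong p q (x ∷ [])    h = refl
inc-cong p q (x ∷ y ∷ u) h = cong₂ _∧_ (h x y (here refl) (there (here refl)))
  (inc-cong p q (y ∷ u) (λ z w z∈ w∈ → h z w (there z∈) (there w∈)))

∈⇒≢ : ∀ {x y : ℕ} {u} → x ∈ u → y ∉ u → x ≢ y
∈⇒≢ x∈ y∉ refl = y∉ x∈

inc-skip : ∀ c σ u → c ∉ u → inc (pos (c ∷ σ)) u ≡ inc (pos σ) u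
inc-skip c σ u c∉ = inc-cong (pos (c ∷ σ)) (pos σ) u
  (λ x y x∈ y∈ → cong₂ _≤?ᵇ_ (pos-there σ (∈⇒≢ x∈ c∉)) (pos-there σ (∈⇒≢ y∈ c∉)))

inc-∷ : ∀ c σ u → c ∉ u → inc (pos (c ∷ σ)) (c ∷ u) ≡ inc (pos σ) u
inc-∷ c σ []      _  = refl
inc-∷ c σ (y ∷ u) c∉ = trans (cong (_∧ inc (pos (c ∷ σ)) (y ∷ u))
    (cong₂ _≤?ᵇ_ (pos-here c σ) (pos-there σ (∈⇒≢ (here refl) c∉))))
  (inc-skip c σ (y ∷ u) c∉)

inc-head : ∀ c σ u → (∀ {x} → x ∈ u → x ∈ c ∷ σ) → Unique u → inc (pos (c ∷ σ)) u ≡ true → c ∈ u → ∃ λ u' → u ≡ c ∷ u'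
inc-head c σ (x ∷ u)     ⊆σ _ e (here refl) = u , refl
inc-head c σ (x ∷ y ∷ u) ⊆σ ((x≢y ∷ x≢) ∷ us) e (there c∈)
  with inc-head c σ (y ∷ u) (⊆σ ∘ there) us (proj₂ (∧-split (pos (c ∷ σ) x ≤?ᵇ pos (c ∷ σ) y) e)) c∈
... | _ , refl = contradiction (trans (sym (proj₁ (∧-split (pos (c ∷ σ) x ≤?ᵇ pos (c ∷ σ) c) e))) later) (λ ())
  where
  later : (pos (c ∷ σ) x ≤?ᵇ pos (c ∷ σ) c) ≡ false
  later with ⊆σ (here refl)
  ... | here x≡c = contradiction x≡c x≢y
  ... | there x∈ = trans (cong₂ _≤?ᵇ_ (trans (pos-there σ x≢y) (cong suc (proj₂ (pos-suc x∈)))) (pos-here c σ)) refl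

shuffle-∷ˡ : ∀ c {u w} v → w ∈ shuffle u v → c ∷ w ∈ shuffle (c ∷ u) v
shuffle-∷ˡ c {u} []      w∈ with subst (_ ∈_) (shuffle-[]ʳ u) w∈
... | here refl = here refl
shuffle-∷ˡ c     (b ∷ v) w∈ = ∈ₚ.∈-++⁺ˡ (∈ₚ.∈-map⁺ (c ∷_) w∈)

shuffle-∷ʳ : ∀ c u {v w} → w ∈ shuffle u v → c ∷ w ∈ shuffle u (c ∷ v)
shuffle-∷ʳ c []          (here refl) = here refl
shuffle-∷ʳ c (a ∷ u) {v} w∈          = ∈ₚ.∈-++⁺ʳ (map (a ∷_) (shuffle u (c ∷ v))) (∈ₚ.∈-map⁺ (c ∷_) w∈)

-- `inc (pos σ) u` says that the letters of `u` occur in `σ` in the order of `u`; the other word of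
-- the shuffle is then what remains of `σ`. The first letter of `σ` either lies outside `u` or,
-- having position 1, must head it.
inc⇒shuffle : ∀ σ u → Unique σ → Unique u → (∀ {x} → x ∈ u → x ∈ σ) → inc (pos σ) u ≡ true → σ ∈ shuffle u (remove u σ)
inc⇒shuffle []      []      _ _ _  _ = here refl
inc⇒shuffle []      (x ∷ u) _ _ ⊆σ _ = case ⊆σ (here refl) of λ ()
inc⇒shuffle (c ∷ σ) u (c∉ ∷ σ!) u! ⊆σ e with c ∈? u
... | no c∉u = shuffle-∷ʳ c u (inc⇒shuffle σ u σ! u! tail-⊆ (trans (sym (inc-skip c σ u c∉u)) e))
  where
  tail-⊆ : ∀ {x} → x ∈ u → x ∈ σ
  tail-⊆ x∈ with ⊆σ x∈
  ... | here refl = contradiction x∈ c∉u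
  ... | there p   = p
... | yes c∈u with inc-head c σ u ⊆σ u! e c∈u
inc⇒shuffle (c ∷ σ) (c ∷ u) (c∉ ∷ σ!) (c∉u ∷ u!) ⊆σ e | yes c∈u | _ , refl =
  subst (λ v → c ∷ σ ∈ shuffle (c ∷ u) v) (sym remove≡)
    (shuffle-∷ˡ c (remove u σ) (inc⇒shuffle σ u σ! u! tail-⊆ (trans (sym (inc-∷ c σ u (λ p → All.lookup c∉u p refl))) e)))
  where
  tail-⊆ : ∀ {x} → x ∈ u → x ∈ σ
  tail-⊆ x∈ with ⊆σ (there x∈)
  ... | here refl = contradiction refl (All.lookup c∉u x∈)
  ... | there p   = p
  remove-cong : ∀ σ → (∀ {x} → x ∈ σ → c ≢ x) → remove (c ∷ u) σ ≡ remove u σ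
  remove-cong []      h = refl
  remove-cong (x ∷ σ) h = cases (x ∈? u)
    where
    cases : Dec (x ∈ u) → remove (c ∷ u) (x ∷ σ) ≡ remove u (x ∷ σ)
    cases (yes x∈) = trans (remove-∈ (c ∷ u) (there x∈)) (trans (remove-cong σ (h ∘ there)) (sym (remove-∈ u x∈)))
    cases (no x∉)  = trans (remove-∉ (c ∷ u) λ { (here x≡c) → h (here refl) (sym x≡c) ; (there p) → x∉ p })
      (trans (cong (x ∷_) (remove-cong σ (h ∘ there))) (sym (remove-∉ u x∉)))
  remove≡ : remove (c ∷ u) σ ≡ remove u σ
  remove≡ = remove-cong σ (All.lookup c∉)

inc-self : ∀ {u} → Unique u → inc (pos u) u ≡ true
inc-self {[]}    _        = refl
inc-self {a ∷ u} (a∉ ∷ us) = trans (inc-∷ a u u (λ p → All.lookup a∉ p refl)) (inc-self us)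

shuffle⇒inc : ∀ u v {w} → w ∈ shuffle u v → Unique u → Apart u v → inc (pos w) u ≡ true
shuffle⇒inc []      v       _           _  _ = refl
shuffle⇒inc (a ∷ u) []      (here refl) u! _ = inc-self u!
shuffle⇒inc (a ∷ u) (b ∷ v) w∈ (a∉ ∷ u!) apart with ∈ₚ.∈-++⁻ (map (a ∷_) (shuffle u (b ∷ v))) w∈
... | inj₁ p with ∈ₚ.∈-map⁻ (a ∷_) p
...   | w , m , refl = trans (inc-∷ a w u (λ q → All.lookup a∉ q refl)) (shuffle⇒inc u (b ∷ v) m u! (apart ∘ there))
shuffle⇒inc (a ∷ u) (b ∷ v) w∈ (a∉ ∷ u!) apart | inj₂ p with ∈ₚ.∈-map⁻ (b ∷_) p
... | w , m , refl = trans (inc-skip b w (a ∷ u) (λ q → apart q (here refl))) (shuffle⇒inc (a ∷ u) v m (a∉ ∷ u!) (λ p q → apart p (there q)))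

-- `U` is the whole first word and stays fixed while `u` shrinks in the recursion. Recovering `v`
-- from `w` is what keeps iterated shuffles free of repetitions.
shuffle-remove : ∀ U u v {w} → w ∈ shuffle u v → (∀ {x} → x ∈ u → x ∈ U) → Apart U v → remove U w ≡ v
shuffle-remove U []      v       (here refl) _  apart = remove-disjoint U v (λ p q → apart q p)
shuffle-remove U (a ∷ u) []      (here refl) ⊆U _     = Listₚ.filter-none (λ x → ¬? (x ∈? U)) (All.tabulate (λ p q → q (⊆U p)))
shuffle-remove U (a ∷ u) (b ∷ v) w∈ ⊆U apart with ∈ₚ.∈-++⁻ (map (a ∷_) (shuffle u (b ∷ v))) w∈
... | inj₁ p with ∈ₚ.∈-map⁻ (a ∷_) p
...   | w , m , refl = trans (remove-∈ U (⊆U (here refl))) (shuffle-remove U u (b ∷ v) m (⊆U ∘ there) apart)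
shuffle-remove U (a ∷ u) (b ∷ v) w∈ ⊆U apart | inj₂ p with ∈ₚ.∈-map⁻ (b ∷_) p
... | w , m , refl = trans (remove-∉ U (λ q → apart q (here refl))) (cong (b ∷_) (shuffle-remove U (a ∷ u) v m ⊆U (λ p q → apart p (there q))))

shuffle-unique : ∀ u v → Apart u v → Unique (shuffle u v)
shuffle-unique []      v       _     = [] ∷ []
shuffle-unique (a ∷ u) []      _     = [] ∷ []
shuffle-unique (a ∷ u) (b ∷ v) apart = Uniqueₚ.++⁺
  (Uniqueₚ.map⁺ Listₚ.∷-injectiveʳ (shuffle-unique u (b ∷ v) (apart ∘ there)))
  (Uniqueₚ.map⁺ Listₚ.∷-injectiveʳ (shuffle-unique (a ∷ u) v (λ p q → apart p (there q))))
  (λ (p , q) → case ∈ₚ.∈-map⁻ (a ∷_) p of λ { (_ , _ , refl) → case ∈ₚ.∈-map⁻ (b ∷_) q of λ { (_ , _ , e) →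
     apart (here refl) (here (Listₚ.∷-injectiveˡ e)) } })

shuffle-↭ : ∀ u v {w} → w ∈ shuffle u v → w ↭ u ++ v
shuffle-↭ []      v       (here refl) = ↭-refl
shuffle-↭ (a ∷ u) []      (here refl) = ↭-sym (↭ₚ.++-identityʳ (a ∷ u))
shuffle-↭ (a ∷ u) (b ∷ v) w∈ with ∈ₚ.∈-++⁻ (map (a ∷_) (shuffle u (b ∷ v))) w∈
... | inj₁ p with ∈ₚ.∈-map⁻ (a ∷_) p
...   | w , m , refl = Perm.prep a (shuffle-↭ u (b ∷ v) m)
shuffle-↭ (a ∷ u) (b ∷ v) w∈ | inj₂ p with ∈ₚ.∈-map⁻ (b ∷_) p
... | w , m , refl = ↭-trans (Perm.prep b (shuffle-↭ (a ∷ u) v m)) (↭-sym (↭ₚ.shift b (a ∷ u) v))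

pos-remove : ∀ u σ {x y} → x ∈ σ → y ∈ σ → x ∉ u → y ∉ u →
  (pos σ x ≤?ᵇ pos σ y) ≡ (pos (remove u σ) x ≤?ᵇ pos (remove u σ) y)
pos-remove u (c ∷ σ) {x} {y} x∈ y∈ x∉ y∉ with c ∈? u
... | yes c∈ = trans (cong₂ _≤?ᵇ_ (pos-there σ (x≢c x∉)) (pos-there σ (x≢c y∉)))
    (pos-remove u σ (tail x∈ (x≢c x∉)) (tail y∈ (x≢c y∉)) x∉ y∉)
  where
  x≢c : ∀ {x} → x ∉ u → x ≢ c
  x≢c x∉ refl = x∉ c∈
  tail : ∀ {x} → x ∈ c ∷ σ → x ≢ c → x ∈ σ
  tail (here e)  h = contradiction e h
  tail (there p) _ = p
... | no c∉ with x ℕ.≟ c | y ℕ.≟ c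
...   | yes refl | yes refl = trans (cong (λ k → k ≤?ᵇ k) (pos-here c σ)) (sym (cong (λ k → k ≤?ᵇ k) (pos-here c (remove u σ))))
...   | yes refl | no y≢c   = trans (cong₂ _≤?ᵇ_ (pos-here c σ) (pos-there σ y≢c))
    (sym (cong₂ _≤?ᵇ_ (pos-here c (remove u σ)) (pos-there (remove u σ) y≢c)))
pos-remove u (c ∷ σ) {x} {y} (here e) y∈ x∉ y∉ | no c∉ | no x≢c | yes refl = contradiction e x≢c
pos-remove u (c ∷ σ) {x} {y} (there x∈) y∈ x∉ y∉ | no c∉ | no x≢c | yes refl =
  trans (cong₂ _≤?ᵇ_ (trans (pos-there σ x≢c) (cong suc (proj₂ (pos-suc x∈)))) (pos-here c σ))
    (sym (cong₂ _≤?ᵇ_ (trans (pos-there (remove u σ) x≢c) (cong suc (proj₂ (pos-suc (∈ₚ.∈-filter⁺ (λ x → ¬? (x ∈? u)) x∈ x∉))))) (pos-here c (remove u σ))))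
pos-remove u (c ∷ σ) {x} {y} (here e) y∈ x∉ y∉ | no c∉ | no x≢c | no y≢c = contradiction e x≢c
pos-remove u (c ∷ σ) {x} {y} (there x∈) (here e) x∉ y∉ | no c∉ | no x≢c | no y≢c = contradiction e y≢c
pos-remove u (c ∷ σ) {x} {y} (there x∈) (there y∈) x∉ y∉ | no c∉ | no x≢c | no y≢c =
  trans (cong₂ _≤?ᵇ_ (pos-there σ x≢c) (pos-there σ y≢c)) (trans (pos-remove u σ x∈ y∈ x∉ y∉)
    (sym (cong₂ _≤?ᵇ_ (pos-there (remove u σ) x≢c) (pos-there (remove u σ) y≢c))))

multiShuffle-↭ : ∀ β π {w} → sum β ≡ length π → w ∈ multiShuffle β π → w ↭ π
multiShuffle-↭ []      []  _ (here refl) = ↭-refl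
multiShuffle-↭ (b ∷ β) π e w∈ with concatMap-∈ (shuffle (take b π)) (multiShuffle β (drop b π)) w∈
... | w' , w'∈ , m = ↭-trans (shuffle-↭ (take b π) w' m)
  (↭-trans (↭ₚ.++⁺ˡ (take b π) (multiShuffle-↭ β (drop b π) (sym (proj₂ (length-take-≤ b π (sum β) e))) w'∈))
    (↭-reflexive (Listₚ.take++drop≡id b π)))

multiShuffle-apart : ∀ b β π {w} → Unique π → w ∈ multiShuffle β (drop b π) → Apart (take b π) w
multiShuffle-apart b β π π! w∈ p q = take-drop-apart b π π! p (multiShuffle-letters β (drop b π) w∈ q)

multiShuffle-unique : ∀ β π → Unique π → Unique (multiShuffle β π)
multiShuffle-unique []      π _  = [] ∷ []
multiShuffle-unique (b ∷ β) π π! = concatMap-unique (shuffle (take b π)) (multiShuffle-unique β (drop b π) (Uniqueₚ.drop⁺ b π!))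
  (λ w w∈ → shuffle-unique (take b π) w (multiShuffle-apart b β π π! w∈))
  (λ w w' σ w∈ w'∈ m m' → trans (sym (shuffle-remove (take b π) (take b π) w m id (multiShuffle-apart b β π π! w∈)))
    (shuffle-remove (take b π) (take b π) w' m' id (multiShuffle-apart b β π π! w'∈)))

module Block (b : ℕ) (β π σ : List ℕ) (0<b : 0 < b) (β⁺ : Positive β) (e : sum (b ∷ β) ≡ length π) (π! : Unique π) (σ↭π : σ ↭ π) where

  π₁ = take b π
  π₂ = drop b π

  len₁ : length π₁ ≡ b
  len₁ = proj₁ (length-take-≤ b π (sum β) e)

  len₂ : length π₂ ≡ sum β
  len₂ = proj₂ (length-take-≤ b π (sum β) e)

  π₂! : Unique π₂
  π₂! = Uniqueₚ.drop⁺ b π!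

  π₁⊆σ : ∀ {x} → x ∈ π₁ → x ∈ σ
  π₁⊆σ p = ↭ₚ.∈-resp-↭ (↭-sym σ↭π) (subst (_ ∈_) (Listₚ.take++drop≡id b π) (∈ₚ.∈-++⁺ˡ p))

  π₂⊆σ : ∀ {x} → x ∈ π₂ → x ∈ σ
  π₂⊆σ p = ↭ₚ.∈-resp-↭ (↭-sym σ↭π) (subst (_ ∈_) (Listₚ.take++drop≡id b π) (∈ₚ.∈-++⁺ʳ π₁ p))

  remove-↭ : remove π₁ σ ↭ π₂
  remove-↭ = ↭-trans (↭ₚ.filter-↭ (λ x → ¬? (x ∈? π₁)) σ↭π) (↭-reflexive (begin
    remove π₁ π                ≡⟨ cong (remove π₁) (sym (Listₚ.take++drop≡id b π)) ⟩
    remove π₁ (π₁ ++ π₂)       ≡⟨ Listₚ.filter-++ (λ x → ¬? (x ∈? π₁)) π₁ π₂ ⟩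
    remove π₁ π₁ ++ remove π₁ π₂ ≡⟨ cong₂ _++_ (Listₚ.filter-none (λ x → ¬? (x ∈? π₁)) (All.tabulate (λ p q → q p)))
                                      (remove-disjoint π₁ π₂ (λ p q → take-drop-apart b π π! q p)) ⟩
    π₂ ∎))

  -- The later blocks compare only letters outside `π₁`, and deleting `π₁` from `σ` keeps their
  -- relative order. Since `fits` depends on comparisons alone, the condition separates into one on
  -- `π₁` and the same condition for shorter words.
  fits-split : fits (b ∷ β) (map (pos σ) π) ≡ inc (pos σ) π₁ ∧ fits β (map (pos (remove π₁ σ)) π₂)
  fits-split = begin
    fits (b ∷ β) (map (pos σ) π)
      ≡⟨ cong (fits (b ∷ β)) (trans (cong (map (pos σ)) (sym (Listₚ.take++drop≡id b π))) (Listₚ.map-++ (pos σ) π₁ π₂)) ⟩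
    fits ((b ∷ []) ++ β) (map (pos σ) π₁ ++ map (pos σ) π₂)
      ≡⟨ fits-++ (b ∷ []) β (map (pos σ) π₁) (map (pos σ) π₂) (0<b ∷ []) (trans (ℕₚ.+-identityʳ b) (trans (sym len₁) (sym (Listₚ.length-map (pos σ) π₁)))) ⟩
    fits (b ∷ []) (map (pos σ) π₁) ∧ fits β (map (pos σ) π₂)
      ≡⟨ cong₂ _∧_ (first π₁ len₁ 0<b)
           (fits-cong (pos σ) (pos (remove π₁ σ)) β π₂ (λ x y x∈ y∈ → pos-remove π₁ σ (π₂⊆σ x∈) (π₂⊆σ y∈)
             (λ p → take-drop-apart b π π! p x∈) (λ p → take-drop-apart b π π! p y∈))) ⟩
    inc (pos σ) π₁ ∧ fits β (map (pos (remove π₁ σ)) π₂) ∎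
    where
    first : ∀ u → length u ≡ b → 0 < b → fits (b ∷ []) (map (pos σ) u) ≡ inc (pos σ) u
    first (x ∷ u) refl _ = fits-inc (pos σ) x u

multiShuffle⇒fits : ∀ β π σ → Positive β → sum β ≡ length π → Unique π → σ ∈ multiShuffle β π → fits β (map (pos σ) π) ≡ true
multiShuffle⇒fits []      π σ _        _ _  _  = refl
multiShuffle⇒fits (b ∷ β) π σ (p ∷ ps) e π! σ∈
  with concatMap-∈ (shuffle (take b π)) (multiShuffle β (drop b π)) σ∈
... | w , w∈ , m = trans fits-split (cong₂ _∧_
  (shuffle⇒inc π₁ w m (Uniqueₚ.take⁺ b π!) (multiShuffle-apart b β π π! w∈))
  (trans (cong (λ ρ → fits β (map (pos ρ) π₂)) (shuffle-remove π₁ π₁ w m id (multiShuffle-apart b β π π! w∈)))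
    (multiShuffle⇒fits β π₂ w ps (sym len₂) π₂! w∈)))
  where open Block b β π σ p ps e π! (multiShuffle-↭ (b ∷ β) π e σ∈)

fits⇒multiShuffle : ∀ β π σ → Positive β → sum β ≡ length π → Unique π → σ ↭ π → fits β (map (pos σ) π) ≡ true → σ ∈ multiShuffle β π
fits⇒multiShuffle []      []  σ _        _ _  σ↭π _ = here (↭ₚ.↭-empty-inv σ↭π)
fits⇒multiShuffle (b ∷ β) π σ (p ∷ ps) e π! σ↭π f
  with ∧-split (inc (pos σ) (take b π)) (trans (sym (Block.fits-split b β π σ p ps e π! σ↭π)) f)
... | i , f' = ∈-concatMap (shuffle π₁) (multiShuffle β π₂)
  (fits⇒multiShuffle β π₂ (remove π₁ σ) ps (sym len₂) π₂! remove-↭ f')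
  (inc⇒shuffle σ π₁ (Unique-↭ (↭-sym σ↭π) π!) (Uniqueₚ.take⁺ b π!) π₁⊆σ i)
  where open Block b β π σ p ps e π! σ↭π

-- A permutation `σ` contributes `f σ` exactly when σ⁻¹π has descent composition at most `β`, that
-- is, when each segment of `π` cut out by `β` occurs in order in `σ`. These are the members of
-- `multiShuffle β π`, each listed once.
mulS-Xel : ∀ n f β π → β ∈ comps n → π ∈ perms n → mulS n f (Xel β) π ≡ ∑ (multiShuffle β π) f
mulS-Xel n f β π β∈ π∈ = begin
  mulS n f (Xel β) π
    ≡⟨ mulS-eval n f (Xel β) π π∈ ⟩
  ∑ (perms n) (λ σ → f σ * Xel β (map (pos σ) π))
    ≡⟨ Σ-cong (perms n) (λ σ σ∈ → trans (cong (f σ *_) (trans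
         (Xel-fits (map (pos σ) π) β∈ (trans (Listₚ.length-map (pos σ) π) (perms-length n π∈))) (indicator σ σ∈)))
         (sym (Σ-*ˡ (multiShuffle β π) (f σ) _))) ⟩
  ∑ (perms n) (λ σ → ∑ (multiShuffle β π) (λ w → f σ * δ σ w))
    ≡⟨ Σ-swap (perms n) (multiShuffle β π) _ ⟩
  ∑ (multiShuffle β π) (λ w → ∑ (perms n) (λ σ → f σ * δ σ w))
    ≡⟨ Σ-cong (multiShuffle β π) (λ w w∈ → Σ-δʳ f (perms-unique n)
         (perms-complete n (↭-trans (multiShuffle-↭ β π sum≡ w∈) (perms-sound n π∈)))) ⟩
  ∑ (multiShuffle β π) f ∎
  where
  β⁺ = comps-positive n β∈
  π! = perms-letters-unique n π∈
  sum≡ : sum β ≡ length π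
  sum≡ = trans (comps-sum n β∈) (sym (perms-length n π∈))
  indicator : ∀ σ → σ ∈ perms n → ind (fits β (map (pos σ) π)) ≡ ∑ (multiShuffle β π) (λ w → δ σ w)
  indicator σ σ∈ with fits β (map (pos σ) π) in e
  ... | true  = sym (trans (Σ-single (multiShuffle-unique β π π!)
      (fits⇒multiShuffle β π σ β⁺ sum≡ π! (↭-trans (perms-sound n σ∈) (↭-sym (perms-sound n π∈))) e)
      (λ w _ w≢σ → δ-≢ {σ} {w} (w≢σ ∘ sym))) (δ-refl σ))
  ... | false = sym (Σ-0 (multiShuffle β π) (λ w w∈ → δ-≢ {σ} {w} (λ { refl →
      case trans (sym e) (multiShuffle⇒fits β π σ β⁺ sum≡ π! w∈) of λ () })))

-- Descent compositions

descents : List ℕ → List ℕ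
descents []          = []
descents (x ∷ [])    = 1 ∷ []
descents (x ∷ y ∷ w) = if y <ᵇ x then 1 ∷ descents (y ∷ w) else incFirst (descents (y ∷ w))

descents-∈ : ∀ w → descents w ∈ comps (length w)
descents-∈ []          = here refl
descents-∈ (x ∷ [])    = here refl
descents-∈ (x ∷ y ∷ w) = ∈-concatMap (λ α → (1 ∷ α) ∷ incFirst α ∷ []) (comps (suc (length w))) (descents-∈ (y ∷ w)) (choice (y <ᵇ x))
  where
  choice : ∀ b {α} → (if b then 1 ∷ α else incFirst α) ∈ (1 ∷ α) ∷ incFirst α ∷ []
  choice true  = here refl
  choice false = there (here refl)

descents-head : ∀ x w → ∃ λ a → ∃ λ α → descents (x ∷ w) ≡ suc a ∷ α
descents-head x w = comps-head (length w) (descents-∈ (x ∷ w))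

partialFrom-1∷ : ∀ s a α → partialFrom s (1 ∷ a ∷ α) ≡ suc s ∷ partialFrom (suc s) (a ∷ α)
partialFrom-1∷ s a α rewrite ℕₚ.+-comm s 1 = refl

partialFrom-descents : ∀ s w → partialFrom s (descents w) ≡ desFrom (suc s) w
partialFrom-descents s []          = refl
partialFrom-descents s (x ∷ [])    = refl
partialFrom-descents s (x ∷ y ∷ w) with descents-head y w | partialFrom-descents (suc s) (y ∷ w)
... | a , α , e | ih rewrite e with y <ᵇ x
...   | true  = trans (partialFrom-1∷ s (suc a) α) (cong (suc s ∷_) ih)
...   | false = trans (partialFrom-suc s (suc a) α) ih

-- The partial sums stop before the total, so the last part is recovered from the equality of the
-- sums.
partialFrom-injective : ∀ s α β → Positive α → Positive β → sum α ≡ sum β → partialFrom s α ≡ partialFrom s β → α ≡ β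
partialFrom-injective s []          []          _ _ _ _ = refl
partialFrom-injective s []          (suc b ∷ β) _ _ () _
partialFrom-injective s []          (zero ∷ β)  _ (() ∷ _) _ _
partialFrom-injective s (suc a ∷ α) []          _ _ () _
partialFrom-injective s (zero ∷ α)  []          (() ∷ _) _ _ _
partialFrom-injective s (a ∷ [])    (b ∷ [])    _ _ e _ = cong (_∷ []) (ℕₚ.+-cancelʳ-≡ 0 a b e)
partialFrom-injective s (a ∷ a' ∷ α) (b ∷ b' ∷ β) (_ ∷ ps) (_ ∷ qs) e f
  with ℕₚ.+-cancelˡ-≡ s a b (Listₚ.∷-injectiveˡ f)
... | refl = cong (a ∷_) (partialFrom-injective (s ℕ.+ a) (a' ∷ α) (b' ∷ β) ps qs (ℕₚ.+-cancelˡ-≡ a (sum (a' ∷ α)) (sum (b' ∷ β)) e) (Listₚ.∷-injectiveʳ f))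

Yel-δ : ∀ n α σ → α ∈ comps n → length σ ≡ n → Yel α σ ≡ δ (descents σ) α
Yel-δ n α σ α∈ refl with descents σ ≟L α
... | inj₁ refl = trans (cong (λ d → ind (eqL d (setOf α))) (sym (partialFrom-descents 0 σ)))
  (trans (cong ind (eqL-refl (setOf α))) (sym (δ-refl α)))
... | inj₂ ≢α = trans (cong ind (eqL-≢ (λ e → ≢α (partialFrom-injective 0 (descents σ) α
    (comps-positive n (descents-∈ σ)) (comps-positive n α∈) (trans (comps-sum n (descents-∈ σ)) (sym (comps-sum n α∈)))
    (trans (partialFrom-descents 0 σ) e)))))
  (sym (δ-≢ ≢α))

descents-max : ∀ m x w → (∀ {y} → y ∈ x ∷ w → y < m) → descents (m ∷ x ∷ w) ≡ 1 ∷ descents (x ∷ w)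
descents-max m x w h rewrite T⇒≡ (ℕₚ.<⇒<ᵇ (h (here refl))) = refl

descents-min : ∀ m x w → (∀ {y} → y ∈ x ∷ w → m ≤ y) → descents (m ∷ x ∷ w) ≡ incFirst (descents (x ∷ w))
descents-min m x w h with x <ᵇ m in e
... | false = refl
... | true  = contradiction (ℕₚ.<ᵇ⇒< x m (≡⇒T e)) (ℕₚ.≤⇒≯ (h (here refl)))

descents-map-suc : ∀ w → descents (map suc w) ≡ descents w
descents-map-suc []          = refl
descents-map-suc (x ∷ [])    = refl
descents-map-suc (x ∷ y ∷ w) = cong (λ α → if y <ᵇ x then 1 ∷ α else incFirst α) (descents-map-suc (y ∷ w))

-- Prepending a new largest letter creates a descent, prepending a new smallest one an ascent.
descents-surjective : ∀ n α → α ∈ comps n → ∃ λ σ → σ ↭ letters n × descents σ ≡ α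
descents-surjective zero          _ (here refl) = [] , ↭-refl , refl
descents-surjective (suc zero)    _ (here refl) = 1 ∷ [] , ↭-refl , refl
descents-surjective (suc (suc n)) α α∈ = step (descents-surjective (suc n)) α α∈
  where
  step : (∀ β → β ∈ comps (suc n) → ∃ λ σ → σ ↭ letters (suc n) × descents σ ≡ β) →
         ∀ α → α ∈ comps (suc (suc n)) → ∃ λ σ → σ ↭ letters (suc (suc n)) × descents σ ≡ α
  step ih α α∈ with concatMap-∈ (λ α → (1 ∷ α) ∷ incFirst α ∷ []) (comps (suc n)) α∈
  ... | β , β∈ , z with ih β β∈
  step ih α α∈ | β , β∈ , z | [] , p , e = case ↭ₚ.↭-length p of λ ()
  step ih _ _ | β , β∈ , here refl | x ∷ w , p , refl =
    suc (suc n) ∷ x ∷ w , Perm.prep (suc (suc n)) p ,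
    descents-max (suc (suc n)) x w (λ y∈ → s≤s (proj₂ (letters-≤ (suc n) (↭ₚ.∈-resp-↭ p y∈))))
  step ih _ _ | β , β∈ , there (here refl) | x ∷ w , p , refl =
    1 ∷ map suc (x ∷ w) ,
    ↭-trans (Perm.prep 1 (↭ₚ.map⁺ suc (↭-trans p (↭-sym (applyUpTo-suc-↭ (suc n))))))
      (↭-trans (↭-reflexive (cong (1 ∷_) (Listₚ.map-applyUpTo suc suc (suc n)))) (applyUpTo-suc-↭ (suc (suc n)))) ,
    trans (descents-min 1 (suc x) (map suc w) (λ y∈ → case ∈ₚ.∈-map⁻ suc y∈ of λ { (_ , _ , refl) → s≤s z≤n }))
      (cong incFirst (descents-map-suc (x ∷ w)))

fits-descents : ∀ w → fits (descents w) w ≡ true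
fits-descents []          = refl
fits-descents (x ∷ [])    = refl
fits-descents (x ∷ y ∷ w) with descents-head y w | fits-descents (y ∷ w)
... | a , α , e | ih rewrite e with y <ᵇ x in lt
...   | true  = ih
...   | false = trans (cong (λ b → not b ∧ fits (suc a ∷ α) (y ∷ w)) lt) ih

length-incFirst : ∀ α → length (incFirst α) ≡ length α
length-incFirst []      = refl
length-incFirst (a ∷ α) = refl

-- Supplies the triangularity of X with respect to Y: a descent composition below `β` and different
-- from it has fewer parts.
fits⇒descents : ∀ β w → Positive β → sum β ≡ length w → fits β w ≡ true → descents w ≡ β ⊎ length (descents w) < length β
fits⇒descents []                     []          _ _ _ = inj₁ refl
fits⇒descents (suc zero ∷ [])        (x ∷ [])    _ _ _ = inj₁ refl
fits⇒descents (suc zero ∷ suc b ∷ β) (x ∷ [])    _ () _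
fits⇒descents (suc zero ∷ zero ∷ β)  (x ∷ [])    (_ ∷ () ∷ _) _ _
fits⇒descents (suc zero ∷ β)         (x ∷ y ∷ w) (_ ∷ ps) e f
  with y <ᵇ x | fits⇒descents β (y ∷ w) ps (ℕₚ.suc-injective e) f
... | true  | inj₁ eq = inj₁ (cong (1 ∷_) eq)
... | true  | inj₂ lt = inj₂ (s≤s lt)
... | false | inj₁ eq = inj₂ (s≤s (ℕₚ.≤-reflexive (trans (length-incFirst (descents (y ∷ w))) (cong length eq))))
... | false | inj₂ lt = inj₂ (ℕₚ.≤-trans (ℕₚ.≤-reflexive (cong suc (length-incFirst (descents (y ∷ w))))) (ℕₚ.m≤n⇒m≤1+n lt))
fits⇒descents (suc (suc a) ∷ β)      (x ∷ [])    _ _ ()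
fits⇒descents (suc (suc a) ∷ β)      (x ∷ y ∷ w) (_ ∷ ps) e f
  with fits⇒descents (suc a ∷ β) (y ∷ w) (s≤s z≤n ∷ ps) (ℕₚ.suc-injective e) (proj₂ (∧-split (x ≤?ᵇ y) f))
     | y <ᵇ x | proj₁ (∧-split (x ≤?ᵇ y) f)
... | inj₁ eq | false | _ = inj₁ (cong incFirst eq)
... | inj₂ lt | false | _ = inj₂ (ℕₚ.≤-trans (ℕₚ.≤-reflexive (cong suc (length-incFirst (descents (y ∷ w))))) lt)

-- Transition between X and Y.

coarser : Mat
coarser β α = ind (subsetB (setOf α) (setOf β))

coarser-descents : ∀ β σ → coarser β (descents σ) ≡ Xel β σ
coarser-descents β σ = cong (λ d → ind (subsetB d (setOf β))) (partialFrom-descents 0 σ)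

-- Every composition is the descent composition of a permutation, so the order on compositions can
-- be tested along a word by `fits`.
coarser-fits : ∀ n β α → β ∈ comps n → α ∈ comps n → ∃ λ σ → length σ ≡ n × descents σ ≡ α × coarser β α ≡ ind (fits β σ)
coarser-fits n β α β∈ α∈ with descents-surjective n α α∈
... | σ , p , refl = σ , len , refl , trans (coarser-descents β σ) (Xel-fits σ β∈ len)
  where
  len : length σ ≡ n
  len = trans (↭ₚ.↭-length p) (length-letters n)

comps-length-≤ : ∀ n {α} → α ∈ comps n → length α ≤ n
comps-length-≤ n {α} α∈ = subst (length α ≤_) (comps-sum n α∈) (length≤sum (comps-positive n α∈))

-- Apart from Y_β itself, X_β involves only Y_α with `α` shorter than `β`, whereas `UpperTriangular`
-- asks heights to grow from row to column; hence the height `n ∸ length γ`.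
coarser-invertible : ∀ n → Invertible (comps n) (comps-unique n) coarser
coarser-invertible n = unitriangular-invertible (comps n) (comps-unique n) (λ γ → n ∸ length γ) n
  (λ α _ → ℕₚ.m∸n≤m n (length α)) coarser diag upper
  where
  diag : ∀ α → α ∈ comps n → coarser α α ≡ 1ℚ
  diag α α∈ with coarser-fits n α α α∈ α∈
  ... | σ , _ , refl , e = trans e (cong ind (fits-descents σ))
  upper : Triangular.UpperTriangular (comps n) (comps-unique n) (λ γ → n ∸ length γ) coarser
  upper β α β∈ α∈ β≢α ≮ with coarser-fits n β α β∈ α∈
  ... | σ , len , refl , e = trans e (cong ind (≢true not-fits))
    where
    not-fits : fits β σ ≢ true
    not-fits f with fits⇒descents β σ (comps-positive n β∈) (trans (comps-sum n β∈) (sym len)) f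
    ... | inj₁ eq = β≢α (sym eq)
    ... | inj₂ lt = ≮ (ℕₚ.∸-monoʳ-< lt (comps-length-≤ n β∈))

Xel-Yel : ∀ n β σ → σ ∈ perms n → Xel β σ ≡ lin (comps n) (coarser β) Yel σ
Xel-Yel n β σ σ∈ = sym (begin
  lin (comps n) (coarser β) Yel σ
    ≡⟨ lin-∑ (comps n) (coarser β) Yel σ ⟩
  ∑ (comps n) (λ α → coarser β α * Yel α σ)
    ≡⟨ Σ-cong (comps n) (λ α α∈ → cong (coarser β α *_) (trans (Yel-δ n α σ α∈ (perms-length n σ∈)) (δ-sym (descents σ) α))) ⟩
  ∑ (comps n) (λ α → coarser β α * δ α (descents σ))
    ≡⟨ Σ-δʳ (coarser β) (comps-unique n) (subst (λ k → descents σ ∈ comps k) (perms-length n σ∈) (descents-∈ σ)) ⟩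
  coarser β (descents σ)
    ≡⟨ coarser-descents β σ ⟩
  Xel β σ ∎)

-- Evaluation at a permutation with descent composition `γ` isolates the coefficient `a γ`, and
-- `descents-surjective` supplies such a permutation.
Yel-independent : ∀ n a → lin (comps n) a Yel ≈[ perms n ] zeroV → ∀ γ → γ ∈ comps n → a γ ≡ 0ℚ
Yel-independent n a a≈0 γ γ∈ with descents-surjective n γ γ∈
... | σ , p , refl = begin
  a γ                                       ≡⟨ sym (Σ-δʳ a (comps-unique n) γ∈) ⟩
  ∑ (comps n) (λ α → a α * δ α γ)           ≡⟨ Σ-cong (comps n) (λ α α∈ → cong (a α *_) (trans (δ-sym α γ) (sym (Yel-δ n α σ α∈ (perms-length n σ∈))))) ⟩
  ∑ (comps n) (λ α → a α * Yel α σ)         ≡⟨ sym (lin-∑ (comps n) a Yel σ) ⟩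
  lin (comps n) a Yel σ                     ≡⟨ a≈0 σ σ∈ ⟩
  0ℚ ∎
  where
  σ∈ = perms-complete n p

mulS-cong : ∀ n f {g g'} π → (∀ τ → τ ∈ perms n → g τ ≡ g' τ) → mulS n f g π ≡ mulS n f g' π
mulS-cong n f {g} {g'} π h = trans (∑-def (perms n) _) (trans (Σ-ext (perms n) (λ σ →
  trans (∑-def (perms n) _) (trans (Σ-cong (perms n) (λ τ τ∈ → cong (λ q → ind (eqL (compose σ τ) π) * (f σ * q)) (h τ τ∈)))
    (sym (∑-def (perms n) _))))) (sym (∑-def (perms n) _)))

mulS-lin : ∀ n f I a gen π → π ∈ perms n → mulS n f (lin I a gen) π ≡ lin I a (λ γ → mulS n f (gen γ)) π
mulS-lin n f I a gen π π∈ = begin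
  mulS n f (lin I a gen) π
    ≡⟨ mulS-eval n f (lin I a gen) π π∈ ⟩
  ∑ (perms n) (λ σ → f σ * lin I a gen (map (pos σ) π))
    ≡⟨ Σ-ext (perms n) (λ σ → trans (cong (f σ *_) (lin-∑ I a gen (map (pos σ) π))) (trans (sym (Σ-*ˡ I (f σ) _))
         (Σ-ext I (λ γ → solve 3 (λ x y z → x :* (y :* z) := y :* (x :* z)) refl (f σ) (a γ) (gen γ (map (pos σ) π)))))) ⟩
  ∑ (perms n) (λ σ → ∑ I (λ γ → a γ * (f σ * gen γ (map (pos σ) π))))
    ≡⟨ Σ-swap (perms n) I _ ⟩
  ∑ I (λ γ → ∑ (perms n) (λ σ → a γ * (f σ * gen γ (map (pos σ) π))))
    ≡⟨ Σ-ext I (λ γ → trans (Σ-*ˡ (perms n) (a γ) _) (cong (a γ *_) (sym (mulS-eval n f (gen γ) π π∈)))) ⟩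
  ∑ I (λ γ → a γ * mulS n f (gen γ) π)
    ≡⟨ sym (lin-∑ I a (λ γ → mulS n f (gen γ)) π) ⟩
  lin I a (λ γ → mulS n f (gen γ)) π ∎

-- Left multiplication by (X^Φ)_n.

module _ (Φ : Mat) (hopf : IsHopfEnd Φ) where

  open Character Φ hopf

  XPhi-cuts : ∀ n w → length w ≡ n → XPhi Φ n w ≡ ∑ (cuts w) ζ
  XPhi-cuts n w refl = trans (lin-∑ (comps n) (Φ (single n)) Xel w) (sym (trans (∑-cuts-fits w ζ)
    (Σ-cong (comps n) (λ α α∈ → cong₂ _*_ (cong (λ k → Φ (single k) α) (comps-sum n α∈)) (sym (Xel-fits w α∈ refl))))))

  -- Left multiplication by (X^Φ)_n is dual to Φ_n.
  mulS-XPhi : ∀ n β π → β ∈ comps n → π ∈ perms n → mulS n (XPhi Φ n) (Xel β) π ≡ lin (comps n) (Φ β) Xel π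
  mulS-XPhi n β π β∈ π∈ = begin
    mulS n (XPhi Φ n) (Xel β) π
      ≡⟨ mulS-Xel n (XPhi Φ n) β π β∈ π∈ ⟩
    ∑ (multiShuffle β π) (XPhi Φ n)
      ≡⟨ Σ-cong (multiShuffle β π) (λ w w∈ → XPhi-cuts n w (trans (↭ₚ.↭-length (multiShuffle-↭ β π sum≡ w∈)) (perms-length n π∈))) ⟩
    ∑ (multiShuffle β π) (λ w → ∑ (cuts w) ζ)
      ≡⟨ ∑-multiShuffle β π (comps-positive n β∈) sum≡ (perms-letters-unique n π∈) ⟩
    ∑ (comps (sum β)) (λ γ → Φ β γ * ind (fits γ π))
      ≡⟨ cong (λ k → ∑ (comps k) (λ γ → Φ β γ * ind (fits γ π))) (comps-sum n β∈) ⟩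
    ∑ (comps n) (λ γ → Φ β γ * ind (fits γ π))
      ≡⟨ Σ-cong (comps n) (λ γ γ∈ → cong (Φ β γ *_) (sym (Xel-fits π γ∈ (perms-length n π∈)))) ⟩
    ∑ (comps n) (λ γ → Φ β γ * Xel γ π)
      ≡⟨ sym (lin-∑ (comps n) (Φ β) Xel π) ⟩
    lin (comps n) (Φ β) Xel π ∎
    where
    sum≡ : sum β ≡ length π
    sum≡ = trans (comps-sum n β∈) (sym (perms-length n π∈))

  -- The rows of `L` are eigenvectors in X-coordinates, while 𝒟_n is given by the family Y.
  -- `coarser` converts them, and its inverse together with `R` inverts the product.
  XPhi-diagonalizable : ∀ n μ → Matrices.Eigenbases (comps n) (comps-unique n) Φ μ →
    Diagonalizable (comps n) Yel (perms n) (mulS n (XPhi Φ n))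
  XPhi-diagonalizable n μ eigen = diagonalizable I I! {T = mulS n (XPhi Φ n)} {P = L ⊗ coarser} {Q = inverse ⊗ R} μ
    (λ α β α∈ β∈ → trans (cancel-middle L R inverseʳ α β α∈ β∈) (LR α β α∈ β∈))
    (λ α β α∈ β∈ → trans (cancel-middle inverse coarser RL α β α∈ β∈) (inverseˡ α β α∈ β∈))
    (Yel-independent n)
    (λ γ γ∈ π π∈ → begin
      mulS n (XPhi Φ n) (lin I ((L ⊗ coarser) γ) Yel) π
        ≡⟨ mulS-cong n (XPhi Φ n) π (λ τ τ∈ → sym (lin-Xel γ τ τ∈)) ⟩
      mulS n (XPhi Φ n) (lin I (L γ) Xel) π
        ≡⟨ mulS-lin n (XPhi Φ n) I (L γ) Xel π π∈ ⟩
      lin I (L γ) (λ β → mulS n (XPhi Φ n) (Xel β)) π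
        ≡⟨ lin-cong-gen (L γ) (λ β → mulS n (XPhi Φ n) (Xel β)) (λ β → lin I (Φ β) Xel) π (λ β β∈ → mulS-XPhi n β π β∈ π∈) ⟩
      lin I (L γ) (λ β → lin I (Φ β) Xel) π
        ≡⟨ lin-lin I I! (L γ) Φ Xel π ⟩
      lin I ((L ⊗ Φ) γ) Xel π
        ≡⟨ lin-cong I I! Xel π (λ β β∈ → LA γ β γ∈ β∈) ⟩
      lin I (λ β → μ γ * L γ β) Xel π
        ≡⟨ trans (lin-∑ I (λ β → μ γ * L γ β) Xel π) (trans (Σ-ext I (λ β → ℚₚ.*-assoc (μ γ) (L γ β) (Xel β π))) (Σ-*ˡ I (μ γ) _)) ⟩
      μ γ * ∑ I (λ β → L γ β * Xel β π)
        ≡⟨ cong (μ γ *_) (trans (sym (lin-∑ I (L γ) Xel π)) (lin-Xel γ π π∈)) ⟩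
      μ γ * lin I ((L ⊗ coarser) γ) Yel π ∎)
    where
    I  = comps n
    I! = comps-unique n
    open Matrices I I!
    open Eigenbases eigen
    open Invertible (coarser-invertible n)
    lin-cong-gen : ∀ a (g g' : List ℕ → Vect) x → (∀ γ → γ ∈ I → g γ x ≡ g' γ x) → lin I a g x ≡ lin I a g' x
    lin-cong-gen a g g' x h = trans (lin-∑ I a g x) (trans (Σ-cong I (λ γ γ∈ → cong (a γ *_) (h γ γ∈))) (sym (lin-∑ I a g' x)))
    lin-Xel : ∀ γ σ → σ ∈ perms n → lin I (L γ) Xel σ ≡ lin I ((L ⊗ coarser) γ) Yel σ
    lin-Xel γ σ σ∈ = trans (lin-cong-gen (L γ) Xel (λ β → lin I (coarser β) Yel) σ (λ β _ → Xel-Yel n β σ σ∈)) (lin-lin I I! (L γ) coarser Yel σ)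

theorem4p3 : (Φ : Mat) → IsHopfEnd Φ → (n : ℕ) →
    (∀ m → 1 ≤ m → m ≤ n → lam Φ m ≢ 0ℚ →
      ∀ β → β ∈ comps m → β ≢ (m ∷ Data.List.[]) → lam Φ m ≢ lamC Φ β) →
    HasRank (comps n) unitV (comps n) (applyΦ Φ n) (nonzeroCount Φ n) →
    Diagonalizable (comps n) unitV (comps n) (applyΦ Φ n)
      × Diagonalizable (comps n) Yel (perms n) (mulS n (XPhi Φ n))
theorem4p3 Φ hopf n separated rank =
  Φ-diagonalizable , XPhi-diagonalizable Φ hopf n (lamC Φ) Φ-eigenbases
  where open Spectrum Φ hopf n separated rank
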